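{- Let $r$ be an integer with $2 \leq r \leq 26$. Then there exists $n_0$ such that, for every $n \geq n_0$ and every graph $G$ on $n$ vertices, $$c_{r,K_3^{(2)}}(G) \leq r^{\mathrm{ex}(n,K_3)}.$$ Moreover, for $n \geq n_0$, equality holds if and only if $G$ is isomorphic to the bipartite Tur\'an graph $T_2(n)$.
   Context: An $r$-edge-coloring of a graph $G$ is any map $E(G)\to[r]=\{1,\dots,r\}$ (not necessarily proper). $K_3^{(2)}$ denotes the color pattern of the triangle in which exactly two distinct colors appear (two edges share a color and the third edge has a different color). A coloring is $K_3^{(2)}$-free if $G$ contains no triangle whose three edges receive exactly two distinct colors. $c_{r,K_3^{(2)}}(G)$ is the number of $K_3^{(2)}$-free $r$-edge-colorings of $G$. $\mathrm{ex}(n,K_3)=\lfloor n^2/4\rfloor$ is the maximum number of edges of a triangle-free $n$-vertex graph, and $T_2(n)$ is the complete bipartite graph on $n$ vertices with parts of sizes $\lfloor n/2\rfloor$ and $\lceil n/2\rceil$. -}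

module Defs where

open import Data.Nat using (ℕ; zero; suc; _*_; _/_; _<ᵇ_)
open import Data.Bool using (Bool; true; false; _xor_; _∧_; if_then_else_)
open import Data.Fin using (Fin; toℕ; _≟_)
open import Data.Fin.Properties using (_≟_)
open import Data.List using (List; []; _∷_; length; filter; allFin; concatMap; map; zip)
open import Data.Maybe using (Maybe; just; nothing)
import Data.Maybe.Properties as MP
open import Data.Vec using (Vec; []; _∷_; toList)
open import Data.Product using (_×_; _,_; Σ)
open import Relation.Binary.PropositionalEquality using (_≡_)
open import Relation.Nullary using (¬_; Dec; yes; no)
open import Relation.Nullary.Decidable using (⌊_⌋)
open import Function.Bundles using (_↔_; Inverse)

record Graph (n : ℕ) : Set where
  field
    adj    : Fin n → Fin n → Bool
    sym    : ∀ i j → adj i j ≡ adj j i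
    irrefl : ∀ i → adj i i ≡ false
open Graph public

_≅_ : ∀ {n m} → Graph n → Graph m → Set
_≅_ {n} {m} G H = Σ (Fin n ↔ Fin m) λ σ →
  ∀ i j → adj G i j ≡ adj H (Inverse.to σ i) (Inverse.to σ j)

-- ex(n, K₃) = ⌊n²/4⌋ (Mantel), as fixed in the context.
exK3 : ℕ → ℕ
exK3 n = (n * n) / 4

private
  inA : ∀ {n} → Fin n → Bool
  inA {n} i = toℕ i <ᵇ (n / 2)

T2 : (n : ℕ) → Graph n
T2 n = record { adj = λ i j → inA i xor inA j ; sym = sym' ; irrefl = irr }
  where
  sym' : ∀ i j → (inA {n} i xor inA j) ≡ (inA j xor inA i)
  sym' i j with inA {n} i | inA {n} j
  ... | false | false = _≡_.refl
  ... | false | true  = _≡_.refl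
  ... | true  | false = _≡_.refl
  ... | true  | true  = _≡_.refl
  irr : ∀ i → (inA {n} i xor inA i) ≡ false
  irr i with inA {n} i
  ... | false = _≡_.refl
  ... | true  = _≡_.refl

pairs : (n : ℕ) → List (Fin n × Fin n)
pairs n = concatMap (λ i → map (λ j → i , j) (allFin n)) (allFin n)

edges : ∀ {n} → Graph n → List (Fin n × Fin n)
edges {n} G = filter (λ p → Data.Bool.T? (lt p ∧ adj G (Data.Product.proj₁ p) (Data.Product.proj₂ p))) (pairs n)
  where
  lt : Fin n × Fin n → Bool
  lt (i , j) = toℕ i <ᵇ toℕ j

allVecs : (r m : ℕ) → List (Vec (Fin r) m)
allVecs r zero    = [] ∷ []
allVecs r (suc m) = concatMap (λ c → map (c ∷_) (allVecs r m)) (allFin r)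

Colouring : (r : ℕ) → ∀ {n} → Graph n → Set
Colouring r G = Vec (Fin r) (length (edges G))

-- Colour of the edge {i , j} (i < j) in a colouring given as an
-- association list (nothing for non-edges, which are never queried).
lookupCol : ∀ {r n} → List ((Fin n × Fin n) × Fin r) → Fin n → Fin n → Maybe (Fin r)
lookupCol [] i j = nothing
lookupCol (((a , b) , c) ∷ xs) i j =
  if ⌊ a ≟ i ⌋ ∧ ⌊ b ≟ j ⌋ then just c else lookupCol xs i j

allB : ∀ {A : Set} → (A → Bool) → List A → Bool
allB p []       = true
allB p (x ∷ xs) = p x ∧ allB p xs

exactlyTwo : ∀ {r} → Maybe (Fin r) → Maybe (Fin r) → Maybe (Fin r) → Bool
exactlyTwo a b c with ⌊ MP.≡-dec _≟_ a b ⌋ | ⌊ MP.≡-dec _≟_ a c ⌋ | ⌊ MP.≡-dec _≟_ b c ⌋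
... | true  | true  | true  = false
... | false | false | false = false
... | _     | _     | _     = true

triangles : ∀ {n} → Graph n → List (Fin n × Fin n × Fin n)
triangles {n} G = filter (λ t → Data.Bool.T? (ok t))
  (concatMap (λ i → concatMap (λ j → map (λ k → i , j , k) (allFin n)) (allFin n)) (allFin n))
  where
  ok : Fin n × Fin n × Fin n → Bool
  ok (i , j , k) = (toℕ i <ᵇ toℕ j) ∧ (toℕ j <ᵇ toℕ k) ∧ adj G i j ∧ adj G j k ∧ adj G i k

K32free : ∀ {r n} (G : Graph n) → Colouring r G → Bool
K32free {r} {n} G col =
  allB (λ { (i , j , k) → Data.Bool.not (exactlyTwo (f i j) (f j k) (f i k)) }) (triangles G)
  where
  f : Fin n → Fin n → Maybe (Fin r)
  f = lookupCol (zip (edges G) (toList col))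

cK32 : (r : ℕ) → ∀ {n} → Graph n → ℕ
cK32 r G = length (filter (λ col → Data.Bool.T? (K32free G col)) (allVecs r (length (edges G))))

{-# OPTIONS --safe #-}
-- By Zykov symmetrization, a graph with a triangle and the maximal number of colourings may be assumed
-- complete multipartite with at least three parts.  In a colouring of such a graph, the edges of a colour i
-- at a vertex v either all lead to one part, or v lies in a complete multipartite component of colour i.
-- Recording this for all v and i takes only n ^ O(n) choices, and confines every edge to a list of colours:
-- a single forced colour, or colours that both ends reserve for each other's part.  The lists of
-- the unforced edges from a vertex to different parts are disjoint.
--
-- The product of the list sizes is bounded by r ^ ((1 - 1/D) n² / 4 + O(n)) by removing cliques of at most six
-- vertices: a vertex joined to j vertices of the clique contributes at most (r / j) ^ j, which is less than
-- r ^ (s / 2) for a maximal clique of size s = 4 or 5, or any clique of size 6.  The case j = 3, s = 4 needs r < 27.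
-- If there are only three parts, a pair or a triangle containing an edge with a longest list is removed.
-- So for large n a graph with a triangle has fewer than r ^ ⌊n²/4⌋ colourings, while a triangle-free graph
-- with m edges has r ^ m, and Mantel's theorem with its case of equality applies.
module Submission where

open import Defs
open import Data.Nat using (ℕ; zero; suc; _+_; _*_; _∸_; _^_; _/_; _%_; _⊔_; _⊓_; _≤_; _<_; _≤?_; _<?_; _<ᵇ_; z≤n; s≤s; NonZero; >-nonZero; pred)
import Data.Nat.Properties as ℕ
open import Data.Nat.DivMod using (m≡m%n+[m/n]*n; m%n<n; m/n*n≤m; m*n/n≡m; /-monoˡ-≤; m<n*o⇒m/o<n)
open import Data.Nat.ListAction using (sum; product)
open import Data.Nat.ListAction.Properties using (product-↭; product-++)
open import Data.Nat.Tactic.RingSolver using (solve-∀)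
open import Data.Bool using (Bool; true; false; _∧_; _xor_; not; if_then_else_; T; T?)
import Data.Bool.Properties as Bool
open import Data.Fin using (Fin; zero; suc; toℕ; _≟_; punchIn)
import Data.Fin.Properties as Fin
open import Data.Fin.Permutation as Perm using (Permutation′; _⟨$⟩ʳ_; _⟨$⟩ˡ_)
open import Data.List using (List; []; _∷_; _++_; [_]; length; map; filter; allFin; tabulate; concatMap; cartesianProduct; cartesianProductWith; zip)
import Data.List.Properties as List
open import Data.List.Membership.Propositional using (_∈_; _∉_; find)
open import Data.List.Membership.Propositional.Properties
open import Data.List.Relation.Unary.Any as Any using (Any; here; there)
open import Data.List.Relation.Unary.All as All using (All; []; _∷_)
open import Data.List.Relation.Unary.AllPairs as AllPairs using (AllPairs; []; _∷_)
import Data.List.Relation.Unary.AllPairs.Properties as AllPairs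
import Data.List.Relation.Unary.All.Properties as All
import Data.List.Relation.Unary.Any.Properties as Any
open import Data.List.Relation.Unary.Unique.Propositional using (Unique)
import Data.List.Relation.Unary.Unique.Propositional.Properties as Unique
open import Data.List.Relation.Binary.Permutation.Propositional using (_↭_; ↭-sym; ↭-trans; prep)
import Data.List.Relation.Binary.Permutation.Propositional.Properties as ↭
open import Data.Maybe using (Maybe; just; nothing)
import Data.Maybe.Properties as Maybe
open import Data.Vec as Vec using (Vec; []; _∷_; lookup)
import Data.Vec.Properties as Vec
open import Data.Product using (∃; ∃₂; _×_; _,_; proj₁; proj₂)
import Data.Product.Properties as Product
open import Data.Sum using (_⊎_; inj₁; inj₂; [_,_]′)
import Data.Sum.Properties as Sum
open import Data.Empty using (⊥; ⊥-elim)
open import Data.Unit using (tt)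
open import Function using (_∘_; id; case_of_)
open import Function.Bundles using (_⇔_; mk⇔; Equivalence)
open import Level using (Level)
open import Relation.Binary using (DecidableEquality; Tri; tri<; tri≈; tri>)
open import Relation.Binary.PropositionalEquality using (_≡_; _≢_; refl; cong; cong₂; subst; subst₂; module ≡-Reasoning) renaming (sym to ≡-sym; trans to ≡-trans)
open import Relation.Nullary using (¬_; Dec; yes; no; does; contradiction)
open import Relation.Nullary.Decidable using (toWitness; map′; _×-dec_; _⊎-dec_; _→-dec_; ¬?)

-- Three parts are the critical case. Against a triangle, a vertex lying in the part of one of its
-- corners can reach about `(r / 2) ^ 2`, which is below `r ^ (3 / 2)` only for `r < 16`, so
-- removing arbitrary triangles fails. What helps is that the lists on the three edges of a triangle
-- compete for the same r colours. If g is the largest weight, attained at a b, then a vertex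
-- outside the parts of a and b has product at most g² towards them, and also at most about
-- `((r - g) / 2) ^ 2`. The vertices inside and outside these two parts are then averaged against
-- each other, and whichever group is larger decides whether the pair or a triangle is removed. No
-- estimate has to be sharp. The choices of labels number only `(2 * n) ^ (r * n)`, so any fixed
-- saving in the coefficient of n² outweighs them for large n. It is therefore enough to have strict
-- inequalities between integers for each r, and to extract a common saving 1 / D from them. Roots
-- and logarithms are avoided by raising everything to the power 2 D. Products run over ordered
-- pairs of vertices, so they bound the square of a number of colourings.

private variable
  ℓ : Level
  A B C : Set ℓ
  r n : ℕ

-- Finite counting

remove : {y : A} {ys : List A} → y ∈ ys →
  ∃ λ zs → (length ys ≡ suc (length zs)) × (∀ {z} → z ∈ ys → z ≢ y → z ∈ zs)
remove {ys = _ ∷ ys} (here refl) = ys , refl , λ { (here z≡y) z≢y → contradiction z≡y z≢y ; (there z∈) _ → z∈ }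
remove {ys = x ∷ _} (there y∈) with zs , eq , keep ← remove y∈ =
  x ∷ zs , cong suc eq , λ { (here z≡x) _ → here z≡x ; (there z∈) z≢y → there (keep z∈ z≢y) }

InjectiveOn : (A → B) → List A → Set _
InjectiveOn f xs = ∀ {x y} → x ∈ xs → y ∈ xs → f x ≡ f y → x ≡ y

injection⇒length≤ : (f : A → B) {xs : List A} {ys : List B} → Unique xs → InjectiveOn f xs →
  (∀ {x} → x ∈ xs → f x ∈ ys) → length xs ≤ length ys
injection⇒length≤ f {[]} _ _ _ = z≤n
injection⇒length≤ f {x ∷ xs} (x∉ ∷ uniq) inj into with zs , eq , keep ← remove (into (here refl)) =
  subst (suc (length xs) ≤_) (≡-sym eq) (s≤s (injection⇒length≤ f uniq
    (λ p q → inj (there p) (there q))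
    (λ p → keep (into (there p)) λ e → All.lookup x∉ p (≡-sym (inj (there p) (here refl) e)))))

injection⇒length< : (f : A → B) {xs : List A} {ys : List B} → Unique xs → InjectiveOn f xs →
  (∀ {x} → x ∈ xs → f x ∈ ys) → ∀ {y} → y ∈ ys → (∀ {x} → x ∈ xs → f x ≢ y) → length xs < length ys
injection⇒length< f {xs} uniq inj into y∈ avoid with zs , eq , keep ← remove y∈ =
  subst (length xs <_) (≡-sym eq) (s≤s (injection⇒length≤ f uniq inj (λ p → keep (into p) (avoid p))))

⊆⇒length≤ : {xs ys : List A} → Unique xs → (∀ {x} → x ∈ xs → x ∈ ys) → length xs ≤ length ys
⊆⇒length≤ uniq sub = injection⇒length≤ id uniq (λ _ _ e → e) sub

length-cartesianProductWith : ∀ (f : A → B → C) xs ys →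
  length (cartesianProductWith f xs ys) ≡ length xs * length ys
length-cartesianProductWith f [] ys = refl
length-cartesianProductWith f (x ∷ xs) ys =
  ≡-trans (List.length-++ (map (f x) ys)) (cong₂ _+_ (List.length-map (f x) ys) (length-cartesianProductWith f xs ys))

length-concatMap-≤ : (f : A → List B) (xs : List A) {k : ℕ} →
  (∀ {x} → x ∈ xs → length (f x) ≤ k) → length (concatMap f xs) ≤ length xs * k
length-concatMap-≤ f [] _ = z≤n
length-concatMap-≤ f (x ∷ xs) h = subst (_≤ _) (≡-sym (List.length-++ (f x)))
  (ℕ.+-mono-≤ (h (here refl)) (length-concatMap-≤ f xs (h ∘ there)))

vecsOf : (Fin n → List A) → List (Vec A n)
vecsOf {n = zero}  L = [ [] ]
vecsOf {n = suc n} L = cartesianProductWith _∷_ (L zero) (vecsOf (L ∘ suc))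

∈-vecsOf⁺ : (L : Fin n → List A) (v : Vec A n) → (∀ i → lookup v i ∈ L i) → v ∈ vecsOf L
∈-vecsOf⁺ L [] _ = here refl
∈-vecsOf⁺ L (x ∷ v) h = ∈-cartesianProductWith⁺ _∷_ (h zero) (∈-vecsOf⁺ (L ∘ suc) v (h ∘ suc))

vecsOf-unique : (L : Fin n → List A) → (∀ i → Unique (L i)) → Unique (vecsOf L)
vecsOf-unique {n = zero}  L _ = [] ∷ []
vecsOf-unique {n = suc n} L h =
  Unique.cartesianProductWith⁺ _∷_ (λ e → Vec.∷-injective e) (h zero) (vecsOf-unique (L ∘ suc) (h ∘ suc))

length-vecsOf : (L : Fin n → List A) → length (vecsOf L) ≡ product (map (length ∘ L) (allFin n))
length-vecsOf {n = zero}  L = refl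
length-vecsOf {n = suc n} L = ≡-trans (length-cartesianProductWith _∷_ (L zero) (vecsOf (L ∘ suc)))
  (cong (length (L zero) *_) (≡-trans (length-vecsOf (L ∘ suc))
    (cong product (≡-trans (List.map-tabulate id (length ∘ L ∘ suc)) (≡-sym (List.map-tabulate suc (length ∘ L)))))))

product-replicate : (k : ℕ) (xs : List A) → product (map (λ _ → k) xs) ≡ k ^ length xs
product-replicate k []       = refl
product-replicate k (_ ∷ xs) = cong (k *_) (product-replicate k xs)

lookup-ext : {u v : Vec A n} → (∀ i → lookup u i ≡ lookup v i) → u ≡ v
lookup-ext {u = u} {v} h = ≡-trans (≡-sym (Vec.tabulate∘lookup u)) (≡-trans (Vec.tabulate-cong h) (Vec.tabulate∘lookup v))

concatMap-unique : (f : A → List B) {xs : List A} → (∀ x → Unique (f x)) →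
  AllPairs (λ x y → ∀ z → z ∈ f x → z ∈ f y → ⊥) xs → Unique (concatMap f xs)
concatMap-unique f uniq disj = Unique.concat⁺ (All.map⁺ (All.universal uniq _))
  (AllPairs.map⁺ (AllPairs.map (λ h {z} pq → h z (proj₁ pq) (proj₂ pq)) disj))

-- Products over lists

∏ : List A → (A → ℕ) → ℕ
∏ xs f = product (map f xs)

interchange-* : ∀ a b c d → (a * b) * (c * d) ≡ (a * c) * (b * d)
interchange-* = solve-∀

^-distribʳ-* : ∀ k a b → (a * b) ^ k ≡ a ^ k * b ^ k
^-distribʳ-* zero    a b = refl
^-distribʳ-* (suc k) a b = ≡-trans (cong (a * b *_) (^-distribʳ-* k a b)) (interchange-* a b (a ^ k) (b ^ k))

^-swap : ∀ a m n → (a ^ m) ^ n ≡ (a ^ n) ^ m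
^-swap a m n = ≡-trans (ℕ.^-*-assoc a m n) (≡-trans (cong (a ^_) (ℕ.*-comm m n)) (≡-sym (ℕ.^-*-assoc a n m)))

1≤^ : ∀ {a} n → 1 ≤ a → 1 ≤ a ^ n
1≤^ n 1≤a = ℕ.m^n>0 _ {{>-nonZero 1≤a}} n

∏-++ : (f : A → ℕ) (xs ys : List A) → ∏ (xs ++ ys) f ≡ ∏ xs f * ∏ ys f
∏-++ f xs ys = ≡-trans (cong product (List.map-++ f xs ys)) (product-++ (map f xs) (map f ys))

∏-↭ : (f : A → ℕ) {xs ys : List A} → xs ↭ ys → ∏ xs f ≡ ∏ ys f
∏-↭ f xs↭ys = product-↭ (↭.map⁺ f xs↭ys)

∏-cong : {f g : A → ℕ} (xs : List A) → (∀ {x} → x ∈ xs → f x ≡ g x) → ∏ xs f ≡ ∏ xs g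
∏-cong []       _ = refl
∏-cong (x ∷ xs) h = cong₂ _*_ (h (here refl)) (∏-cong xs (h ∘ there))

∏-mono : {f g : A → ℕ} (xs : List A) → (∀ {x} → x ∈ xs → f x ≤ g x) → ∏ xs f ≤ ∏ xs g
∏-mono []       _ = ℕ.≤-refl
∏-mono (x ∷ xs) h = ℕ.*-mono-≤ (h (here refl)) (∏-mono xs (h ∘ there))

∏-≤^ : {f : A → ℕ} {k : ℕ} (xs : List A) → (∀ {x} → x ∈ xs → f x ≤ k) → ∏ xs f ≤ k ^ length xs
∏-≤^ {k = k} xs h = ℕ.≤-trans (∏-mono xs h) (ℕ.≤-reflexive (product-replicate k xs))

∏-≡1 : {f : A → ℕ} (xs : List A) → (∀ {x} → x ∈ xs → f x ≡ 1) → ∏ xs f ≡ 1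
∏-≡1 xs h = ≡-trans (∏-cong xs h) (≡-trans (product-replicate 1 xs) (ℕ.^-zeroˡ (length xs)))

∏-* : (f g : A → ℕ) (xs : List A) → ∏ xs (λ x → f x * g x) ≡ ∏ xs f * ∏ xs g
∏-* f g []       = refl
∏-* f g (x ∷ xs) = ≡-trans (cong (f x * g x *_) (∏-* f g xs)) (interchange-* (f x) (g x) (∏ xs f) (∏ xs g))

∏-swap : (f : A → B → ℕ) (xs : List A) (ys : List B) →
  ∏ xs (λ x → ∏ ys (f x)) ≡ ∏ ys (λ y → ∏ xs (λ x → f x y))
∏-swap f []       ys = ≡-sym (∏-≡1 ys (λ _ → refl))
∏-swap f (x ∷ xs) ys = ≡-trans (cong (∏ ys (f x) *_) (∏-swap f xs ys))
  (≡-sym (∏-* (f x) (λ y → ∏ xs (λ x → f x y)) ys))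

∏-split : {P : A → Set ℓ} (P? : ∀ x → Dec (P x)) {f : A → ℕ} {k l : ℕ} (xs : List A) →
  (∀ {x} → x ∈ xs → P x → f x ≤ k) → (∀ {x} → x ∈ xs → ¬ P x → f x ≤ l) →
  ∏ xs f ≤ k ^ length (filter P? xs) * l ^ length (filter (¬? ∘ P?) xs)
∏-split P? [] _ _ = ℕ.≤-refl
∏-split P? {f} {k} {l} (x ∷ xs) h₁ h₂ with ih ← ∏-split P? xs (h₁ ∘ there) (h₂ ∘ there) | P? x
... | yes p = ℕ.≤-trans (ℕ.*-mono-≤ (h₁ (here refl) p) ih) (ℕ.≤-reflexive (≡-sym (ℕ.*-assoc k _ _)))
... | no ¬p = ℕ.≤-trans (ℕ.*-mono-≤ (h₂ (here refl) ¬p) ih) (ℕ.≤-reflexive (rearrange l (k ^ length (filter P? xs)) _))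
  where
  rearrange : ∀ a b c → a * (b * c) ≡ b * (a * c)
  rearrange = solve-∀

length-filter-split : {P : A → Set ℓ} (P? : ∀ x → Dec (P x)) (xs : List A) →
  length (filter P? xs) + length (filter (¬? ∘ P?) xs) ≡ length xs
length-filter-split P? [] = refl
length-filter-split P? (x ∷ xs) with ih ← length-filter-split P? xs | P? x
... | yes _ = cong suc ih
... | no  _ = ≡-trans (ℕ.+-suc _ _) (cong suc ih)

-- The maximal product of the weights of a vertex

maxUpTo : ℕ → (ℕ → ℕ) → ℕ
maxUpTo zero    f = f 0
maxUpTo (suc k) f = f (suc k) ⊔ maxUpTo k f

maxUpTo-upper : ∀ k f {x} → x ≤ k → f x ≤ maxUpTo k f
maxUpTo-upper zero    f z≤n = ℕ.≤-refl
maxUpTo-upper (suc k) f {x} x≤k with ℕ.m≤n⇒m<n∨m≡n x≤k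
... | inj₁ (s≤s x≤) = ℕ.≤-trans (maxUpTo-upper k f x≤) (ℕ.m≤n⊔m (f (suc k)) _)
... | inj₂ refl     = ℕ.m≤m⊔n _ _

maxUpTo-least : ∀ k f {l} → (∀ {x} → x ≤ k → f x ≤ l) → maxUpTo k f ≤ l
maxUpTo-least zero    f h = h z≤n
maxUpTo-least (suc k) f h = ℕ.⊔-lub (h ℕ.≤-refl) (maxUpTo-least k f (h ∘ ℕ.m≤n⇒m≤1+n))

-- The factor 1 ⊔ x allows for forced edges: they have weight 1 but use up none of the s colours at the vertex.
maxProd : ℕ → ℕ → ℕ
maxProd zero    s = 1
maxProd (suc j) s = maxUpTo s λ x → (1 ⊔ x) * maxProd j (s ∸ x)

maxProd-mono : ∀ j {s t} → s ≤ t → maxProd j s ≤ maxProd j t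
maxProd-mono zero    _   = ℕ.≤-refl
maxProd-mono (suc j) {s} {t} s≤t = maxUpTo-least s _ λ {x} x≤s → ℕ.≤-trans
  (ℕ.*-monoʳ-≤ (1 ⊔ x) (maxProd-mono j (ℕ.∸-monoˡ-≤ x s≤t)))
  (maxUpTo-upper t (λ x → (1 ⊔ x) * maxProd j (t ∸ x)) (ℕ.≤-trans x≤s s≤t))

∏≤maxProd : (f : A → ℕ) (xs : List A) {s : ℕ} → sum (map f xs) ≤ s → ∏ xs (λ x → 1 ⊔ f x) ≤ maxProd (length xs) s
∏≤maxProd f []       _ = ℕ.≤-refl
∏≤maxProd f (x ∷ xs) {s} h = ℕ.≤-trans
  (ℕ.*-monoʳ-≤ (1 ⊔ f x) (∏≤maxProd f xs {s ∸ f x}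
    (ℕ.m+n≤o⇒m≤o∸n (sum (map f xs)) (subst (_≤ s) (ℕ.+-comm (f x) _) h))))
  (maxUpTo-upper s (λ y → (1 ⊔ y) * maxProd (length xs) (s ∸ y)) (ℕ.m+n≤o⇒m≤o (f x) h))

1≤maxProd : ∀ j s → 1 ≤ maxProd j s
1≤maxProd zero    s = ℕ.≤-refl
1≤maxProd (suc j) s = ℕ.≤-trans (ℕ.≤-trans (1≤maxProd j s) (ℕ.≤-reflexive (≡-sym (ℕ.*-identityˡ _))))
  (maxUpTo-upper s (λ y → (1 ⊔ y) * maxProd j (s ∸ y)) z≤n)

maxProd-suc : ∀ j s → maxProd j s ≤ maxProd (suc j) s
maxProd-suc j s = ℕ.≤-trans (ℕ.≤-reflexive (≡-sym (ℕ.*-identityˡ _)))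
  (maxUpTo-upper s (λ y → (1 ⊔ y) * maxProd j (s ∸ y)) z≤n)

-- Among integers x ^ (1 / x) is largest at x = 3, where equality holds. Beyond it a step multiplies
-- the left side by at most (4 / 3) ^ 3 < 3.
cube≤3^ : ∀ x → x ^ 3 ≤ 3 ^ x
cube≤3^ 0 = z≤n
cube≤3^ 1 = toWitness {a? = 1 ≤? 3} tt
cube≤3^ 2 = toWitness {a? = 8 ≤? 9} tt
cube≤3^ (suc (suc (suc y))) = go y
  where
  expand : ∀ y → (4 + y) * ((4 + y) * ((4 + y) * 1)) + (2 * y * y * y + 15 * y * y + 33 * y + 17) ≡
    3 * ((3 + y) * ((3 + y) * ((3 + y) * 1)))
  expand = solve-∀
  go : ∀ y → (3 + y) ^ 3 ≤ 3 ^ (3 + y)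
  go zero    = ℕ.≤-refl
  go (suc y) = ℕ.≤-trans (ℕ.≤-trans (ℕ.m≤m+n _ _) (ℕ.≤-reflexive (expand y))) (ℕ.*-monoʳ-≤ 3 (go y))

-- As x³ ≤ 3ˣ, the bound does not depend on the number of factors.
∏³≤3^ : (f : A → ℕ) (xs : List A) {s : ℕ} → sum (map f xs) ≤ s → ∏ xs (λ x → 1 ⊔ f x) ^ 3 ≤ 3 ^ s
∏³≤3^ f xs h = ℕ.≤-trans (go xs) (ℕ.^-monoʳ-≤ 3 h)
  where
  factor : ∀ x → (1 ⊔ x) ^ 3 ≤ 3 ^ x
  factor zero    = ℕ.≤-refl
  factor (suc x) = cube≤3^ (suc x)
  go : ∀ xs → ∏ xs (λ x → 1 ⊔ f x) ^ 3 ≤ 3 ^ sum (map f xs)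
  go []       = ℕ.≤-refl
  go (x ∷ xs) = begin
    ((1 ⊔ f x) * ∏ xs (λ x → 1 ⊔ f x)) ^ 3    ≡⟨ ^-distribʳ-* 3 (1 ⊔ f x) _ ⟩
    (1 ⊔ f x) ^ 3 * ∏ xs (λ x → 1 ⊔ f x) ^ 3  ≤⟨ ℕ.*-mono-≤ (factor (f x)) (go xs) ⟩
    3 ^ f x * 3 ^ sum (map f xs)              ≡⟨ ℕ.^-distribˡ-+-* 3 (f x) _ ⟨
    3 ^ (f x + sum (map f xs))                ∎
    where open ℕ.≤-Reasoning

cube-cancel : ∀ {x y} → x ^ 3 ≤ y ^ 3 → x ≤ y
cube-cancel {x} {y} h with x ≤? y
... | yes x≤y = x≤y
... | no  x≰y = contradiction h (ℕ.<⇒≱ (ℕ.^-monoˡ-< 3 (ℕ.≰⇒> x≰y)))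

-- With D = 1 + d, a factor x with x ^ 2D ≤ r ^ (k d) is smaller than r ^ (k / 2) by a power r ^ (k / 2D).
record Gains (r d : ℕ) : Set where
  field
    gain₂ : (r ∸ 1) ^ (2 * suc d) ≤ r ^ (2 * d)
    gain₄ : maxProd 3 r ^ (2 * suc d) ≤ r ^ (4 * d)
    gain₅ : maxProd 4 r ^ (2 * suc d) ≤ r ^ (5 * d)
    gain₆ : (3 ^ r) ^ (2 * suc d) ≤ (r ^ (6 * d)) ^ 3
    gain₃ : ∀ {g} → g < r → let k = (g * g) ⊓ maxProd 2 (r ∸ g) in
      (g * k) ^ (2 * suc d) ≤ r ^ (4 * d) ×
      (k * maxProd 2 (r ∸ 1)) ^ (2 * suc d) ≤ r ^ (6 * d) ×
      k ^ (2 * suc d) ≤ r ^ (3 * d)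

-- Strict inequalities X² < rᵏ have a uniform slack: with N ≥ X² and D = 90 N,
-- (X² / rᵏ) ^ D ≤ (1 + 1 / N) ^ (- D) ≤ 2 ^ (- 90) ≤ r ^ (- k) for r ≤ 32 and k ≤ 18.

bernoulli : ∀ N m → (N + m) * N ^ m ≤ N * suc N ^ m
bernoulli N zero    = ℕ.≤-reflexive (cong (_* 1) (ℕ.+-identityʳ N))
bernoulli N (suc m) = begin
  (N + suc m) * (N * N ^ m)                        ≤⟨ ℕ.m≤m+n _ (m * N ^ m) ⟩
  (N + suc m) * (N * N ^ m) + m * N ^ m            ≡⟨ regroup N m (N ^ m) ⟩
  suc N * ((N + m) * N ^ m)                        ≤⟨ ℕ.*-monoʳ-≤ (suc N) (bernoulli N m) ⟩
  suc N * (N * suc N ^ m)                          ≡⟨ exchange (suc N) N (suc N ^ m) ⟩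
  N * (suc N * suc N ^ m)                          ∎
  where
  open ℕ.≤-Reasoning
  regroup : ∀ N m x → (N + suc m) * (N * x) + m * x ≡ suc N * ((N + m) * x)
  regroup = solve-∀
  exchange : ∀ a b c → a * (b * c) ≡ b * (a * c)
  exchange = solve-∀

-- Bernoulli's inequality at `m = N`. Its 90th power is the factor that `slack` spends on `r ^ k`.
doubling : ∀ N .{{_ : NonZero N}} → 2 * N ^ N ≤ suc N ^ N
doubling N = ℕ.*-cancelˡ-≤ N (subst (_≤ N * suc N ^ N) (regroup N (N ^ N)) (bernoulli N N))
  where
  regroup : ∀ N x → (N + N) * x ≡ N * (2 * x)
  regroup = solve-∀

slack : ∀ {X r k d} N .{{_ : NonZero N}} → suc d ≡ N * 90 → r ≤ 32 → k ≤ 18 → 0 < r → X ^ 2 ≤ N → X ^ 2 < r ^ k →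
  X ^ (2 * suc d) ≤ r ^ (k * d)
slack {X} {r} {k} {d} N D≡ r≤32 k≤18 0<r X²≤N X²< = ℕ.*-cancelʳ-≤ _ _ (r ^ k * N ^ D) (begin
  X ^ (2 * D) * (r ^ k * N ^ D)  ≤⟨ ℕ.*-monoʳ-≤ (X ^ (2 * D)) r^k≤ ⟩
  X ^ (2 * D) * suc N ^ D        ≡⟨ cong (_* suc N ^ D) (ℕ.^-*-assoc X 2 D) ⟨
  (X ^ 2) ^ D * suc N ^ D        ≡⟨ ^-distribʳ-* D (X ^ 2) (suc N) ⟨
  (X ^ 2 * suc N) ^ D            ≤⟨ ℕ.^-monoˡ-≤ D base ⟩
  (r ^ k * N) ^ D                ≡⟨ ^-distribʳ-* D (r ^ k) N ⟩
  (r ^ k) ^ D * N ^ D            ≡⟨ cong (_* N ^ D) (ℕ.^-*-assoc r k D) ⟩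
  r ^ (k * D) * N ^ D            ≡⟨ cong (λ j → r ^ j * N ^ D) (≡-trans (ℕ.*-suc k d) (ℕ.+-comm k (k * d))) ⟩
  r ^ (k * d + k) * N ^ D        ≡⟨ cong (_* N ^ D) (ℕ.^-distribˡ-+-* r (k * d) k) ⟩
  r ^ (k * d) * r ^ k * N ^ D    ≡⟨ ℕ.*-assoc (r ^ (k * d)) _ _ ⟩
  r ^ (k * d) * (r ^ k * N ^ D)  ∎)
  where
  open ℕ.≤-Reasoning
  D : ℕ
  D = suc d
  instance
    r≢0 : NonZero r
    r≢0 = >-nonZero 0<r
    pos : NonZero (r ^ k * N ^ D)
    pos = ℕ.m*n≢0 (r ^ k) (N ^ D) {{ℕ.m^n≢0 r k}} {{ℕ.m^n≢0 N D}}
  base : X ^ 2 * suc N ≤ r ^ k * N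
  base = begin
    X ^ 2 * suc N     ≡⟨ ℕ.*-suc (X ^ 2) N ⟩
    X ^ 2 + X ^ 2 * N ≤⟨ ℕ.+-monoˡ-≤ _ X²≤N ⟩
    suc (X ^ 2) * N   ≤⟨ ℕ.*-monoˡ-≤ N X²< ⟩
    r ^ k * N         ∎
  r^k≤ : r ^ k * N ^ D ≤ suc N ^ D
  r^k≤ = begin
    r ^ k * N ^ D               ≤⟨ ℕ.*-monoˡ-≤ (N ^ D) (ℕ.≤-trans (ℕ.^-monoˡ-≤ k r≤32) (ℕ.^-monoʳ-≤ 32 k≤18)) ⟩
    32 ^ 18 * N ^ D             ≡⟨⟩
    2 ^ 90 * N ^ D              ≡⟨ cong (λ j → 2 ^ 90 * N ^ j) D≡ ⟩
    2 ^ 90 * N ^ (N * 90)       ≡⟨ cong (2 ^ 90 *_) (ℕ.^-*-assoc N N 90) ⟨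
    2 ^ 90 * (N ^ N) ^ 90       ≡⟨ ^-distribʳ-* 90 2 (N ^ N) ⟨
    (2 * N ^ N) ^ 90            ≤⟨ ℕ.^-monoˡ-≤ 90 (doubling N) ⟩
    (suc N ^ N) ^ 90            ≡⟨ ℕ.^-*-assoc (suc N) N 90 ⟩
    suc N ^ (N * 90)            ≡⟨ cong (suc N ^_) D≡ ⟨
    suc N ^ D                   ∎

Tame : ℕ → Set
Tame r = (r ∸ 1) ^ 2 < r ^ 2 × maxProd 3 r ^ 2 < r ^ 4 × maxProd 4 r ^ 2 < r ^ 5 × (3 ^ r) ^ 2 < r ^ 18 ×
  (∀ {g} → g < r → let k = (g * g) ⊓ maxProd 2 (r ∸ g) in
    (g * k) ^ 2 < r ^ 4 × (k * maxProd 2 (r ∸ 1)) ^ 2 < r ^ 6 × k ^ 2 < r ^ 3)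

tame? : ∀ r → Dec (Tame r)
tame? r = (_ <? _) ×-dec (_ <? _) ×-dec (_ <? _) ×-dec (_ <? _) ×-dec
  ℕ.allUpTo? (λ g → (_ <? _) ×-dec (_ <? _) ×-dec (_ <? _)) r

abstract
  -- A finite check by evaluation for r = 2, ..., 26. At r = 27 the condition on `maxProd 3 r` turns
  -- into an equality, since 9 ^ 3 = 27 ^ 2.
  tame : ∀ {r} → 2 ≤ r → r ≤ 26 → Tame r
  tame {suc (suc r)} (s≤s (s≤s _)) (s≤s (s≤s r≤24)) = toWitness {a? = ℕ.allUpTo? (λ r → tame? (2 + r)) 25} tt (s≤s r≤24)

gains : ∀ {r} → 2 ≤ r → r ≤ 26 → ∃ λ d → Gains r d
gains {r} 2≤r r≤26 = pred (N * 90) , record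
  { gain₂ = bound (r ∸ 1) {2} (s≤s (s≤s z≤n)) (proj₁ conditions)
  ; gain₄ = bound (maxProd 3 r) {4} (ℕ.m≤m+n 4 14) (proj₁ (proj₂ conditions))
  ; gain₅ = bound (maxProd 4 r) {5} (ℕ.m≤m+n 5 13) (proj₁ (proj₂ (proj₂ conditions)))
  ; gain₆ = ℕ.≤-trans (bound (3 ^ r) {18} ℕ.≤-refl (proj₁ (proj₂ (proj₂ (proj₂ conditions))))) (ℕ.≤-reflexive (triple (pred (N * 90))))
  ; gain₃ = λ {g} g<r → let k = (g * g) ⊓ maxProd 2 (r ∸ g) ; x , y , z = proj₂ (proj₂ (proj₂ (proj₂ conditions))) g<r in
      bound (g * k) {4} (ℕ.m≤m+n 4 14) x , bound (k * maxProd 2 (r ∸ 1)) {6} (ℕ.m≤m+n 6 12) y , bound k {3} (ℕ.m≤m+n 3 15) z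
  }
  where
  N : ℕ
  -- Every condition has the form `X ^ 2 < r ^ k` with `k ≤ 18`, so this N dominates all the squares
  -- and one d serves all gains. The largest k comes from six-cliques, where `x ^ 2 < r ^ 6` is only
  -- available for cubes.
  N = r ^ 18
  0<r : 0 < r
  0<r = ℕ.<-trans (s≤s z≤n) 2≤r
  instance
    r≢0 : NonZero r
    r≢0 = >-nonZero 0<r
    N≢0 : NonZero N
    N≢0 = ℕ.m^n≢0 r 18
  conditions : Tame r
  conditions = tame 2≤r r≤26
  regroup : ∀ d → 18 * d ≡ 6 * d * 3
  regroup = solve-∀
  triple : ∀ d → r ^ (18 * d) ≡ (r ^ (6 * d)) ^ 3
  triple d = ≡-trans (cong (r ^_) (regroup d)) (≡-sym (ℕ.^-*-assoc r (6 * d) 3))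
  bound : ∀ X {k} → k ≤ 18 → X ^ 2 < r ^ k → X ^ (2 * suc (pred (N * 90))) ≤ r ^ (k * pred (N * 90))
  bound X {k} k≤ h = slack {X} {k = k} N (ℕ.suc-pred (N * 90) {{ℕ.m*n≢0 N 90}})
    (ℕ.≤-trans r≤26 (ℕ.m≤m+n 26 6)) k≤ 0<r (ℕ.≤-trans (ℕ.<⇒≤ h) (ℕ.^-monoʳ-≤ r k≤)) h

-- Weighted multipartite graphs

-- The factor y alone may be too large. Each of the q factors y is paired with a factor x, and the
-- remaining p - q factors x are small by themselves.
balance : ∀ {x y ρ} e {p q} → q ≤ p → x ^ e ≤ ρ → (x * y) ^ e ≤ ρ * ρ → (x ^ p * y ^ q) ^ e ≤ ρ ^ (p + q)
balance {x} {y} {ρ} e {p} {q} q≤p hx hxy = begin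
  (x ^ p * y ^ q) ^ e                    ≡⟨ cong (λ k → (x ^ k * y ^ q) ^ e) (≡-sym p≡) ⟩
  (x ^ (p ∸ q + q) * y ^ q) ^ e          ≡⟨ cong (_^ e) regroup ⟩
  (x ^ (p ∸ q) * (x * y) ^ q) ^ e        ≡⟨ ^-distribʳ-* e (x ^ (p ∸ q)) _ ⟩
  (x ^ (p ∸ q)) ^ e * ((x * y) ^ q) ^ e  ≡⟨ cong₂ _*_ (^-swap x (p ∸ q) e) (^-swap (x * y) q e) ⟩
  (x ^ e) ^ (p ∸ q) * ((x * y) ^ e) ^ q  ≤⟨ ℕ.*-mono-≤ (ℕ.^-monoˡ-≤ (p ∸ q) hx) (ℕ.^-monoˡ-≤ q hxy) ⟩
  ρ ^ (p ∸ q) * (ρ * ρ) ^ q              ≡⟨ cong (ρ ^ (p ∸ q) *_) (^-distribʳ-* q ρ ρ) ⟩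
  ρ ^ (p ∸ q) * (ρ ^ q * ρ ^ q)          ≡⟨ ℕ.*-assoc (ρ ^ (p ∸ q)) _ _ ⟨
  ρ ^ (p ∸ q) * ρ ^ q * ρ ^ q            ≡⟨ cong (_* ρ ^ q) (ℕ.^-distribˡ-+-* ρ (p ∸ q) q) ⟨
  ρ ^ (p ∸ q + q) * ρ ^ q                ≡⟨ cong (λ k → ρ ^ k * ρ ^ q) p≡ ⟩
  ρ ^ p * ρ ^ q                          ≡⟨ ℕ.^-distribˡ-+-* ρ p q ⟨
  ρ ^ (p + q)                            ∎
  where
  open ℕ.≤-Reasoning
  p≡ : p ∸ q + q ≡ p
  p≡ = ℕ.m∸n+n≡m q≤p
  regroup : x ^ (p ∸ q + q) * y ^ q ≡ x ^ (p ∸ q) * (x * y) ^ q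
  regroup = ≡-trans (cong (_* y ^ q) (ℕ.^-distribˡ-+-* x (p ∸ q) q))
    (≡-trans (ℕ.*-assoc (x ^ (p ∸ q)) _ _) (cong (x ^ (p ∸ q) *_) (≡-sym (^-distribʳ-* q x y))))

module Weights {V Q : Set} (_≟Q_ : DecidableEquality Q) (part : V → Q) (w : V → V → ℕ) (r d : ℕ)
  (1<r : 1 < r) (gains : Gains r d)
  (w-sym  : ∀ u v → w u v ≡ w v u)
  (w-same : ∀ {u v} → part u ≡ part v → w u v ≡ 1)
  (w-pos  : ∀ u v → 1 ≤ w u v)
  (w-top  : ∀ u v → w u v < r)
  (w-star : ∀ v K → AllPairs (λ x y → part x ≢ part y) K → All (λ k → part v ≢ part k) K →
     ∃ λ (g : V → ℕ) → (∀ {k} → k ∈ K → w v k ≤ 1 ⊔ g k) × sum (map g K) ≤ r)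
  (w-tri : ∀ {v b c} → part v ≢ part b → part v ≢ part c → part b ≢ part c →
     w v b * w v c ≤ maxProd 2 (r ∸ w b c))
  where

  open Gains gains

  private instance
    r≢0 : NonZero r
    r≢0 = >-nonZero (ℕ.<-trans (s≤s z≤n) 1<r)

  e : ℕ
  e = 2 * suc d

  pairProduct : List V → ℕ
  pairProduct S = ∏ S λ u → ∏ S (w u)

  -- With `D = suc d` and s vertices, this says that the product over ordered pairs is at most r to
  -- the power (1 - 1 / D) s² / 2 + 6 s. The linear term pays for the pairs inside removed cliques:
  -- at most six vertices give s² · 2 D ≤ 12 D s.
  Bounded : List V → Set
  Bounded S = pairProduct S ^ e ≤ r ^ (d * (length S * length S) + 12 * suc d * length S)

  Clique : List V → Set
  Clique = AllPairs (λ x y → part x ≢ part y)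

  -- In `d * (s + m) ^ 2` the mixed term 2 d s m pays for the pairs between K and R, in both
  -- directions, and the linear term pays for the pairs within K. The bound on R is on the whole
  -- product and not on each vertex, because pairs and triangles need an average over the vertices.
  delete : ∀ K R {S} → S ↭ K ++ R → length K ≤ 6 →
    ∏ R (λ v → ∏ K (w v)) ^ e ≤ (r ^ (length K * d)) ^ length R → Bounded R → Bounded S
  delete K R {S} S↭ s≤6 X-bound R-bound = begin
    pairProduct S ^ e                     ≡⟨ cong (_^ e) split ⟩
    (PK * X * (X * PR)) ^ e               ≡⟨ ^-distribʳ-* e (PK * X) (X * PR) ⟩
    (PK * X) ^ e * (X * PR) ^ e           ≡⟨ cong₂ _*_ (^-distribʳ-* e PK X) (^-distribʳ-* e X PR) ⟩
    PK ^ e * X ^ e * (X ^ e * PR ^ e)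
      ≤⟨ ℕ.*-mono-≤ (ℕ.*-mono-≤ (ℕ.^-monoˡ-≤ e PK-bound) X-bound) (ℕ.*-mono-≤ X-bound R-bound) ⟩
    ((r ^ s) ^ s) ^ e * (r ^ (s * d)) ^ m * ((r ^ (s * d)) ^ m * r ^ (d * (m * m) + 12 * suc d * m))
      ≡⟨ cong₂ (λ x y → x * y * (y * r ^ (d * (m * m) + 12 * suc d * m)))
           (≡-trans (cong (_^ e) (ℕ.^-*-assoc r s s)) (ℕ.^-*-assoc r (s * s) e)) (ℕ.^-*-assoc r (s * d) m) ⟩
    r ^ (s * s * e) * r ^ (s * d * m) * (r ^ (s * d * m) * r ^ (d * (m * m) + 12 * suc d * m))
      ≡⟨ cong₂ _*_ (ℕ.^-distribˡ-+-* r (s * s * e) _) (ℕ.^-distribˡ-+-* r (s * d * m) _) ⟨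
    r ^ (s * s * e + s * d * m) * r ^ (s * d * m + (d * (m * m) + 12 * suc d * m))
      ≡⟨ ℕ.^-distribˡ-+-* r (s * s * e + s * d * m) _ ⟨
    r ^ (s * s * e + s * d * m + (s * d * m + (d * (m * m) + 12 * suc d * m)))
      ≤⟨ ℕ.^-monoʳ-≤ r exponents ⟩
    r ^ (d * ((s + m) * (s + m)) + 12 * suc d * (s + m))
      ≡⟨ cong (λ k → r ^ (d * (k * k) + 12 * suc d * k)) S-length ⟨
    r ^ (d * (length S * length S) + 12 * suc d * length S) ∎
    where
    open ℕ.≤-Reasoning
    s m PK PR X : ℕ
    s = length K
    m = length R
    PK = pairProduct K
    PR = pairProduct R
    X = ∏ R λ v → ∏ K (w v)
    S-length : length S ≡ s + m
    S-length = ≡-trans (↭.↭-length S↭) (List.length-++ K)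
    X-swap : ∏ K (λ k → ∏ R (w k)) ≡ X
    X-swap = ≡-trans (∏-swap w K R) (∏-cong R λ _ → ∏-cong K λ _ → w-sym _ _)
    split : pairProduct S ≡ PK * X * (X * PR)
    split = ≡-trans (∏-↭ _ S↭) (≡-trans
      (∏-cong (K ++ R) λ {u} _ → ≡-trans (∏-↭ (w u) S↭) (∏-++ (w u) K R))
      (≡-trans (∏-++ _ K R) (cong₂ _*_
        (≡-trans (∏-* _ _ K) (cong (PK *_) X-swap)) (∏-* _ _ R))))
    PK-bound : PK ≤ (r ^ s) ^ s
    PK-bound = ∏-≤^ K λ _ → ∏-≤^ K λ _ → ℕ.<⇒≤ (w-top _ _)
    lhs : ∀ s m d → s * s * (2 * suc d) + s * d * m + (s * d * m + (d * (m * m) + 12 * suc d * m)) ≡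
      s * (s * (2 * suc d)) + (s * d * m + (s * d * m + (d * (m * m) + 12 * suc d * m)))
    lhs = solve-∀
    rhs : ∀ s m d → s * (6 * (2 * suc d)) + (s * d * m + (s * d * m + (d * (m * m) + 12 * suc d * m))) + d * (s * s) ≡
      d * ((s + m) * (s + m)) + 12 * suc d * (s + m)
    rhs = solve-∀
    exponents : s * s * e + s * d * m + (s * d * m + (d * (m * m) + 12 * suc d * m)) ≤
      d * ((s + m) * (s + m)) + 12 * suc d * (s + m)
    exponents = begin
      s * s * e + s * d * m + (s * d * m + (d * (m * m) + 12 * suc d * m)) ≡⟨ lhs s m d ⟩
      s * (s * e) + (s * d * m + (s * d * m + (d * (m * m) + 12 * suc d * m)))
        ≤⟨ ℕ.+-monoˡ-≤ _ (ℕ.*-monoʳ-≤ s (ℕ.*-monoˡ-≤ e s≤6)) ⟩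
      s * (6 * e) + (s * d * m + (s * d * m + (d * (m * m) + 12 * suc d * m))) ≤⟨ ℕ.m≤m+n _ (d * (s * s)) ⟩
      s * (6 * e) + (s * d * m + (s * d * m + (d * (m * m) + 12 * suc d * m))) + d * (s * s) ≡⟨ rhs s m d ⟩
      d * ((s + m) * (s + m)) + 12 * suc d * (s + m) ∎

  delete-pointwise : ∀ K R {S} → S ↭ K ++ R → length K ≤ 6 →
    (∀ {v} → v ∈ R → ∏ K (w v) ^ e ≤ r ^ (length K * d)) → Bounded R → Bounded S
  delete-pointwise K R S↭ s≤6 h = delete K R S↭ s≤6 (begin
    ∏ R (λ v → ∏ K (w v)) ^ e    ≡⟨ ∏-^ R ⟩
    ∏ R (λ v → ∏ K (w v) ^ e)    ≤⟨ ∏-≤^ R h ⟩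
    (r ^ (length K * d)) ^ length R ∎)
    where
    open ℕ.≤-Reasoning
    ∏-^ : ∀ R → ∏ R (λ v → ∏ K (w v)) ^ e ≡ ∏ R (λ v → ∏ K (w v) ^ e)
    ∏-^ []      = ℕ.^-zeroˡ e
    ∏-^ (v ∷ R) = ≡-trans (^-distribʳ-* e (∏ K (w v)) _) (cong (∏ K (w v) ^ e *_) (∏-^ R))

  neighbours : V → List V → List V
  neighbours v = filter (λ k → ¬? (part v ≟Q part k))

  ∏-neighbours : ∀ v K → ∏ K (w v) ≡ ∏ (neighbours v K) (w v)
  ∏-neighbours v [] = refl
  ∏-neighbours v (k ∷ K) with ih ← ∏-neighbours v K | part v ≟Q part k
  ... | yes eq = ≡-trans (cong₂ _*_ (w-same eq) ih) (ℕ.*-identityˡ _)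
  ... | no  _  = cong (w v k *_) ih

  star-bound : ∀ v {K} → Clique K → ∃ λ g → ∏ K (w v) ≤ ∏ (neighbours v K) (λ k → 1 ⊔ g k) ×
    sum (map g (neighbours v K)) ≤ r
  star-bound v {K} clique
    with g , w≤ , Σ≤ ← w-star v (neighbours v K) (AllPairs.filter⁺ _ clique) (All.all-filter _ K) =
    g , ℕ.≤-trans (ℕ.≤-reflexive (∏-neighbours v K)) (∏-mono (neighbours v K) w≤) , Σ≤

  maxProd-monoˡ : ∀ {i j} s → i ≤ j → maxProd i s ≤ maxProd j s
  maxProd-monoˡ {i} {j} s i≤j with ℕ.m≤n⇒m<n∨m≡n i≤j
  ... | inj₂ refl = ℕ.≤-refl
  maxProd-monoˡ {i} {suc j} s _ | inj₁ (s≤s i≤j) = ℕ.≤-trans (maxProd-monoˡ s i≤j) (maxProd-suc j s)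

  -- The clique vertex in the part of v has weight 1 with v, so one factor fewer shares the r
  -- colours.
  covered-bound : ∀ v {k K} → Clique (k ∷ K) → Any (λ k → part v ≡ part k) (k ∷ K) →
    ∏ (k ∷ K) (w v) ≤ maxProd (length K) r
  covered-bound v {k} {K} clique any with g , ∏≤ , Σ≤ ← star-bound v clique =
    ℕ.≤-trans ∏≤ (ℕ.≤-trans (∏≤maxProd g (neighbours v (k ∷ K)) Σ≤)
      (maxProd-monoˡ r (ℕ.≤-pred (List.filter-notAll (λ k → ¬? (part v ≟Q part k)) (k ∷ K) (Any.map (λ eq neq → neq eq) any)))))

  cube-bound : ∀ v {K} → Clique K → ∏ K (w v) ^ 3 ≤ 3 ^ r
  cube-bound v {K} clique with g , ∏≤ , Σ≤ ← star-bound v clique =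
    ℕ.≤-trans (ℕ.^-monoˡ-≤ 3 ∏≤) (∏³≤3^ g (neighbours v K) Σ≤)

  outside? : ∀ K S → (∃ λ v → v ∈ S × All (λ k → part v ≢ part k) K) ⊎
    (∀ {v} → v ∈ S → Any (λ k → part v ≡ part k) K)
  outside? K [] = inj₂ λ ()
  outside? K (v ∷ S) with Any.any? (λ k → part v ≟Q part k) K
  ... | no none = inj₁ (v , here refl , All.¬Any⇒All¬ K none)
  ... | yes any with outside? K S
  ...   | inj₁ (u , u∈ , out) = inj₁ (u , there u∈ , out)
  ...   | inj₂ cov = inj₂ λ { (here refl) → any ; (there v∈) → cov v∈ }

  bring : ∀ {v : V} {R} → v ∈ R → ∃ λ R′ → R ↭ v ∷ R′
  bring v∈ with ys , zs , refl ← ∈-∃++ v∈ = ys ++ zs , ↭.shift _ ys zs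

  extend : ∀ {v K R S} → S ↭ K ++ R → v ∈ S → All (λ k → part v ≢ part k) K → ∃ λ R′ → R ↭ v ∷ R′
  extend {K = K} S↭ v∈ out with ∈-++⁻ K (↭.∈-resp-↭ S↭ v∈)
  ... | inj₁ v∈K = contradiction refl (All.lookup out v∈K)
  ... | inj₂ v∈R = bring v∈R

  Heaviest : List V → ℕ → Set
  Heaviest S g = ∀ {u v} → u ∈ S → v ∈ S → part u ≢ part v → w u v ≤ g

  heaviest : ∀ S → (∀ {u v} → u ∈ S → v ∈ S → part u ≡ part v) ⊎
    (∃₂ λ a b → a ∈ S × b ∈ S × part a ≢ part b × Heaviest S (w a b))
  heaviest S = search r (λ _ _ _ → ℕ.<⇒≤ (w-top _ _))
    where
    search : ∀ g → Heaviest S g → (∀ {u v} → u ∈ S → v ∈ S → part u ≡ part v) ⊎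
      (∃₂ λ a b → a ∈ S × b ∈ S × part a ≢ part b × Heaviest S (w a b))
    -- The search lowers g from r. Weights are positive, so it gets to 0 only if all vertices lie in
    -- one part.
    search zero h = inj₁ λ {u} {v} u∈ v∈ → case part u ≟Q part v of λ
      { (yes eq) → eq ; (no neq) → contradiction (w-pos u v) (ℕ.<⇒≱ (s≤s (h u∈ v∈ neq))) }
    search (suc g) h
      with Any.any? (λ p → ¬? (part (proj₁ p) ≟Q part (proj₂ p)) ×-dec (w (proj₁ p) (proj₂ p) ℕ.≟ suc g)) (cartesianProduct S S)
    ... | yes any with (a , b) , p∈ , neq , eq ← find any
      with a∈ , b∈ ← ∈-cartesianProduct⁻ S S p∈ =
      inj₂ (a , b , a∈ , b∈ , neq , λ u∈ v∈ ne → ℕ.≤-trans (h u∈ v∈ ne) (ℕ.≤-reflexive (≡-sym eq)))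
    ... | no none = search g λ {u} {v} u∈ v∈ ne → ℕ.≤-pred (ℕ.≤∧≢⇒< (h u∈ v∈ ne)
      λ eq → none (Any.map (λ { refl → ne , eq }) (∈-cartesianProduct⁺ u∈ v∈)))

  -- Two bounds of opposite tendency: maximality of `w a b` is strong when it is small, and
  -- disjointness from the list of a b is strong when it is large.
  pair-bound : ∀ {a b v S} → a ∈ S → b ∈ S → v ∈ S → part a ≢ part b → Heaviest S (w a b) →
    part v ≢ part a → part v ≢ part b → w v a * w v b ≤ (w a b * w a b) ⊓ maxProd 2 (r ∸ w a b)
  pair-bound a∈ b∈ v∈ a≁b heavy v≁a v≁b =
    ℕ.⊓-glb (ℕ.*-mono-≤ (heavy v∈ a∈ v≁a) (heavy v∈ b∈ v≁b)) (w-tri v≁a v≁b a≁b)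

  Apart : V → V → V → Set
  Apart a b v = part v ≢ part a × part v ≢ part b

  apart? : ∀ a b v → Dec (Apart a b v)
  apart? a b v = ¬? (part v ≟Q part a) ×-dec ¬? (part v ≟Q part b)

  ∏₂ : ∀ {v a b} → w v a * w v b ≡ ∏ (a ∷ b ∷ []) (w v)
  ∏₂ {v} {a} {b} = cong (w v a *_) (≡-sym (ℕ.*-identityʳ (w v b)))

  -- With g the weight of a b, a vertex in the part of a or b contributes at most g < r. A vertex in
  -- neither part contributes at most k, possibly more than r, but g k < r². So the vertices in
  -- neither part may be paired off if they are not the majority.
  delete-pair : ∀ {a b R S} → S ↭ a ∷ b ∷ R → part a ≢ part b → Heaviest S (w a b) →
    length (filter (apart? a b) R) ≤ length (filter (¬? ∘ apart? a b) R) → Bounded R → Bounded S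
  delete-pair {a} {b} {R} {S} S↭ a≁b heavy c≤m =
    delete (a ∷ b ∷ []) R S↭ (s≤s (s≤s z≤n)) (begin
      ∏ R (λ v → ∏ (a ∷ b ∷ []) (w v)) ^ e  ≤⟨ ℕ.^-monoˡ-≤ e (∏-split (apart? a b) R far near) ⟩
      (k ^ c * g ^ m) ^ e                    ≡⟨ cong (_^ e) (ℕ.*-comm (k ^ c) _) ⟩
      (g ^ m * k ^ c) ^ e                    ≤⟨ balance e c≤m
          (ℕ.≤-trans (ℕ.^-monoˡ-≤ e (ℕ.<⇒≤pred (w-top a b))) gain₂)
          (ℕ.≤-trans (proj₁ (gain₃ (w-top a b))) (ℕ.≤-reflexive
            (≡-trans (cong (r ^_) (ℕ.*-distribʳ-+ d 2 2)) (ℕ.^-distribˡ-+-* r (2 * d) (2 * d))))) ⟩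
      (r ^ (2 * d)) ^ (m + c)                ≡⟨ cong ((r ^ (2 * d)) ^_)
          (≡-trans (ℕ.+-comm m c) (length-filter-split (apart? a b) R)) ⟩
      (r ^ (2 * d)) ^ length R               ∎)
    where
    open ℕ.≤-Reasoning
    g k c m : ℕ
    g = w a b
    k = (g * g) ⊓ maxProd 2 (r ∸ g)
    c = length (filter (apart? a b) R)
    m = length (filter (¬? ∘ apart? a b) R)
    back : ∀ {v} → v ∈ a ∷ b ∷ R → v ∈ S
    back = ↭.∈-resp-↭ (↭-sym S↭)
    far : ∀ {v} → v ∈ R → Apart a b v → ∏ (a ∷ b ∷ []) (w v) ≤ k
    far v∈ (v≁a , v≁b) = subst (_≤ k) ∏₂
      (pair-bound (back (here refl)) (back (there (here refl))) (back (there (there v∈))) a≁b heavy v≁a v≁b)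
    near : ∀ {v} → v ∈ R → ¬ Apart a b v → ∏ (a ∷ b ∷ []) (w v) ≤ g
    near {v} v∈ ¬apart with part v ≟Q part a | part v ≟Q part b
    ... | yes v~a | _ = subst (_≤ g) (≡-trans (≡-sym (ℕ.*-identityˡ _)) (≡-trans (cong (_* w v b) (≡-sym (w-same v~a))) ∏₂))
      (heavy (back (there (there v∈))) (back (there (here refl))) λ v~b → a≁b (≡-trans (≡-sym v~a) v~b))
    ... | no v≁a | yes v~b = subst (_≤ g) (≡-trans (≡-sym (ℕ.*-identityʳ _)) (≡-trans (cong (w v a *_) (≡-sym (w-same v~b))) ∏₂))
      (heavy (back (there (there v∈))) (back (here refl)) v≁a)
    ... | no v≁a | no v≁b = contradiction (v≁a , v≁b) ¬apart

  -- The reverse situation. A vertex in the part of c has weight 1 with c and contributes at most k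
  -- < r ^ (3 / 2). One in the part of a or b may exceed r ^ (3 / 2), but the product of both
  -- contributions is below r³, and now the part of c has the majority.
  delete-triangle : ∀ {a b c R S} → S ↭ a ∷ b ∷ c ∷ R → part a ≢ part b → part a ≢ part c → part b ≢ part c →
    (∀ {v} → v ∈ S → Any (λ k → part v ≡ part k) (a ∷ b ∷ c ∷ [])) → Heaviest S (w a b) →
    length (filter (¬? ∘ apart? a b) R) ≤ length (filter (apart? a b) R) → Bounded R → Bounded S
  delete-triangle {a} {b} {c} {R} {S} S↭ a≁b a≁c b≁c covered heavy m≤c′ =
    delete (a ∷ b ∷ c ∷ []) R S↭ (s≤s (s≤s (s≤s z≤n))) (begin
      ∏ R (λ v → ∏ (a ∷ b ∷ c ∷ []) (w v)) ^ e  ≤⟨ ℕ.^-monoˡ-≤ e (∏-split (apart? a b) R far near) ⟩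
      (k ^ c′ * l ^ m) ^ e                       ≤⟨ balance e m≤c′ (proj₂ (proj₂ (gain₃ (w-top a b))))
          (ℕ.≤-trans (proj₁ (proj₂ (gain₃ (w-top a b)))) (ℕ.≤-reflexive
            (≡-trans (cong (r ^_) (ℕ.*-distribʳ-+ d 3 3)) (ℕ.^-distribˡ-+-* r (3 * d) (3 * d))))) ⟩
      (r ^ (3 * d)) ^ (c′ + m)                   ≡⟨ cong ((r ^ (3 * d)) ^_) (length-filter-split (apart? a b) R) ⟩
      (r ^ (3 * d)) ^ length R                   ∎)
    where
    open ℕ.≤-Reasoning
    g k l c′ m : ℕ
    g = w a b
    k = (g * g) ⊓ maxProd 2 (r ∸ g)
    l = maxProd 2 (r ∸ 1)
    c′ = length (filter (apart? a b) R)
    m = length (filter (¬? ∘ apart? a b) R)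
    back : ∀ {v} → v ∈ a ∷ b ∷ c ∷ R → v ∈ S
    back = ↭.∈-resp-↭ (↭-sym S↭)
    tri : ∀ {v x y} → part v ≢ part x → part v ≢ part y → part x ≢ part y → w v x * w v y ≤ l
    tri {x = x} {y} v≁x v≁y x≁y = ℕ.≤-trans (w-tri v≁x v≁y x≁y) (maxProd-mono 2 (ℕ.∸-monoʳ-≤ r (w-pos x y)))
    far : ∀ {v} → v ∈ R → Apart a b v → ∏ (a ∷ b ∷ c ∷ []) (w v) ≤ k
    far {v} v∈ (v≁a , v≁b) with covered (back (there (there (there v∈))))
    ... | here v~a                 = contradiction v~a v≁a
    ... | there (here v~b)         = contradiction v~b v≁b
    ... | there (there (here v~c)) = subst (_≤ k)
      (cong (w v a *_) (≡-trans (≡-sym (ℕ.*-identityʳ _)) (cong (λ x → w v b * (x * 1)) (≡-sym (w-same v~c)))))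
      (pair-bound (back (here refl)) (back (there (here refl))) (back (there (there (there v∈)))) a≁b heavy v≁a v≁b)
    near : ∀ {v} → v ∈ R → ¬ Apart a b v → ∏ (a ∷ b ∷ c ∷ []) (w v) ≤ l
    near {v} v∈ ¬apart with part v ≟Q part a | part v ≟Q part b
    ... | yes v~a | _ = subst (_≤ l)
      (≡-trans ∏₂ (≡-trans (≡-sym (ℕ.*-identityˡ _)) (cong (_* ∏ (b ∷ c ∷ []) (w v)) (≡-sym (w-same v~a)))))
      (tri (λ v~b → a≁b (≡-trans (≡-sym v~a) v~b)) (λ v~c → a≁c (≡-trans (≡-sym v~a) v~c)) b≁c)
    ... | no v≁a | yes v~b = subst (_≤ l)
      (≡-trans ∏₂ (cong (w v a *_) (≡-trans (≡-sym (ℕ.*-identityˡ _)) (cong (_* (w v c * 1)) (≡-sym (w-same v~b))))))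
      (tri v≁a (λ v~c → b≁c (≡-trans (≡-sym v~b) v~c)) a≁c)
    ... | no v≁a | no v≁b = contradiction (v≁a , v≁b) ¬apart

  count-apart : ∀ {a b c R} → part a ≢ part c → part b ≢ part c →
    length (filter (apart? a b) (c ∷ R)) ≡ suc (length (filter (apart? a b) R)) ×
    length (filter (¬? ∘ apart? a b) (c ∷ R)) ≡ length (filter (¬? ∘ apart? a b) R)
  count-apart {a} {b} a≁c b≁c =
    cong length (List.filter-accept (apart? a b) apart) ,
    cong length (List.filter-reject (¬? ∘ apart? a b) (λ ¬apart → ¬apart apart))
    where
    apart : Apart a b _
    apart = a≁c ∘ ≡-sym , b≁c ∘ ≡-sym

  -- With at most three parts, the pair a b of maximal weight is removed, unless the third part is so large
  -- that removing a triangle on a b is better.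
  bounded : ∀ k S → length S ≤ k → Bounded S
  bounded k [] _ = ℕ.≤-trans (ℕ.≤-reflexive (ℕ.^-zeroˡ e)) (1≤^ (d * 0 + 12 * suc d * 0) (ℕ.<⇒≤ 1<r))
  bounded (suc k) S@(_ ∷ _) S≤ with heaviest S
  ... | inj₁ same = ℕ.≤-trans
    (ℕ.≤-reflexive (≡-trans (cong (_^ e) (∏-≡1 S λ u∈ → ∏-≡1 S λ v∈ → w-same (same u∈ v∈))) (ℕ.^-zeroˡ e)))
    (1≤^ (d * (length S * length S) + 12 * suc d * length S) (ℕ.<⇒≤ 1<r))
  ... | inj₂ (a , b , a∈ , b∈ , a≁b , heavy) = choose-third
    where
    rest : ∀ {v R} → S ↭ v ∷ R → length R ≤ k
    rest S↭ = ℕ.≤-pred (subst (_≤ suc k) (↭.↭-length S↭) S≤)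
    shorter : ∀ K {v R} → S ↭ v ∷ K ++ R → Bounded R
    shorter K {R = R} S↭ = bounded k R (ℕ.≤-trans
      (ℕ.≤-trans (ℕ.m≤n+m _ (length K)) (ℕ.≤-reflexive (≡-sym (List.length-++ K)))) (rest S↭))

    five : ∀ {K R} → S ↭ K ++ R → Clique K → length K ≡ 5 → Bounded S
    five {[]} _ _ ()
    five {k₁ ∷ K} {R} S↭ clique eq with outside? (k₁ ∷ K) S
    ... | inj₂ covered = delete-pointwise (k₁ ∷ K) R S↭ (subst (_≤ 6) (≡-sym eq) (ℕ.n≤1+n 5))
      (λ {v} v∈ → ℕ.≤-trans (ℕ.^-monoˡ-≤ e (covered-bound v clique (covered (↭.∈-resp-↭ (↭-sym S↭) (∈-++⁺ʳ _ v∈)))))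
        (subst₂ (λ i j → maxProd i r ^ e ≤ r ^ (j * d)) (cong pred (≡-sym eq)) (≡-sym eq) gain₅))
      (shorter K S↭)
    -- A six-clique needs no distinction between covered and uncovered vertices: every product x has
    -- `x ^ 3 ≤ 3 ^ r`, and `3 ^ r < r ^ 9`.
    ... | inj₁ (v , v∈ , out) with R′ , R↭ ← extend {K = k₁ ∷ K} S↭ v∈ out =
      delete-pointwise (v ∷ k₁ ∷ K) R′ S↭′ (ℕ.≤-reflexive (cong suc eq))
        (λ {u} _ → cube-cancel (begin
          (∏ (v ∷ k₁ ∷ K) (w u) ^ e) ^ 3  ≡⟨ ^-swap (∏ (v ∷ k₁ ∷ K) (w u)) e 3 ⟩
          (∏ (v ∷ k₁ ∷ K) (w u) ^ 3) ^ e  ≤⟨ ℕ.^-monoˡ-≤ e (cube-bound u (out ∷ clique)) ⟩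
          (3 ^ r) ^ e                     ≤⟨ gain₆ ⟩
          (r ^ (6 * d)) ^ 3               ≡⟨ cong (λ j → (r ^ (suc j * d)) ^ 3) eq ⟨
          (r ^ (suc (suc (length K)) * d)) ^ 3 ∎))
        (shorter (k₁ ∷ K) S↭′)
      where
      open ℕ.≤-Reasoning
      S↭′ : S ↭ v ∷ k₁ ∷ K ++ R′
      S↭′ = ↭-trans S↭ (↭-trans (↭.++⁺ˡ (k₁ ∷ K) R↭) (↭.shift v (k₁ ∷ K) R′))

    four : ∀ {K R} → S ↭ K ++ R → Clique K → length K ≡ 4 → Bounded S
    four {[]} _ _ ()
    four {k₁ ∷ K} {R} S↭ clique eq with outside? (k₁ ∷ K) S
    ... | inj₂ covered = delete-pointwise (k₁ ∷ K) R S↭ (subst (_≤ 6) (≡-sym eq) (ℕ.m≤n+m 4 2))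
      (λ {v} v∈ → ℕ.≤-trans (ℕ.^-monoˡ-≤ e (covered-bound v clique (covered (↭.∈-resp-↭ (↭-sym S↭) (∈-++⁺ʳ _ v∈)))))
        (subst₂ (λ i j → maxProd i r ^ e ≤ r ^ (j * d)) (cong pred (≡-sym eq)) (≡-sym eq) gain₄))
      (shorter K S↭)
    ... | inj₁ (v , v∈ , out) with R′ , R↭ ← extend {K = k₁ ∷ K} S↭ v∈ out =
      five (↭-trans S↭ (↭-trans (↭.++⁺ˡ (k₁ ∷ K) R↭) (↭.shift v (k₁ ∷ K) R′))) (out ∷ clique) (cong suc eq)

    choose-third : Bounded S
    choose-third
      with R₁ , S↭₁ ← bring a∈
      with R₂ , R₁↭ ← extend {K = a ∷ []} S↭₁ b∈ ((a≁b ∘ ≡-sym) ∷ [])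
      with S↭₂ ← ↭-trans S↭₁ (prep a R₁↭)
      with outside? (a ∷ b ∷ []) S
    ... | inj₂ covered = delete-pair S↭₂ a≁b heavy
      (subst (_≤ length (filter (¬? ∘ apart? a b) R₂)) (≡-sym (cong length (List.filter-none (apart? a b) (All.tabulate none)))) z≤n)
      (shorter (b ∷ []) S↭₂)
      where
      none : ∀ {v} → v ∈ R₂ → ¬ Apart a b v
      none v∈ (v≁a , v≁b) with covered (↭.∈-resp-↭ (↭-sym S↭₂) (there (there v∈)))
      ... | here v~a         = v≁a v~a
      ... | there (here v~b) = v≁b v~b
    ... | inj₁ (c , c∈ , c≁a ∷ c≁b ∷ [])
      with R₃ , R₂↭ ← extend {K = a ∷ b ∷ []} S↭₂ c∈ (c≁a ∷ c≁b ∷ [])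
      with S↭₃ ← ↭-trans S↭₂ (prep a (prep b R₂↭))
      with outside? (a ∷ b ∷ c ∷ []) S
    ...   | inj₁ (v , v∈ , out) with R₄ , R₃↭ ← extend {K = a ∷ b ∷ c ∷ []} S↭₃ v∈ out =
      four (↭-trans S↭₃ (↭-trans (↭.++⁺ˡ (a ∷ b ∷ c ∷ []) R₃↭) (↭.shift v (a ∷ b ∷ c ∷ []) R₄)))
        (out ∷ (a≁b ∷ c≁a ∘ ≡-sym ∷ []) ∷ (c≁b ∘ ≡-sym ∷ []) ∷ [] ∷ []) refl
    ...   | inj₂ covered with count-apart (c≁a ∘ ≡-sym) (c≁b ∘ ≡-sym)
                            | ℕ.<-≤-connex (length (filter (apart? a b) R₃)) (length (filter (¬? ∘ apart? a b) R₃))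
    ...     | _ | inj₂ m≤c = delete-triangle S↭₃ a≁b (c≁a ∘ ≡-sym) (c≁b ∘ ≡-sym) covered heavy m≤c
      (shorter (b ∷ c ∷ []) S↭₃)
    -- Only a and b are removed, so c returns to the remaining vertices. It lies outside the parts
    -- of a and b, and the strict inequality makes room for it.
    ...     | eq₁ , eq₂ | inj₁ c<m = delete-pair {R = c ∷ R₃} S↭₃ a≁b heavy
      (subst₂ _≤_ (≡-sym eq₁) (≡-sym eq₂) c<m) (shorter (b ∷ []) S↭₃)

-- Lists of admissible colours

-- Pigeonhole. It supplies a common neighbour for two vertices of a colour component with three
-- parts, and a third part away from a given edge.
avoid-two : {p q s : Fin n} → p ≢ q → p ≢ s → q ≢ s → ∀ x y →
  (x ≢ p × y ≢ p) ⊎ (x ≢ q × y ≢ q) ⊎ (x ≢ s × y ≢ s)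
avoid-two {p = p} {q} p≢q p≢s q≢s x y with x ≟ p | y ≟ p
... | no x≢p | no y≢p = inj₁ (x≢p , y≢p)
... | yes refl | _ with y ≟ q
...   | no y≢q   = inj₂ (inj₁ (p≢q , y≢q))
...   | yes refl = inj₂ (inj₂ (p≢s , q≢s))
avoid-two {q = q} p≢q p≢s q≢s x y | no _ | yes refl with x ≟ q
...   | no x≢q   = inj₂ (inj₁ (x≢q , p≢q))
...   | yes refl = inj₂ (inj₂ (q≢s , p≢s))

module Lists {n r : ℕ} (part : Fin n → Fin n) (label : Fin n → Fin r → Fin n ⊎ Fin n) where

  Starred : Fin n ⊎ Fin n → Set
  Starred x = ∃ λ z → x ≡ inj₂ z

  starred? : ∀ x → Dec (Starred x)
  starred? (inj₁ _) = no λ ()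
  starred? (inj₂ z) = yes (z , refl)

  _≟ᴸ_ : DecidableEquality (Fin n ⊎ Fin n)
  _≟ᴸ_ = Sum.≡-dec _≟_ _≟_

  -- Equally starred vertices lie in one complete multipartite component of that colour, which forces
  -- the colour of the edge between them; other edges may use a colour only if the labels at both ends agree to it.
  Shared Crossing : Fin n → Fin n → Fin r → Set
  Shared u v i = Starred (label u i) × label u i ≡ label v i
  Crossing u v i = label u i ≡ inj₁ (part v) × label v i ≡ inj₁ (part u)

  Forced : Fin n → Fin n → Set
  Forced u v = ∃ (Shared u v)

  forced? : ∀ u v → Dec (Forced u v)
  forced? u v = Fin.any? λ i → starred? (label u i) ×-dec (label u i ≟ᴸ label v i)

  crossing? : ∀ u v i → Dec (Crossing u v i)
  crossing? u v i = (label u i ≟ᴸ _) ×-dec (label v i ≟ᴸ _)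

  colours : Fin n → Fin n → List (Fin r)
  colours u v with forced? u v
  ... | yes (i , _) = [ i ]
  ... | no _        = filter (crossing? u v) (allFin r)

  weight : Fin n → Fin n → ℕ
  weight u v with part u ≟ part v
  ... | yes _ = 1
  ... | no  _ = length (colours u v)

  forced-sym : ∀ {u v} → Forced u v → Forced v u
  forced-sym (i , (z , eq) , e) = i , (z , ≡-trans (≡-sym e) eq) , ≡-sym e

  forced-colours : ∀ {u v} → Forced u v → length (colours u v) ≡ 1
  forced-colours {u} {v} f with forced? u v
  ... | yes _ = refl
  ... | no ¬f = contradiction f ¬f

  free-colours : ∀ {u v} → ¬ Forced u v → colours u v ≡ filter (crossing? u v) (allFin r)
  free-colours {u} {v} ¬f with forced? u v
  ... | yes f = contradiction f ¬f
  ... | no _  = refl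

  ∈-colours : ∀ {u v i} → i ∈ colours u v → Forced u v × Starred (label u i) ⊎ Crossing u v i
  ∈-colours {u} {v} i∈ with forced? u v
  ∈-colours {u} {v} (here refl) | yes f@(_ , s , _) = inj₁ (f , s)
  ∈-colours {u} {v} i∈          | no _ = inj₂ (proj₂ (∈-filter⁻ (crossing? u v) {xs = allFin r} i∈))

  colours-unique : ∀ u v → Unique (colours u v)
  colours-unique u v with forced? u v
  ... | yes _ = [] ∷ []
  ... | no _  = Unique.filter⁺ (crossing? u v) (Unique.allFin⁺ r)

  colours-sym : ∀ u v → length (colours u v) ≡ length (colours v u)
  colours-sym u v with forced? u v
  ... | yes f = ≡-sym (forced-colours (forced-sym f))
  ... | no ¬f = cong length (≡-trans
    (List.filter-≐ (crossing? u v) (crossing? v u) ((λ (p , q) → q , p) , (λ (p , q) → q , p)) (allFin r))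
    (≡-sym (free-colours (¬f ∘ forced-sym))))

  weight-same : ∀ {u v} → part u ≡ part v → weight u v ≡ 1
  weight-same {u} {v} eq with part u ≟ part v
  ... | yes _ = refl
  ... | no ne = contradiction eq ne

  weight-apart : ∀ {u v} → part u ≢ part v → weight u v ≡ length (colours u v)
  weight-apart {u} {v} ne with part u ≟ part v
  ... | yes eq = contradiction eq ne
  ... | no _   = refl

  weight-sym : ∀ u v → weight u v ≡ weight v u
  weight-sym u v with part u ≟ part v
  ... | yes eq = ≡-sym (weight-same (≡-sym eq))
  ... | no ne  = ≡-trans (colours-sym u v) (≡-sym (weight-apart (ne ∘ ≡-sym)))

  weight-forced : ∀ {u v} → Forced u v → weight u v ≡ 1
  weight-forced {u} {v} f with part u ≟ part v
  ... | yes _ = refl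
  ... | no _  = forced-colours f

  -- At u a colour has only one label. A forced colour is starred there and a crossing colour names
  -- the part at the other end, so it cannot serve two edges to different parts unless both are
  -- forced.
  disjoint : ∀ {u v x} → part v ≢ part x → ¬ (Forced u v × Forced u x) →
    ∀ {i} → i ∈ colours u v → i ∈ colours u x → ⊥
  disjoint v≁x ¬both i∈ i∈′ with ∈-colours i∈ | ∈-colours i∈′
  ... | inj₁ (f , _)       | inj₁ (f′ , _)      = ¬both (f , f′)
  ... | inj₁ (_ , _ , eq)  | inj₂ (eq′ , _)     = case ≡-trans (≡-sym eq) eq′ of λ ()
  ... | inj₂ (eq , _)      | inj₁ (_ , _ , eq′) = case ≡-trans (≡-sym eq) eq′ of λ ()
  ... | inj₂ (eq , _)      | inj₂ (eq′ , _)     = v≁x (Sum.inj₁-injective (≡-trans (≡-sym eq) eq′))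

  colours-swap : ∀ {u v i} → ¬ Forced u v → i ∈ colours u v → i ∈ colours v u
  colours-swap {u} {v} {i} ¬f i∈ = subst (i ∈_) (≡-sym (free-colours (¬f ∘ forced-sym)))
    (let i∈all , p , q = ∈-filter⁻ (crossing? u v) {xs = allFin r} (subst (i ∈_) (free-colours ¬f) i∈)
     in ∈-filter⁺ (crossing? v u) i∈all (q , p))

  length≤r : {xs : List (Fin r)} → Unique xs → length xs ≤ r
  length≤r uniq = ℕ.≤-trans (⊆⇒length≤ uniq (λ _ → ∈-allFin _)) (ℕ.≤-reflexive (List.length-tabulate {n = r} id))

  two-weights : ∀ {u v x} → part u ≢ part v → part u ≢ part x → part v ≢ part x → ¬ (Forced u v × Forced u x) →
    weight u v + weight u x ≤ r
  two-weights {u} {v} {x} u≁v u≁x v≁x ¬both = begin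
    weight u v + weight u x                      ≡⟨ cong₂ _+_ (weight-apart u≁v) (weight-apart u≁x) ⟩
    length (colours u v) + length (colours u x)  ≡⟨ List.length-++ (colours u v) ⟨
    length (colours u v ++ colours u x)          ≤⟨ length≤r (Unique.++⁺ (colours-unique u v) (colours-unique u x)
                                                      λ (p , q) → disjoint v≁x ¬both p q) ⟩
    r                                            ∎
    where open ℕ.≤-Reasoning

  -- Any two edges of the triangle meet in a vertex, whose labels separate their lists. The edge b c
  -- may be forced: its colour is starred at b and c, whereas the colours of v b and v c have
  -- unstarred labels there.
  three-weights : ∀ {v b c} → part v ≢ part b → part v ≢ part c → part b ≢ part c → ¬ Forced v b → ¬ Forced v c →
    weight v b + weight v c + weight b c ≤ r
  three-weights {v} {b} {c} v≁b v≁c b≁c ¬fb ¬fc = begin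
    weight v b + weight v c + weight b c
      ≡⟨ cong₂ _+_ (cong₂ _+_ (weight-apart v≁b) (weight-apart v≁c)) (weight-apart b≁c) ⟩
    length (colours v b) + length (colours v c) + length (colours b c)
      ≡⟨ cong (_+ length (colours b c)) (List.length-++ (colours v b)) ⟨
    length (colours v b ++ colours v c) + length (colours b c)
      ≡⟨ List.length-++ (colours v b ++ colours v c) ⟨
    length ((colours v b ++ colours v c) ++ colours b c)
      ≤⟨ length≤r (Unique.++⁺
          (Unique.++⁺ (colours-unique v b) (colours-unique v c) λ (p , q) → disjoint b≁c (¬fb ∘ proj₁) p q)
          (colours-unique b c) λ (p , q) → [ (λ p → disjoint v≁c (¬fb ∘ forced-sym ∘ proj₁) (colours-swap ¬fb p) q)
                                           , (λ p → disj-c p q) ]′ (∈-++⁻ (colours v b) p)) ⟩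
    r ∎
    where
    open ℕ.≤-Reasoning
    disj-c : ∀ {i} → i ∈ colours v c → i ∈ colours b c → ⊥
    disj-c p q with ∈-colours p | ∈-colours q
    ... | inj₁ (f , _)  | _                      = ¬fc f
    ... | inj₂ (_ , eq) | inj₂ (_ , eq′)         = v≁b (Sum.inj₁-injective (≡-trans (≡-sym eq) eq′))
    ... | inj₂ (_ , eq) | inj₁ _ with forced? b c
    disj-c p (here refl) | inj₂ (_ , eq) | inj₁ _ | yes (_ , (_ , s) , t) = case ≡-trans (≡-sym eq) (≡-trans (≡-sym t) s) of λ ()
    disj-c p q           | inj₂ _        | inj₁ (f , _) | no ¬f = ¬f f

  *≤maxProd₂ : ∀ {x y s} → x + y ≤ s → x * y ≤ maxProd 2 s
  *≤maxProd₂ {x} {y} {s} h = ℕ.≤-trans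
    (ℕ.*-mono-≤ (ℕ.m≤n⊔m 1 x) (ℕ.≤-trans (ℕ.m≤n⊔m 1 y) (ℕ.≤-reflexive (≡-sym (ℕ.*-identityʳ _)))))
    (∏≤maxProd id (x ∷ y ∷ []) (subst (_≤ s) (cong (x +_) (≡-sym (ℕ.+-identityʳ y))) h))

  ≤maxProd₂ : ∀ {x s} → x ≤ s → x ≤ maxProd 2 s
  ≤maxProd₂ {x} {s} h = ℕ.≤-trans
    (ℕ.≤-trans (ℕ.m≤n⊔m 1 x) (ℕ.≤-reflexive (≡-sym (≡-trans (ℕ.*-identityˡ _) (ℕ.*-identityʳ _)))))
    (∏≤maxProd id (0 ∷ x ∷ []) (subst (_≤ s) (≡-sym (ℕ.+-identityʳ x)) h))

  -- A forced edge at v contributes a factor 1. If only one is forced, the other one and b c share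
  -- an endpoint, and their two lists are disjoint there.
  weight-tri : ∀ {v b c} → part v ≢ part b → part v ≢ part c → part b ≢ part c →
    weight v b * weight v c ≤ maxProd 2 (r ∸ weight b c)
  weight-tri {v} {b} {c} v≁b v≁c b≁c with forced? v b | forced? v c
  ... | yes fb | yes fc = ℕ.≤-trans (ℕ.≤-reflexive (cong₂ _*_ (weight-forced fb) (weight-forced fc))) (1≤maxProd 2 (r ∸ weight b c))
  ... | yes fb | no ¬fc = ℕ.≤-trans
    (ℕ.≤-reflexive (≡-trans (cong (_* weight v c) (weight-forced fb)) (ℕ.*-identityˡ _)))
    (≤maxProd₂ (ℕ.m+n≤o⇒m≤o∸n (weight v c) (subst₂ (λ x y → x + y ≤ r) (weight-sym c v) (weight-sym c b)
      (two-weights (v≁c ∘ ≡-sym) (b≁c ∘ ≡-sym) v≁b (¬fc ∘ forced-sym ∘ proj₁)))))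
  ... | no ¬fb | yes fc = ℕ.≤-trans
    (ℕ.≤-reflexive (≡-trans (cong (weight v b *_) (weight-forced fc)) (ℕ.*-identityʳ _)))
    (≤maxProd₂ (ℕ.m+n≤o⇒m≤o∸n (weight v b) (subst (λ x → x + weight b c ≤ r) (weight-sym b v)
      (two-weights (v≁b ∘ ≡-sym) b≁c v≁c (¬fb ∘ forced-sym ∘ proj₁)))))
  ... | no ¬fb | no ¬fc = *≤maxProd₂ {weight v b} {weight v c}
    (ℕ.m+n≤o⇒m≤o∸n (weight v b + weight v c) (three-weights v≁b v≁c b≁c ¬fb ¬fc))

  private
    towards : Fin n → Fin n → List (Fin r)
    towards v k = filter (λ i → label v i ≟ᴸ inj₁ (part k)) (allFin r)

  -- The witness counts the colours whose label at v is the part of k. Each colour has one label at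
  -- v, so these sets are disjoint for different parts and together have at most r elements.
  weight-star : ∀ v K → AllPairs (λ x y → part x ≢ part y) K → All (λ k → part v ≢ part k) K →
    ∃ λ (g : Fin n → ℕ) → (∀ {k} → k ∈ K → weight v k ≤ 1 ⊔ g k) × sum (map g K) ≤ r
  weight-star v K clique _ = length ∘ towards v , (λ {k} _ → bound k) , subst (_≤ r) (length-concatMap K)
    (length≤r (concatMap-unique (towards v) (λ k → Unique.filter⁺ _ (Unique.allFin⁺ r))
      (AllPairs.map (λ {x} {y} x≁y _ p q → x≁y (Sum.inj₁-injective (≡-trans (≡-sym (at x p)) (at y q)))) clique)))
    where
    at : ∀ k {i} → i ∈ towards v k → label v i ≡ inj₁ (part k)
    at k i∈ = proj₂ (∈-filter⁻ (λ i → label v i ≟ᴸ inj₁ (part k)) {xs = allFin r} i∈)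
    length-concatMap : ∀ K → length (concatMap (towards v) K) ≡ sum (map (length ∘ towards v) K)
    length-concatMap []      = refl
    length-concatMap (k ∷ K) = ≡-trans (List.length-++ (towards v k)) (cong (length (towards v k) +_) (length-concatMap K))
    bound : ∀ k → weight v k ≤ 1 ⊔ length (towards v k)
    bound k with part v ≟ part k | forced? v k
    ... | yes _ | _     = ℕ.m≤m⊔n 1 (length (towards v k))
    ... | no _  | yes f = ℕ.≤-trans (ℕ.≤-reflexive (forced-colours f)) (ℕ.m≤m⊔n 1 (length (towards v k)))
    ... | no _  | no ¬f = ℕ.≤-trans (subst (λ xs → length xs ≤ length (towards v k)) (≡-sym (free-colours ¬f))
      (⊆⇒length≤ (Unique.filter⁺ (crossing? v k) (Unique.allFin⁺ r)) λ i∈ →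
        let i∈all , p , _ = ∈-filter⁻ (crossing? v k) {xs = allFin r} i∈ in ∈-filter⁺ _ i∈all p))
      (ℕ.m≤n⊔m 1 _)

  module _ (1<r : 1 < r) (nonempty : ∀ u v → part u ≢ part v → 1 ≤ length (colours u v))
    {a b c : Fin n} (a≁b : part a ≢ part b) (a≁c : part a ≢ part c) (b≁c : part b ≢ part c) where

    weight-pos : ∀ u v → 1 ≤ weight u v
    weight-pos u v with part u ≟ part v
    ... | yes _ = ℕ.≤-refl
    ... | no ne = nonempty u v ne

    third-part : ∀ p q → ∃ λ z → p ≢ part z × q ≢ part z
    third-part p q = [ (a ,_) , [ (b ,_) , (c ,_) ]′ ]′ (avoid-two a≁b a≁c b≁c p q)

    -- The third part makes the bound strict: an unforced edge u v leaves at least one colour for an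
    -- edge from u to a third part.
    weight-top : ∀ u v → weight u v < r
    weight-top u v with part u ≟ part v | forced? u v
    ... | yes _   | _     = 1<r
    ... | no u≁v  | yes f = subst (_< r) (≡-sym (forced-colours f)) 1<r
    ... | no u≁v  | no ¬f with z , u≁z , v≁z ← third-part (part u) (part v) =
      subst (_< r) (weight-apart u≁v) (ℕ.≤-trans
        (subst (_≤ weight u v + weight u z) (ℕ.+-comm (weight u v) 1) (ℕ.+-monoʳ-≤ (weight u v) (weight-pos u z)))
        (two-weights u≁v u≁z v≁z (¬f ∘ proj₁)))

    weights-bounded : ∀ {d} → Gains r d →
      ∏ (allFin n) (λ u → ∏ (allFin n) (weight u)) ^ (2 * suc d) ≤ r ^ (d * (n * n) + 12 * suc d * n)
    weights-bounded {d} gains = subst (λ k → ∏ (allFin n) (λ u → ∏ (allFin n) (weight u)) ^ (2 * suc d) ≤ r ^ (d * (k * k) + 12 * suc d * k)) (List.length-tabulate {n = n} id)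
      (Weights.bounded _≟_ part weight r d 1<r gains weight-sym weight-same weight-pos weight-top weight-star weight-tri
        _ (allFin n) ℕ.≤-refl)

-- Colourings as symmetric matrices

-- In this form colourings of different graphs on n vertices have one common type, so they can be
-- restricted, compared and glued when edges are removed or vertices are cloned.
Matrix : ℕ → ℕ → Set
Matrix r n = Vec (Vec (Maybe (Fin r)) n) n

at : Matrix r n → Fin n → Fin n → Maybe (Fin r)
at M i j = lookup (lookup M i) j

matrix : (Fin n → Fin n → Maybe (Fin r)) → Matrix r n
matrix f = Vec.tabulate λ i → Vec.tabulate (f i)

at-matrix : (f : Fin n → Fin n → Maybe (Fin r)) → ∀ i j → at (matrix f) i j ≡ f i j
at-matrix f i j = ≡-trans (cong (λ row → lookup row j) (Vec.lookup∘tabulate _ i)) (Vec.lookup∘tabulate _ j)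

matrix-ext : {M N : Matrix r n} → (∀ i j → at M i j ≡ at N i j) → M ≡ N
matrix-ext h = lookup-ext λ i → lookup-ext (h i)

_≟ᶜ_ : DecidableEquality (Maybe (Fin r))
_≟ᶜ_ = Maybe.≡-dec _≟_

_≟ᴹ_ : DecidableEquality (Matrix r n)
_≟ᴹ_ = Vec.≡-dec (Vec.≡-dec _≟ᶜ_)

palette : ∀ r → List (Maybe (Fin r))
palette r = nothing ∷ map just (allFin r)

∈-palette : (c : Maybe (Fin r)) → c ∈ palette r
∈-palette nothing  = here refl
∈-palette (just c) = there (∈-map⁺ just (∈-allFin c))

palette-unique : ∀ r → Unique (palette r)
palette-unique r = All.map⁺ (All.universal (λ _ ()) (allFin r)) ∷ Unique.map⁺ Maybe.just-injective (Unique.allFin⁺ r)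

matrices : ∀ r n → List (Matrix r n)
matrices r n = vecsOf λ _ → vecsOf λ _ → palette r

∈-matrices : (M : Matrix r n) → M ∈ matrices r n
∈-matrices M = ∈-vecsOf⁺ _ M λ i → ∈-vecsOf⁺ _ (lookup M i) λ _ → ∈-palette _

matrices-unique : ∀ r n → Unique (matrices r n)
matrices-unique r n = vecsOf-unique _ λ _ → vecsOf-unique _ λ _ → palette-unique r

-- A coloured triangle is monochromatic or rainbow iff two equal colours at a vertex force the third one.
record Valid {r n : ℕ} (G : Graph n) (M : Matrix r n) : Set where
  constructor valid
  field
    symmetric  : ∀ i j → at M i j ≡ at M j i
    uncoloured : ∀ i j → adj G i j ≡ false → at M i j ≡ nothing
    coloured   : ∀ i j → adj G i j ≡ true → at M i j ≢ nothing
    closed     : ∀ i j k c → at M i j ≡ just c → at M j k ≡ just c → adj G i k ≡ true → at M i k ≡ just c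
open Valid

abstract
  valid? : (G : Graph n) (M : Matrix r n) → Dec (Valid G M)
  valid? G M = map′ (λ (a , b , c , d) → valid a b c d) (λ v → symmetric v , uncoloured v , coloured v , closed v)
    ((Fin.all? λ i → Fin.all? λ j → at M i j ≟ᶜ at M j i) ×-dec
     (Fin.all? λ i → Fin.all? λ j → (adj G i j Bool.≟ false) →-dec (at M i j ≟ᶜ nothing)) ×-dec
     (Fin.all? λ i → Fin.all? λ j → (adj G i j Bool.≟ true) →-dec ¬? (at M i j ≟ᶜ nothing)) ×-dec
     (Fin.all? λ i → Fin.all? λ j → Fin.all? λ k → Fin.all? λ c → (at M i j ≟ᶜ just c) →-dec
       ((at M j k ≟ᶜ just c) →-dec ((adj G i k Bool.≟ true) →-dec (at M i k ≟ᶜ just c)))))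

colourings : ∀ r → Graph n → List (Matrix r n)
colourings r G = filter (valid? G) (matrices r _)

count : ∀ r → Graph n → ℕ
count r G = length (colourings r G)

∈-colourings⁺ : {G : Graph n} {M : Matrix r n} → Valid G M → M ∈ colourings r G
∈-colourings⁺ {G = G} v = ∈-filter⁺ (valid? G) (∈-matrices _) v

∈-colourings⁻ : {G : Graph n} {M : Matrix r n} → M ∈ colourings r G → Valid G M
∈-colourings⁻ {n} {r} {G = G} M∈ = proj₂ (∈-filter⁻ (valid? G) {xs = matrices r n} M∈)

colourings-unique : ∀ r (G : Graph n) → Unique (colourings r G)
colourings-unique r G = Unique.filter⁺ (valid? G) (matrices-unique r _)

coloured⇒adj : {G : Graph n} {M : Matrix r n} → Valid G M → ∀ {i j c} → at M i j ≡ just c → adj G i j ≡ true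
coloured⇒adj {G = G} v {i} {j} eq with adj G i j in e
... | true  = refl
... | false = case ≡-trans (≡-sym eq) (uncoloured v i j e) of λ ()

adj⇒coloured : {G : Graph n} {M : Matrix r n} → Valid G M → ∀ {i j} → adj G i j ≡ true → ∃ λ c → at M i j ≡ just c
adj⇒coloured {M = M} v {i} {j} e with at M i j in eq
... | just c  = c , refl
... | nothing = contradiction eq (coloured v i j e)

diagonal : {G : Graph n} {M : Matrix r n} → Valid G M → ∀ i → at M i i ≡ nothing
diagonal {G = G} v i = uncoloured v i i (irrefl G i)

upper-ext : {G : Graph n} {M N : Matrix r n} → Valid G M → Valid G N →
  (∀ {u v} → toℕ u < toℕ v → at M u v ≡ at N u v) → M ≡ N
upper-ext V W h = matrix-ext λ u v → case ℕ.<-cmp (toℕ u) (toℕ v) of λ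
  { (tri< u<v _ _) → h u<v
  ; (tri≈ _ eq _) → case Fin.toℕ-injective eq of λ { refl → ≡-trans (diagonal V u) (≡-sym (diagonal W u)) }
  ; (tri> _ _ v<u) → ≡-trans (symmetric V u v) (≡-trans (h v<u) (symmetric W v u)) }

largest-fibre : (f : A → List B) (x : A) (xs : List A) → ∃ λ y → ∀ {z} → z ∈ x ∷ xs → length (f z) ≤ length (f y)
largest-fibre f x [] = x , λ { (here refl) → ℕ.≤-refl }
largest-fibre f x (x′ ∷ xs) with y , max ← largest-fibre f x′ xs with ℕ.≤-total (length (f x)) (length (f y))
... | inj₁ x≤y = y , λ { (here refl) → x≤y ; (there z∈) → max z∈ }
... | inj₂ y≤x = x , λ { (here refl) → ℕ.≤-refl ; (there z∈) → ℕ.≤-trans (max z∈) y≤x }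

-- Chooses class representatives: vertices of one class yield the same filtered list and hence the
-- same head. The default is never taken on a list that contains the vertex itself.
headOr : A → List A → A
headOr x []      = x
headOr _ (x ∷ _) = x

headOr-∈ : {x y : A} {xs : List A} → y ∈ xs → headOr x xs ∈ xs
headOr-∈ {xs = _ ∷ _} _ = here refl

headOr-irrelevant : {x x′ y : A} {xs ys : List A} → xs ≡ ys → y ∈ xs → headOr x xs ≡ headOr x′ ys
headOr-irrelevant {xs = _ ∷ _} refl _ = refl

-- Colourings of complete multipartite graphs

module Multipartite {n r : ℕ} (G : Graph n) (part : Fin n → Fin n)
  (adj⇒apart : ∀ {u v} → adj G u v ≡ true → part u ≢ part v)
  (apart⇒adj : ∀ {u v} → part u ≢ part v → adj G u v ≡ true) where

  -- A vertex with neighbours of colour i in two parts lies in a component of colour i that is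
  -- complete multipartite; its label is the least vertex of that component.  Otherwise
  -- the label is the part containing all neighbours of colour i.
  module Labels (M : Matrix r n) where

    Star : Fin n → Fin r → Set
    Star v i = ∃₂ λ x y → at M v x ≡ just i × at M v y ≡ just i × part x ≢ part y

    star? : ∀ v i → Dec (Star v i)
    star? v i = Fin.any? λ x → Fin.any? λ y → (at M v x ≟ᶜ just i) ×-dec (at M v y ≟ᶜ just i) ×-dec ¬? (part x ≟ part y)

    -- In a complete multipartite component with at least three parts any two vertices have a common
    -- neighbour. So paths of length two already describe the component, without a transitive
    -- closure.
    Linked : Fin r → Fin n → Fin n → Set
    Linked i v z = ∃ λ p → at M v p ≡ just i × at M z p ≡ just i

    linked? : ∀ i v z → Dec (Linked i v z)
    linked? i v z = Fin.any? λ p → (at M v p ≟ᶜ just i) ×-dec (at M z p ≟ᶜ just i)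

    leader : Fin n → Fin r → Fin n
    leader v i = headOr v (filter (linked? i v) (allFin n))

    label : Fin n → Fin r → Fin n ⊎ Fin n
    label v i with star? v i | Fin.any? (λ x → at M v x ≟ᶜ just i)
    ... | yes _ | _           = inj₂ (leader v i)
    ... | no _  | yes (x , _) = inj₁ (part x)
    -- Colour i is absent at v. Edges leave the part of v, so this label admits i on none of them.
    ... | no _  | no _        = inj₁ (part v)

    label-star : ∀ {v i} → Star v i → label v i ≡ inj₂ (leader v i)
    label-star {v} {i} s with star? v i | Fin.any? (λ x → at M v x ≟ᶜ just i)
    ... | yes _ | _ = refl
    ... | no ¬s | _ = contradiction s ¬s

    label-star⁻ : ∀ {v i z} → label v i ≡ inj₂ z → Star v i × leader v i ≡ z
    label-star⁻ {v} {i} eq with star? v i | Fin.any? (λ x → at M v x ≟ᶜ just i)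
    ... | yes s | _     = s , Sum.inj₂-injective eq
    label-star⁻ () | no _ | yes _
    label-star⁻ () | no _ | no _

    label-plain : ∀ {v i x} → ¬ Star v i → at M v x ≡ just i → label v i ≡ inj₁ (part x)
    label-plain {v} {i} {x} ¬s eq with star? v i | Fin.any? (λ x → at M v x ≟ᶜ just i)
    ... | yes s | _            = contradiction s ¬s
    ... | no _  | no ¬any      = contradiction (x , eq) ¬any
    ... | no _  | yes (y , eq′) with part y ≟ part x
    ...   | yes same = cong inj₁ same
    ...   | no apart = contradiction (y , x , eq′ , eq , apart) ¬s

    module _ (V : Valid G M) where

      private
        E : Fin r → Fin n → Fin n → Set
        E i u v = at M u v ≡ just i

        E-sym : ∀ {i u v} → E i u v → E i v u
        E-sym {u = u} {v} e = ≡-trans (symmetric V v u) e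

        E-apart : ∀ {i u v} → E i u v → part u ≢ part v
        E-apart e = adj⇒apart (coloured⇒adj V e)

        E-trans : ∀ {i u v w} → E i u v → E i v w → part u ≢ part w → E i u w
        E-trans e e′ u≁w = closed V _ _ _ _ e e′ (apart⇒adj u≁w)

      module Component {i : Fin r} {u x y : Fin n} (ux : E i u x) (uy : E i u y) (x≁y : part x ≢ part y) where

        xy : E i x y
        xy = E-trans (E-sym ux) uy x≁y

        -- Membership in the component of the monochromatic triangle u x y, expressed by edges to
        -- the triangle alone. In this form it passes along edges, and two members find a common
        -- neighbour among u, x, y.
        Attached : Fin n → Set
        Attached z = (part z ≢ part u → E i z u) × (part z ≢ part x → E i z x) × (part z ≢ part y → E i z y)

        attached-u : Attached u
        attached-u = (λ ne → contradiction refl ne) , (λ _ → ux) , (λ _ → uy)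

        private
          -- If z is outside the part of p, then z′ reaches p through z. Otherwise z is joined to q
          -- and s, and z′ reaches p through whichever of them is not in its own part.
          step : ∀ {z z′ p q s} → E i p q → E i p s → part q ≢ part s →
            (part z ≢ part p → E i z p) → (part z ≢ part q → E i z q) → (part z ≢ part s → E i z s) →
            E i z z′ → part z′ ≢ part p → E i z′ p
          step {z} {z′} {p} {q} {s} pq ps q≁s zp zq zs zz′ z′≁p with part z ≟ part p
          ... | no z≁p = E-trans (E-sym zz′) (zp z≁p) z′≁p
          ... | yes z~p with part z′ ≟ part q
          ...   | no z′≁q = E-trans (E-trans (E-sym zz′) (zq λ z~q → E-apart pq (≡-trans (≡-sym z~p) z~q)) z′≁q) (E-sym pq) z′≁p
          ...   | yes z′~q = E-trans (E-trans (E-sym zz′) (zs λ z~s → E-apart ps (≡-trans (≡-sym z~p) z~s))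
                  (λ z′~s → q≁s (≡-trans (≡-sym z′~q) z′~s))) (E-sym ps) z′≁p

        attached-step : ∀ {z z′} → Attached z → E i z z′ → Attached z′
        attached-step (zu , zx , zy) zz′ =
          step ux uy x≁y zu zx zy zz′ ,
          step (E-sym ux) xy (E-apart uy) zx zu zy zz′ ,
          step (E-sym uy) (E-sym xy) (E-apart ux) zy zu zx zz′

        attached-linked : ∀ {z z′} → Attached z → Linked i z z′ → Attached z′
        attached-linked a (_ , zp , z′p) = attached-step (attached-step a zp) (E-sym z′p)

        linked : ∀ {z z′} → Attached z → Attached z′ → Linked i z z′
        linked {z} {z′} (zu , zx , zy) (z′u , z′x , z′y)
          with avoid-two (E-apart ux) (E-apart uy) x≁y (part z) (part z′)
        ... | inj₁ (p , q)        = u , zu p , z′u q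
        ... | inj₂ (inj₁ (p , q)) = x , zx p , z′x q
        ... | inj₂ (inj₂ (p , q)) = y , zy p , z′y q

        complete : ∀ {z z′} → Attached z → Attached z′ → part z ≢ part z′ → E i z z′
        complete a a′ z≁z′ with _ , zp , z′p ← linked a a′ = E-trans zp (E-sym z′p) z≁z′

      star-linked : ∀ {v i} → Star v i → Linked i v (leader v i)
      star-linked {v} {i} (x , _ , vx , _) =
        proj₂ (∈-filter⁻ (linked? i v) {xs = allFin n} (headOr-∈ (∈-filter⁺ (linked? i v) (∈-allFin v) (x , vx , vx))))

      -- Both ends of the edge lie in the component of the triangle u x y, so they are linked to the
      -- same vertices and have the same first one. The vertex v sees u and one of x, y, which are
      -- in different parts.
      star-step : ∀ {u v i} → Star u i → E i u v → Star v i × leader u i ≡ leader v i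
      star-step {u} {v} {i} (x , y , ux , uy , x≁y) uv = star , headOr-irrelevant
        (List.filter-≐ (linked? i u) (linked? i v)
          ((λ l → linked attached-v (attached-linked attached-u l)) , (λ l → linked attached-u (attached-linked attached-v l)))
          (allFin n))
        (∈-filter⁺ (linked? i u) (∈-allFin u) (x , ux , ux))
        where
        open Component ux uy x≁y
        attached-v : Attached v
        attached-v = attached-step attached-u uv
        star : Star v i
        star with part v ≟ part x
        ... | no v≁x  = u , x , E-sym uv , E-trans (E-sym uv) ux v≁x , E-apart ux
        ... | yes v~x = u , y , E-sym uv , E-trans (E-sym uv) uy (λ v~y → x≁y (≡-trans (≡-sym v~x) v~y)) , E-apart uy

      -- This is why equal starred labels force a colour: the common leader links v to u, and the
      -- component of u is complete multipartite.
      same-leader : ∀ {u v i} → Star u i → Star v i → leader u i ≡ leader v i → part u ≢ part v → E i u v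
      same-leader {u} {v} {i} su@(x , y , ux , uy , x≁y) sv eq u≁v = complete attached-u
        (attached-linked (attached-linked attached-u (star-linked su))
          (let p , vp , zp = star-linked sv in p , subst (λ z → at M z p ≡ just i) (≡-sym eq) zp , vp)) u≁v
        where open Component ux uy x≁y

      module _ (lab : Fin n → Fin r → Fin n ⊎ Fin n) (lab≡ : ∀ v i → lab v i ≡ label v i) where
        open Lists part lab

        -- If some colour j is shared, u v has colour j, hence i = j whichever j was found. If none
        -- is shared, i is not starred at u or v, since a star would spread along the edge with its
        -- leader and make i shared.
        admissible : ∀ {u v i} → at M u v ≡ just i → i ∈ colours u v
        admissible {u} {v} {i} uv with forced? u v
        ... | yes (j , (z , eq) , eq′)
          with su , lu ← label-star⁻ (≡-trans (≡-sym (lab≡ u j)) eq)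
          with sv , lv ← label-star⁻ (≡-trans (≡-sym (lab≡ v j)) (≡-trans (≡-sym eq′) eq)) =
          here (Maybe.just-injective (≡-trans (≡-sym uv) (same-leader su sv (≡-trans lu (≡-sym lv)) (E-apart uv))))
        ... | no ¬forced = ∈-filter⁺ (crossing? u v) (∈-allFin i)
            ( ≡-trans (lab≡ u i) (label-plain ¬star uv)
            , ≡-trans (lab≡ v i) (label-plain (λ s → ¬star (proj₁ (star-step s (E-sym uv)))) (E-sym uv)))
          where
          ¬star : ¬ Star u i
          ¬star su with sv , eq ← star-step su uv = ¬forced
            (i , (leader u i , ≡-trans (lab≡ u i) (label-star su)) ,
             ≡-trans (lab≡ u i) (≡-trans (label-star su) (≡-trans (cong inj₂ eq) (≡-sym (≡-trans (lab≡ v i) (label-star sv))))))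

  Code : Set
  Code = Vec (Vec (Fin n ⊎ Fin n) r) n

  codes : List Code
  codes = vecsOf λ _ → vecsOf λ _ → map inj₁ (allFin n) ++ map inj₂ (allFin n)

  ∈-codes : ∀ κ → κ ∈ codes
  ∈-codes κ = ∈-vecsOf⁺ _ κ λ v → ∈-vecsOf⁺ _ (lookup κ v) λ i → label∈ (lookup (lookup κ v) i)
    where
    label∈ : ∀ l → l ∈ map inj₁ (allFin n) ++ map inj₂ (allFin n)
    label∈ (inj₁ p) = ∈-++⁺ˡ (∈-map⁺ inj₁ (∈-allFin p))
    label∈ (inj₂ z) = ∈-++⁺ʳ (map inj₁ (allFin n)) (∈-map⁺ inj₂ (∈-allFin z))

  length-codes : length codes ≡ ((n + n) ^ r) ^ n
  length-codes = ≡-trans (length-vecsOf {n = n} _) (≡-trans (product-replicate _ (allFin n))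
    (cong₂ _^_ (≡-trans (length-vecsOf {n = r} _) (≡-trans (product-replicate _ (allFin r))
      (cong₂ _^_ labels (List.length-tabulate {n = r} id)))) (List.length-tabulate {n = n} id)))
    where
    labels : length (map inj₁ (allFin n) ++ map inj₂ (allFin n)) ≡ n + n
    labels = ≡-trans (List.length-++ (map inj₁ (allFin n))) (cong₂ _+_
      (≡-trans (List.length-map inj₁ (allFin n)) (List.length-tabulate {n = n} id))
      (≡-trans (List.length-map inj₂ (allFin n)) (List.length-tabulate {n = n} id)))

  encode : Matrix r n → Code
  encode M = Vec.tabulate λ v → Vec.tabulate (Labels.label M v)

  decode : Code → Fin n → Fin r → Fin n ⊎ Fin n
  decode κ v i = lookup (lookup κ v) i

  decode-encode : ∀ M v i → decode (encode M) v i ≡ Labels.label M v i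
  decode-encode M v i = ≡-trans (cong (λ row → lookup row i) (Vec.lookup∘tabulate _ v)) (Vec.lookup∘tabulate _ i)

  _≟ᴷ_ : DecidableEquality Code
  _≟ᴷ_ = Vec.≡-dec (Vec.≡-dec (Sum.≡-dec _≟_ _≟_))

  fibre : Code → List (Matrix r n)
  fibre κ = filter (λ M → encode M ≟ᴷ κ) (colourings r G)

  module _ (κ : Code) where
    open Lists part (decode κ)

    entries : Fin n → Fin n → List (Maybe (Fin r))
    entries u v with part u ≟ part v
    ... | yes _ = [ nothing ]
    ... | no _  = map just (colours u v)

    length-entries : ∀ u v → length (entries u v) ≡ weight u v
    length-entries u v with part u ≟ part v
    ... | yes _ = refl
    ... | no _  = List.length-map just (colours u v)

    ∈-fibre : ∀ {M} → M ∈ fibre κ → Valid G M × encode M ≡ κ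
    ∈-fibre M∈ = let M∈′ , eq = ∈-filter⁻ (λ M → encode M ≟ᴷ κ) {xs = colourings r G} M∈ in ∈-colourings⁻ M∈′ , eq

    fibre-admissible : ∀ {M} → M ∈ fibre κ → ∀ {u v i} → at M u v ≡ just i → i ∈ colours u v
    fibre-admissible {M} M∈ with V , refl ← ∈-fibre M∈ = Labels.admissible M V (decode (encode M)) (decode-encode M)

    ∈-entries : ∀ {M} → M ∈ fibre κ → ∀ u v → at M u v ∈ entries u v
    ∈-entries {M} M∈ u v with V , _ ← ∈-fibre M∈ | part u ≟ part v
    ... | no apart with i , eq ← adj⇒coloured V (apart⇒adj apart) =
      subst (_∈ map just (colours u v)) (≡-sym eq) (∈-map⁺ just (fibre-admissible M∈ eq))
    ... | yes same with at M u v in eq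
    ...   | nothing = here refl
    ...   | just _  = contradiction same (adj⇒apart (coloured⇒adj V eq))

    mix : Matrix r n × Matrix r n → Matrix r n
    mix (M , N) = matrix λ u v → if toℕ u <ᵇ toℕ v then at M u v else at N u v

    -- Two symmetric matrices fit into the two triangles of one, which gives the square.
    fibre-bound : length (fibre κ) * length (fibre κ) ≤ ∏ (allFin n) λ u → ∏ (allFin n) (weight u)
    fibre-bound = begin
      length (fibre κ) * length (fibre κ)           ≡⟨ length-cartesianProductWith _,_ (fibre κ) (fibre κ) ⟨
      length (cartesianProduct (fibre κ) (fibre κ)) ≤⟨ injection⇒length≤ mix
                                                        (Unique.cartesianProduct⁺ fibre-unique fibre-unique) mix-injective mix∈ ⟩
      length (vecsOf (λ u → vecsOf (entries u)))    ≡⟨ length-vecsOf (λ u → vecsOf (entries u)) ⟩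
      ∏ (allFin n) (λ u → length (vecsOf (entries u)))
        ≡⟨ ∏-cong (allFin n) (λ {u} _ → ≡-trans (length-vecsOf (entries u)) (∏-cong (allFin n) λ {v} _ → length-entries u v)) ⟩
      ∏ (allFin n) (λ u → ∏ (allFin n) (weight u))  ∎
      where
      open ℕ.≤-Reasoning
      fibre-unique : Unique (fibre κ)
      fibre-unique = Unique.filter⁺ _ (colourings-unique r G)
      mix∈ : ∀ {p} → p ∈ cartesianProduct (fibre κ) (fibre κ) → mix p ∈ vecsOf (λ u → vecsOf (entries u))
      mix∈ {M , N} p∈ with M∈ , N∈ ← ∈-cartesianProduct⁻ (fibre κ) (fibre κ) p∈ =
        ∈-vecsOf⁺ _ (mix (M , N)) λ u → ∈-vecsOf⁺ (entries u) _ λ v →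
          subst (_∈ entries u v) (≡-sym (at-matrix _ u v)) (choose (toℕ u <ᵇ toℕ v) u v)
        where
        choose : ∀ b u v → (if b then at M u v else at N u v) ∈ entries u v
        choose true  u v = ∈-entries M∈ u v
        choose false u v = ∈-entries N∈ u v
      upper : ∀ {M N : Matrix r n} {u v} → toℕ u < toℕ v → at (mix (M , N)) u v ≡ at M u v
      upper {M} {N} {u} {v} u<v = ≡-trans (at-matrix _ u v)
        (cong (λ b → if b then at M u v else at N u v) (Bool.T-≡ .Equivalence.to (ℕ.<⇒<ᵇ u<v)))
      lower : ∀ {M N : Matrix r n} {u v} → toℕ v < toℕ u → at (mix (M , N)) u v ≡ at N u v
      lower {M} {N} {u} {v} v<u with toℕ u <ᵇ toℕ v in eq | at-matrix (λ u v → if toℕ u <ᵇ toℕ v then at M u v else at N u v) u v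
      ... | false | at≡ = at≡
      ... | true  | _ = contradiction (ℕ.<ᵇ⇒< _ _ (Bool.T-≡ .Equivalence.from eq)) (ℕ.<-asym v<u)
      mix-injective : InjectiveOn mix (cartesianProduct (fibre κ) (fibre κ))
      mix-injective {M , N} {M′ , N′} p∈ q∈ eq
        with M∈ , N∈ ← ∈-cartesianProduct⁻ (fibre κ) (fibre κ) p∈
        with M′∈ , N′∈ ← ∈-cartesianProduct⁻ (fibre κ) (fibre κ) q∈
        with V , _ ← ∈-fibre M∈ | W , _ ← ∈-fibre N∈ | V′ , _ ← ∈-fibre M′∈ | W′ , _ ← ∈-fibre N′∈ =
        cong₂ _,_
          (upper-ext V V′ λ {u} {v} u<v → ≡-trans (≡-sym (upper {M} {N} u<v)) (≡-trans (cong (λ X → at X u v) eq) (upper {M′} {N′} u<v)))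
          (upper-ext W W′ λ {u} {v} u<v → ≡-trans (symmetric W u v) (≡-trans (≡-sym (lower {M} {N} u<v))
            (≡-trans (cong (λ X → at X v u) eq) (≡-trans (lower {M′} {N′} u<v) (symmetric W′ v u)))))

  module _ {d : ℕ} (1<r : 1 < r) (gains : Gains r d) {a b c : Fin n}
    (a≁b : part a ≢ part b) (a≁c : part a ≢ part c) (b≁c : part b ≢ part c) where

    private
      e : ℕ
      e = 2 * (2 * suc d)

    -- A colouring in the fibre shows that no list between different parts is empty, which makes the
    -- weights positive. The exponent has one factor 2 for the square in `fibre-bound` and 2 D for
    -- the bound on weights.
    fibre-power : ∀ κ → length (fibre κ) ^ e ≤ r ^ (d * (n * n) + 12 * suc d * n)
    fibre-power κ = go (fibre κ) refl
      where
      open ℕ.≤-Reasoning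
      open Lists part (decode κ)
      go : ∀ Ms → fibre κ ≡ Ms → length Ms ^ e ≤ r ^ (d * (n * n) + 12 * suc d * n)
      go []         _  = z≤n
      go Ms@(M ∷ _) eq = begin
        length Ms ^ e                      ≡⟨ ℕ.^-*-assoc (length Ms) 2 (2 * suc d) ⟨
        (length Ms ^ 2) ^ (2 * suc d)      ≤⟨ ℕ.^-monoˡ-≤ (2 * suc d) square ⟩
        ∏ (allFin n) (λ u → ∏ (allFin n) (weight u)) ^ (2 * suc d)
                                           ≤⟨ weights-bounded 1<r nonempty a≁b a≁c b≁c gains ⟩
        r ^ (d * (n * n) + 12 * suc d * n) ∎
        where
        M∈ : M ∈ fibre κ
        M∈ = subst (M ∈_) (≡-sym eq) (here refl)
        square : length Ms ^ 2 ≤ ∏ (allFin n) λ u → ∏ (allFin n) (weight u)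
        square = subst (_≤ ∏ (allFin n) λ u → ∏ (allFin n) (weight u))
          (≡-trans (cong (λ xs → length xs * length xs) eq) (cong (length Ms *_) (≡-sym (ℕ.*-identityʳ (length Ms)))))
          (fibre-bound κ)
        nonempty : ∀ u v → part u ≢ part v → 1 ≤ length (colours u v)
        nonempty u v u≁v with i , uv ← adj⇒coloured (proj₁ (∈-fibre κ M∈)) (apart⇒adj u≁v)
          with colours u v | fibre-admissible κ M∈ uv
        ... | _ ∷ _ | _ = s≤s z≤n

    -- The fibres cover all colourings, so the count is at most the number of codes times the size
    -- of a largest fibre.
    count-bound : count r G ^ e ≤ (((n + n) ^ r) ^ n) ^ e * r ^ (d * (n * n) + 12 * suc d * n)
    count-bound = go codes refl
      where
      open ℕ.≤-Reasoning
      κ₁ : Code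
      κ₁ = encode (matrix λ _ _ → nothing)
      go : ∀ ks → codes ≡ ks → count r G ^ e ≤ (((n + n) ^ r) ^ n) ^ e * r ^ (d * (n * n) + 12 * suc d * n)
      go [] eq = case subst (κ₁ ∈_) eq (∈-codes κ₁) of λ ()
      go ks@(κ₀ ∷ κs) eq with κ , heavy ← largest-fibre fibre κ₀ κs = begin
        count r G ^ e                         ≤⟨ ℕ.^-monoˡ-≤ e (ℕ.≤-trans cover (length-concatMap-≤ fibre ks heavy)) ⟩
        (length ks * length (fibre κ)) ^ e    ≡⟨ cong (λ l → (l * length (fibre κ)) ^ e) (≡-trans (cong length (≡-sym eq)) length-codes) ⟩
        (((n + n) ^ r) ^ n * length (fibre κ)) ^ e      ≡⟨ ^-distribʳ-* e (((n + n) ^ r) ^ n) (length (fibre κ)) ⟩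
        (((n + n) ^ r) ^ n) ^ e * length (fibre κ) ^ e  ≤⟨ ℕ.*-monoʳ-≤ ((((n + n) ^ r) ^ n) ^ e) (fibre-power κ) ⟩
        (((n + n) ^ r) ^ n) ^ e * r ^ (d * (n * n) + 12 * suc d * n) ∎
        where
        cover : count r G ≤ length (concatMap fibre ks)
        cover = ⊆⇒length≤ (colourings-unique r G) λ {M} M∈ → ∈-concatMap⁺ fibre
          (Any.map (λ eq′ → ∈-filter⁺ (λ M → encode M ≟ᴷ _) M∈ eq′) (subst (encode M ∈_) eq (∈-codes (encode M))))

-- Symmetrization

module Pairing {K : Set} (_≟_ : DecidableEquality K) (keys : List K) (keys-unique : Unique keys)
  (∈-keys : ∀ k → k ∈ keys) (key : A → K) where

  class : K → List A → List A
  class k = filter (λ x → key x ≟ k)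

  matched : List A → List A → List (A × A)
  matched xs ys = concatMap (λ k → cartesianProduct (class k xs) (class k ys)) keys

  private
    cell : ∀ {k xs ys p} → p ∈ cartesianProduct (class k xs) (class k ys) →
      (proj₁ p ∈ xs × proj₂ p ∈ ys) × (key (proj₁ p) ≡ k × key (proj₂ p) ≡ k)
    cell {k} {xs} {ys} p∈ =
      let x∈′ , y∈′ = ∈-cartesianProduct⁻ (class k xs) (class k ys) p∈
          x∈ , kx = ∈-filter⁻ (λ x → key x ≟ k) {xs = xs} x∈′
          y∈ , ky = ∈-filter⁻ (λ x → key x ≟ k) {xs = ys} y∈′
      in (x∈ , y∈) , (kx , ky)

  ∈-matched⁺ : ∀ {xs ys x y} → x ∈ xs → y ∈ ys → key x ≡ key y → (x , y) ∈ matched xs ys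
  ∈-matched⁺ {xs} {ys} {x} {y} x∈ y∈ eq = ∈-concatMap⁺ _ (Any.map
    (λ { refl → ∈-cartesianProduct⁺ (∈-filter⁺ (λ z → key z ≟ key x) x∈ refl) (∈-filter⁺ (λ z → key z ≟ key x) y∈ (≡-sym eq)) })
    (∈-keys (key x)))

  ∈-matched⁻ : ∀ {xs ys p} → p ∈ matched xs ys → (proj₁ p ∈ xs × proj₂ p ∈ ys) × key (proj₁ p) ≡ key (proj₂ p)
  ∈-matched⁻ {xs} {ys} p∈
    with k , _ , p∈′ ← find (∈-concatMap⁻ (λ k → cartesianProduct (class k xs) (class k ys)) {xs = keys} p∈)
    with in-lists , kx , ky ← cell {k} {xs} {ys} p∈′ = in-lists , ≡-trans kx (≡-sym ky)

  matched-unique : ∀ {xs ys} → Unique xs → Unique ys → Unique (matched xs ys)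
  matched-unique {xs} {ys} ux uy = concatMap-unique _
    (λ k → Unique.cartesianProduct⁺ (Unique.filter⁺ _ ux) (Unique.filter⁺ _ uy))
    (AllPairs.map (λ {k} {l} k≢l _ p q → k≢l
      (≡-trans (≡-sym (proj₁ (proj₂ (cell {k} {xs} {ys} p)))) (proj₁ (proj₂ (cell {l} {xs} {ys} q))))) keys-unique)

  -- If the key k occurs x times in `xs` and y times in `ys`, the three lengths are the sums over k
  -- of x y, x² and y². The inequality is 2 x y ≤ x² + y² term by term.
  matched-bound : ∀ xs ys → 2 * length (matched xs ys) ≤ length (matched xs xs) + length (matched ys ys)
  matched-bound xs ys = go keys
    where
    open ℕ.≤-Reasoning
    cells : List A → List A → List K → ℕ
    cells xs ys ks = length (concatMap (λ k → cartesianProduct (class k xs) (class k ys)) ks)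
    cells-∷ : ∀ xs ys k ks → cells xs ys (k ∷ ks) ≡ length (class k xs) * length (class k ys) + cells xs ys ks
    cells-∷ xs ys k ks = ≡-trans (List.length-++ (cartesianProduct (class k xs) (class k ys)))
      (cong (_+ cells xs ys ks) (length-cartesianProductWith _,_ (class k xs) (class k ys)))
    amgm : ∀ x y → 2 * (x * y) ≤ x * x + y * y
    amgm x y with ℕ.≤-total x y
    ... | inj₁ x≤y with z , refl ← ℕ.m≤n⇒∃[o]m+o≡n x≤y = ℕ.≤-trans (ℕ.m≤m+n _ (z * z)) (ℕ.≤-reflexive (square x z))
      where
      square : ∀ x z → 2 * (x * (x + z)) + z * z ≡ x * x + (x + z) * (x + z)
      square = solve-∀
    ... | inj₂ y≤x with z , refl ← ℕ.m≤n⇒∃[o]m+o≡n y≤x = ℕ.≤-trans (ℕ.m≤m+n _ (z * z)) (ℕ.≤-reflexive (square y z))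
      where
      square : ∀ y z → 2 * ((y + z) * y) + z * z ≡ (y + z) * (y + z) + y * y
      square = solve-∀
    interchange : ∀ a b c d → (a + b) + (c + d) ≡ (a + c) + (b + d)
    interchange = solve-∀
    go : ∀ ks → 2 * cells xs ys ks ≤ cells xs xs ks + cells ys ys ks
    go []       = z≤n
    go (k ∷ ks) = let x = length (class k xs) ; y = length (class k ys) in begin
      2 * cells xs ys (k ∷ ks)                           ≡⟨ cong (2 *_) (cells-∷ xs ys k ks) ⟩
      2 * (x * y + cells xs ys ks)                       ≡⟨ ℕ.*-distribˡ-+ 2 (x * y) _ ⟩
      2 * (x * y) + 2 * cells xs ys ks                   ≤⟨ ℕ.+-mono-≤ (amgm x y) (go ks) ⟩
      (x * x + y * y) + (cells xs xs ks + cells ys ys ks) ≡⟨ interchange (x * x) (y * y) _ _ ⟩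
      (x * x + cells xs xs ks) + (y * y + cells ys ys ks) ≡⟨ cong₂ _+_ (cells-∷ xs xs k ks) (cells-∷ ys ys k ks) ⟨
      cells xs xs (k ∷ ks) + cells ys ys (k ∷ ks)        ∎

-- Isolating and cloning vertices

module _ {X : Set} {P : Fin n → Set} (P? : ∀ i → Dec (P i)) (x : X) (f : Fin n → Fin n → X) where

  hide : Fin n → Fin n → X
  hide i j = if does (P? i ⊎-dec P? j) then x else f i j

  hide-in : ∀ {i j} → P i ⊎ P j → hide i j ≡ x
  hide-in {i} {j} p = go (P? i ⊎-dec P? j)
    where
    go : (d : Dec (P i ⊎ P j)) → (if does d then x else f i j) ≡ x
    go (yes _) = refl
    go (no ¬p) = contradiction p ¬p

  hide-out : ∀ {i j} → ¬ P i → ¬ P j → hide i j ≡ f i j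
  hide-out {i} {j} ¬p ¬q = go (P? i ⊎-dec P? j)
    where
    go : (d : Dec (P i ⊎ P j)) → (if does d then x else f i j) ≡ f i j
    go (yes p) = contradiction p [ ¬p , ¬q ]′
    go (no _)  = refl

-- Stands for the deletion of v; an isolated vertex does not affect the number of colourings, and
-- the vertex set remains `Fin n`.
isolate : Graph n → Fin n → Graph n
isolate {n} G v = record { adj = g ; sym = symm ; irrefl = irr }
  where
  g : Fin n → Fin n → Bool
  g = hide (_≟ v) false (adj G)
  symm : ∀ i j → g i j ≡ g j i
  symm i j with i ≟ v | j ≟ v
  ... | yes _ | yes _ = refl
  ... | yes _ | no _  = refl
  ... | no _  | yes _ = refl
  ... | no _  | no _  = Graph.sym G i j
  irr : ∀ i → g i i ≡ false
  irr i with i ≟ v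
  ... | yes _ = refl
  ... | no _  = irrefl G i

isolate-adj : (G : Graph n) {v i j : Fin n} → adj (isolate G v) i j ≡ true → i ≢ v × j ≢ v × adj G i j ≡ true
isolate-adj G {v} {i} {j} eq with i ≟ v | j ≟ v
... | no i≢v | no j≢v = i≢v , j≢v , eq
isolate-adj G () | yes _ | _
isolate-adj G () | no _  | yes _

-- Along `v ↦ u` this turns v into a twin of u. Irreflexivity of G at u keeps the two non-adjacent.
pull : Graph n → (Fin n → Fin n) → Graph n
pull G σ = record { adj = λ i j → adj G (σ i) (σ j) ; sym = λ i j → Graph.sym G (σ i) (σ j) ; irrefl = λ i → irrefl G (σ i) }

_↦_ : Fin n → Fin n → Fin n → Fin n
(v ↦ u) x = if does (x ≟ v) then u else x

↦-hit : (v u : Fin n) → (v ↦ u) v ≡ u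
↦-hit v u with v ≟ v
... | yes _ = refl
... | no ne = contradiction refl ne

↦-miss : {v u x : Fin n} → x ≢ v → (v ↦ u) x ≡ x
↦-miss {v = v} {x = x} ne with x ≟ v
... | yes eq = contradiction eq ne
... | no _   = refl

↦-avoids : {v u : Fin n} → u ≢ v → ∀ x → (v ↦ u) x ≢ v
↦-avoids {v = v} u≢v x with x ≟ v
... | yes _ = u≢v
... | no ne = ne

blank : {P : Fin n → Set} (P? : ∀ i → Dec (P i)) → Matrix r n → Matrix r n
blank P? M = matrix (hide P? nothing (at M))

module _ {P : Fin n → Set} (P? : ∀ i → Dec (P i)) (M : Matrix r n) where

  blank-in : ∀ {i j} → P i ⊎ P j → at (blank P? M) i j ≡ nothing
  blank-in {i} {j} p = ≡-trans (at-matrix (hide P? nothing (at M)) i j) (hide-in P? nothing (at M) p)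

  blank-out : ∀ {i j} → ¬ P i → ¬ P j → at (blank P? M) i j ≡ at M i j
  blank-out {i} {j} ¬p ¬q = ≡-trans (at-matrix (hide P? nothing (at M)) i j) (hide-out P? nothing (at M) ¬p ¬q)

blank-cong : {P : Fin n → Set} (P? : ∀ i → Dec (P i)) (M N : Matrix r n) →
  (∀ i j → ¬ P i → ¬ P j → at M i j ≡ at N i j) → blank P? M ≡ blank P? N
blank-cong P? M N h = matrix-ext λ i j → go i j (P? i) (P? j)
  where
  go : ∀ i j → Dec _ → Dec _ → at (blank P? M) i j ≡ at (blank P? N) i j
  go i j (yes p) _       = ≡-trans (blank-in P? M (inj₁ p)) (≡-sym (blank-in P? N (inj₁ p)))
  go i j (no _)  (yes q) = ≡-trans (blank-in P? M (inj₂ q)) (≡-sym (blank-in P? N (inj₂ q)))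
  go i j (no ¬p) (no ¬q) = ≡-trans (blank-out P? M ¬p ¬q) (≡-trans (h i j ¬p ¬q) (≡-sym (blank-out P? N ¬p ¬q)))

blank-valid : {G : Graph n} {M : Matrix r n} (v : Fin n) → Valid G M → Valid (isolate G v) (blank (_≟ v) M)
blank-valid {n} {G = G} {M} v V = valid symm uncol col clos
  where
  N = blank (_≟ v) M
  out : ∀ {i j} → i ≢ v → j ≢ v → at N i j ≡ at M i j
  out = blank-out (_≟ v) M
  just-out : ∀ {i j c} → at N i j ≡ just c → (i ≢ v × j ≢ v) × at M i j ≡ just c
  just-out {i} {j} eq with i ≟ v | j ≟ v
  ... | yes p | _     = case ≡-trans (≡-sym eq) (blank-in (_≟ v) M (inj₁ p)) of λ ()
  ... | no _  | yes q = case ≡-trans (≡-sym eq) (blank-in (_≟ v) M {i} (inj₂ q)) of λ ()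
  ... | no ¬p | no ¬q = (¬p , ¬q) , ≡-trans (≡-sym (out ¬p ¬q)) eq
  symm : ∀ i j → at N i j ≡ at N j i
  symm i j with i ≟ v | j ≟ v
  ... | yes p | _     = ≡-trans (blank-in (_≟ v) M (inj₁ p)) (≡-sym (blank-in (_≟ v) M (inj₂ p)))
  ... | no _  | yes q = ≡-trans (blank-in (_≟ v) M (inj₂ q)) (≡-sym (blank-in (_≟ v) M (inj₁ q)))
  ... | no ¬p | no ¬q = ≡-trans (out ¬p ¬q) (≡-trans (symmetric V i j) (≡-sym (out ¬q ¬p)))
  uncol : ∀ i j → adj (isolate G v) i j ≡ false → at N i j ≡ nothing
  uncol i j eq = go (i ≟ v) (j ≟ v)
    where
    go : Dec (i ≡ v) → Dec (j ≡ v) → at N i j ≡ nothing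
    go (yes p) _       = blank-in (_≟ v) M (inj₁ p)
    go (no _)  (yes q) = blank-in (_≟ v) M (inj₂ q)
    go (no ¬p) (no ¬q) = ≡-trans (out ¬p ¬q) (uncoloured V i j (≡-trans (≡-sym (hide-out (_≟ v) false (adj G) ¬p ¬q)) eq))
  col : ∀ i j → adj (isolate G v) i j ≡ true → at N i j ≢ nothing
  col i j eq eq′ with ¬p , ¬q , e ← isolate-adj G eq = coloured V i j e (≡-trans (≡-sym (out ¬p ¬q)) eq′)
  clos : ∀ i j k c → at N i j ≡ just c → at N j k ≡ just c → adj (isolate G v) i k ≡ true → at N i k ≡ just c
  clos i j k c ij jk ik with ¬p , ¬q , e ← isolate-adj G ik =
    ≡-trans (out ¬p ¬q) (closed V i j k c (proj₂ (just-out ij)) (proj₂ (just-out jk)) e)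

module Clone {n r : ℕ} (G : Graph n) {u v : Fin n} (u≢v : u ≢ v) (u≁v : adj G u v ≡ false) where

  σ τ : Fin n → Fin n
  σ = v ↦ u
  τ = u ↦ v

  σ≢v : ∀ x → σ x ≢ v
  σ≢v = ↦-avoids u≢v

  τ≢u : ∀ x → τ x ≢ u
  τ≢u = ↦-avoids (u≢v ∘ ≡-sym)

  σ∘τ : ∀ {x} → x ≢ v → σ (τ x) ≡ x
  σ∘τ {x} x≢v = go (x ≟ u)
    where
    go : Dec (x ≡ u) → σ (τ x) ≡ x
    go (yes refl) = ≡-trans (cong σ (↦-hit u v)) (↦-hit v u)
    go (no x≢u)   = ≡-trans (cong σ (↦-miss x≢u)) (↦-miss x≢v)

  Outer : Fin n → Set
  Outer x = x ≢ u × x ≢ v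

  Agree : Matrix r n → Matrix r n → Set
  Agree M N = ∀ i j → Outer i → Outer j → at M i j ≡ at N i j

  -- Both M and N colour the graph without v. The edges at u take their colours from M, and those at
  -- v copy the edges at u in N.
  glue : Matrix r n × Matrix r n → Matrix r n
  glue (M , N) = matrix λ i j → if does ((i ≟ v) ⊎-dec (j ≟ v)) then at N (σ i) (σ j) else at M i j

  module _ {M N : Matrix r n} (V : Valid (isolate G v) M) (W : Valid (isolate G v) N) (agree : Agree M N) where

    private
      L : Matrix r n
      L = glue (M , N)
      H : Graph n
      H = pull G σ

    on-M : ∀ {i j} → i ≢ v → j ≢ v → at L i j ≡ at M i j
    on-M {i} {j} i≢v j≢v = ≡-trans (at-matrix _ i j) (go ((i ≟ v) ⊎-dec (j ≟ v)))
      where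
      go : (d : Dec (i ≡ v ⊎ j ≡ v)) → (if does d then at N (σ i) (σ j) else at M i j) ≡ at M i j
      go (yes (inj₁ p)) = contradiction p i≢v
      go (yes (inj₂ q)) = contradiction q j≢v
      go (no _)         = refl

    on-N : ∀ {i j} → i ≢ u → j ≢ u → at L i j ≡ at N (σ i) (σ j)
    on-N {i} {j} i≢u j≢u = ≡-trans (at-matrix _ i j) (go ((i ≟ v) ⊎-dec (j ≟ v)))
      where
      go : (d : Dec (i ≡ v ⊎ j ≡ v)) → (if does d then at N (σ i) (σ j) else at M i j) ≡ at N (σ i) (σ j)
      go (yes _) = refl
      go (no ¬p) = ≡-trans (agree i j (i≢u , ¬p ∘ inj₁) (j≢u , ¬p ∘ inj₂))
        (≡-sym (cong₂ (at N) (↦-miss (¬p ∘ inj₁)) (↦-miss (¬p ∘ inj₂))))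

    σσ : ∀ {i j} → i ≢ v → j ≢ v → adj H i j ≡ adj G i j
    σσ i≢v j≢v = cong₂ (adj G) (↦-miss i≢v) (↦-miss j≢v)

    isolated : ∀ {i j} → i ≢ v → j ≢ v → adj (isolate G v) i j ≡ adj G i j
    isolated = hide-out (_≟ v) false (adj G)

    twins : adj H u v ≡ false
    twins = ≡-trans (cong₂ (adj G) (↦-miss u≢v) (↦-hit v u)) (irrefl G u)

    twins-blank : at L u v ≡ nothing × at L v u ≡ nothing
    twins-blank = ≡-trans (at-matrix _ u v) (go₁ ((u ≟ v) ⊎-dec (v ≟ v))) , ≡-trans (at-matrix _ v u) (go₂ ((v ≟ v) ⊎-dec (u ≟ v)))
      where
      go₁ : (d : Dec (u ≡ v ⊎ v ≡ v)) → (if does d then at N (σ u) (σ v) else at M u v) ≡ nothing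
      go₁ (yes _) = ≡-trans (cong₂ (at N) (↦-miss u≢v) (↦-hit v u)) (diagonal W u)
      go₁ (no ne) = contradiction (inj₂ refl) ne
      go₂ : (d : Dec (v ≡ v ⊎ u ≡ v)) → (if does d then at N (σ v) (σ u) else at M v u) ≡ nothing
      go₂ (yes _) = ≡-trans (cong₂ (at N) (↦-hit v u) (↦-miss u≢v)) (diagonal W u)
      go₂ (no ne) = contradiction (inj₁ refl) ne

    data View (i j : Fin n) : Set where
      off-v : i ≢ v → j ≢ v → View i j
      off-u : i ≢ u → j ≢ u → View i j
      uv    : i ≡ u → j ≡ v → View i j
      vu    : i ≡ v → j ≡ u → View i j

    view : ∀ i j → View i j
    view i j with i ≟ v | j ≟ v | i ≟ u | j ≟ u
    ... | no p     | no q     | _      | _      = off-v p q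
    ... | _        | _        | no p   | no q   = off-u p q
    ... | yes p    | _        | _      | yes q  = vu p q
    ... | _        | yes q    | yes p  | _      = uv p q
    ... | yes refl | _        | yes p  | no _   = contradiction (≡-sym p) u≢v
    ... | no _     | yes refl | no _   | yes q  = contradiction (≡-sym q) u≢v

    -- Since u and v are not adjacent in `H`, every triangle avoids one of them, so its colours come
    -- entirely from M or entirely from N.
    glue-valid : Valid H L
    glue-valid = valid symm uncol col clos
      where
      symm : ∀ i j → at L i j ≡ at L j i
      symm i j with view i j
      ... | off-v p q     = ≡-trans (on-M p q) (≡-trans (symmetric V i j) (≡-sym (on-M q p)))
      ... | off-u p q     = ≡-trans (on-N p q) (≡-trans (symmetric W _ _) (≡-sym (on-N q p)))
      ... | uv refl refl  = ≡-trans (proj₁ twins-blank) (≡-sym (proj₂ twins-blank))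
      ... | vu refl refl  = ≡-trans (proj₂ twins-blank) (≡-sym (proj₁ twins-blank))
      uncol : ∀ i j → adj H i j ≡ false → at L i j ≡ nothing
      uncol i j eq with view i j
      ... | off-v p q     = ≡-trans (on-M p q) (uncoloured V i j (≡-trans (isolated p q) (≡-trans (≡-sym (σσ p q)) eq)))
      ... | off-u p q     = ≡-trans (on-N p q) (uncoloured W (σ i) (σ j) (≡-trans (isolated (σ≢v i) (σ≢v j)) eq))
      ... | uv refl refl  = proj₁ twins-blank
      ... | vu refl refl  = proj₂ twins-blank
      col : ∀ i j → adj H i j ≡ true → at L i j ≢ nothing
      col i j eq eq′ with view i j
      ... | off-v p q     = coloured V i j (≡-trans (isolated p q) (≡-trans (≡-sym (σσ p q)) eq)) (≡-trans (≡-sym (on-M p q)) eq′)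
      ... | off-u p q     = coloured W (σ i) (σ j) (≡-trans (isolated (σ≢v i) (σ≢v j)) eq) (≡-trans (≡-sym (on-N p q)) eq′)
      ... | uv refl refl  = case ≡-trans (≡-sym eq) twins of λ ()
      ... | vu refl refl  = case ≡-trans (≡-sym eq) (≡-trans (Graph.sym H v u) twins) of λ ()
      adjacent : ∀ {i j c} → at L i j ≡ just c → adj H i j ≡ true
      adjacent {i} {j} eq with adj H i j in e
      ... | true  = refl
      ... | false = case ≡-trans (≡-sym eq) (uncol i j e) of λ ()
      v-avoids-u : ∀ {i j} → adj H i j ≡ true → i ≡ v → j ≢ u
      v-avoids-u eq refl refl = case ≡-trans (≡-sym eq) (≡-trans (Graph.sym H v u) twins) of λ ()
      v≢u : ∀ {x} → x ≡ v → x ≢ u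
      v≢u refl = u≢v ∘ ≡-sym
      flip : ∀ {i j} → adj H i j ≡ true → adj H j i ≡ true
      flip {i} {j} eq = ≡-trans (Graph.sym H j i) eq
      clos : ∀ i j k c → at L i j ≡ just c → at L j k ≡ just c → adj H i k ≡ true → at L i k ≡ just c
      clos i j k c ij jk ik = go (i ≟ v) (j ≟ v) (k ≟ v)
        where
        all-N : i ≢ u → j ≢ u → k ≢ u → at L i k ≡ just c
        all-N p q s = ≡-trans (on-N p s) (closed W (σ i) (σ j) (σ k) c (≡-trans (≡-sym (on-N p q)) ij) (≡-trans (≡-sym (on-N q s)) jk)
          (≡-trans (isolated (σ≢v i) (σ≢v k)) ik))
        go : Dec (i ≡ v) → Dec (j ≡ v) → Dec (k ≡ v) → at L i k ≡ just c
        go (yes p) _ _ = all-N (v≢u p) (v-avoids-u {i} {j} (adjacent ij) p) (v-avoids-u {i} {k} ik p)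
        go _ (yes q) _ = all-N (v-avoids-u {j} {i} (flip {i} {j} (adjacent ij)) q) (v≢u q) (v-avoids-u {j} {k} (adjacent jk) q)
        go _ _ (yes s) = all-N (v-avoids-u {k} {i} (flip {i} {k} ik) s) (v-avoids-u {k} {j} (flip {j} {k} (adjacent jk)) s) (v≢u s)
        go (no p) (no q) (no s) = ≡-trans (on-M p s) (closed V i j k c (≡-trans (≡-sym (on-M p q)) ij)
          (≡-trans (≡-sym (on-M q s)) jk) (≡-trans (isolated p s) (≡-trans (≡-sym (σσ p s)) ik)))

    recover₁ : ∀ i j → at M i j ≡ hide (_≟ v) nothing (at L) i j
    recover₁ i j = go (i ≟ v) (j ≟ v)
      where
      go : Dec (i ≡ v) → Dec (j ≡ v) → at M i j ≡ hide (_≟ v) nothing (at L) i j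
      go (no p) (no q) = ≡-trans (≡-sym (on-M p q)) (≡-sym (hide-out (_≟ v) nothing (at L) p q))
      go (yes p) _ = ≡-trans (uncoloured V i j (hide-in (_≟ v) false (adj G) (inj₁ p))) (≡-sym (hide-in (_≟ v) nothing (at L) (inj₁ p)))
      go _ (yes q) = ≡-trans (uncoloured V i j (hide-in (_≟ v) false (adj G) (inj₂ q))) (≡-sym (hide-in (_≟ v) nothing (at L) (inj₂ q)))

    recover₂ : ∀ i j → at N i j ≡ hide (_≟ v) nothing (λ i j → at L (τ i) (τ j)) i j
    recover₂ i j = go (i ≟ v) (j ≟ v)
      where
      f : Fin n → Fin n → Maybe (Fin r)
      f i j = at L (τ i) (τ j)
      go : Dec (i ≡ v) → Dec (j ≡ v) → at N i j ≡ hide (_≟ v) nothing f i j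
      go (no p) (no q) = ≡-trans (≡-sym (cong₂ (at N) (σ∘τ {i} p) (σ∘τ {j} q)))
        (≡-trans (≡-sym (on-N {τ i} {τ j} (τ≢u i) (τ≢u j))) (≡-sym (hide-out (_≟ v) nothing f p q)))
      go (yes p) _ = ≡-trans (uncoloured W i j (hide-in (_≟ v) false (adj G) {i} {j} (inj₁ p))) (≡-sym (hide-in (_≟ v) nothing f {i} {j} (inj₁ p)))
      go _ (yes q) = ≡-trans (uncoloured W i j (hide-in (_≟ v) false (adj G) {i} {j} (inj₂ q))) (≡-sym (hide-in (_≟ v) nothing f {i} {j} (inj₂ q)))

  clone-count : (ps : List (Matrix r n × Matrix r n)) → Unique ps →
    (∀ {M N} → (M , N) ∈ ps → Valid (isolate G v) M × Valid (isolate G v) N × Agree M N) →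
    length ps ≤ count r (pull G σ)
  clone-count ps uniq ok = injection⇒length≤ glue uniq inj
    (λ p∈ → let V , W , agree = ok p∈ in ∈-colourings⁺ (glue-valid V W agree))
    where
    inj : InjectiveOn glue ps
    inj {M , N} {M′ , N′} p∈ q∈ eq with V , W , agree ← ok p∈ | V′ , W′ , agree′ ← ok q∈ = cong₂ _,_
      (matrix-ext λ i j → ≡-trans (recover₁ V W agree i j)
        (≡-trans (cong (λ L → hide (_≟ v) nothing (at L) i j) eq) (≡-sym (recover₁ V′ W′ agree′ i j))))
      (matrix-ext λ i j → ≡-trans (recover₂ V W agree i j)
        (≡-trans (cong (λ L → hide (_≟ v) nothing (λ i j → at L (τ i) (τ j)) i j) eq) (≡-sym (recover₂ V′ W′ agree′ i j))))

-- The pair u v carries no colour, so a colouring is determined by its restrictions to G - v and G -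
-- u, which agree away from u and v. Let a colouring k away from both have x extensions to G - v and
-- y to G - u. Then G has at most the sum of x y colourings, and the two clones have at least the
-- sums of x² and y².
symmetrization : (G : Graph n) {u v : Fin n} → u ≢ v → adj G u v ≡ false →
  2 * count r G ≤ count r (pull G (v ↦ u)) + count r (pull G (u ↦ v))
symmetrization {n} {r} G {u} {v} u≢v u≁v = begin
  2 * count r G                                    ≤⟨ ℕ.*-monoʳ-≤ 2 restrict ⟩
  2 * length (matched Ms Ns)                         ≤⟨ matched-bound Ms Ns ⟩
  length (matched Ms Ms) + length (matched Ns Ns)      ≤⟨ ℕ.+-mono-≤ cloned-u cloned-v ⟩
  count r (pull G (v ↦ u)) + count r (pull G (u ↦ v)) ∎
  where
  open ℕ.≤-Reasoning
  Inner : Fin n → Set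
  Inner x = x ≡ u ⊎ x ≡ v
  inner? : ∀ x → Dec (Inner x)
  inner? x = (x ≟ u) ⊎-dec (x ≟ v)
  open Pairing _≟ᴹ_ (matrices r n) (matrices-unique r n) ∈-matrices (blank inner?)
  Ms Ns : List (Matrix r n)
  Ms = colourings r (isolate G v)
  Ns = colourings r (isolate G u)
  agree : ∀ (M N : Matrix r n) → blank inner? M ≡ blank inner? N → ∀ i j → ¬ Inner i → ¬ Inner j → at M i j ≡ at N i j
  agree M N eq i j p q = ≡-trans (≡-sym (blank-out inner? M p q)) (≡-trans (cong (λ X → at X i j) eq) (blank-out inner? N p q))
  restrict : count r G ≤ length (matched Ms Ns)
  restrict = injection⇒length≤ (λ M → blank (_≟ v) M , blank (_≟ u) M) (colourings-unique r G) inj into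
    where
    into : ∀ {M} → M ∈ colourings r G → (blank (_≟ v) M , blank (_≟ u) M) ∈ matched Ms Ns
    into {M} M∈ with V ← ∈-colourings⁻ {G = G} M∈ =
      ∈-matched⁺ (∈-colourings⁺ (blank-valid v V)) (∈-colourings⁺ (blank-valid u V))
        (blank-cong inner? (blank (_≟ v) M) (blank (_≟ u) M) λ i j p q → ≡-trans (blank-out (_≟ v) M (p ∘ inj₂) (q ∘ inj₂)) (≡-sym (blank-out (_≟ u) M (p ∘ inj₁) (q ∘ inj₁))))
    inj : InjectiveOn (λ M → blank (_≟ v) M , blank (_≟ u) M) (colourings r G)
    inj {M} {N} M∈ N∈ eq with V ← ∈-colourings⁻ {G = G} M∈ | W ← ∈-colourings⁻ {G = G} N∈ =
      matrix-ext λ i j → go i j (i ≟ v) (j ≟ v) (i ≟ u) (j ≟ u)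
      where
      go : ∀ i j → Dec (i ≡ v) → Dec (j ≡ v) → Dec (i ≡ u) → Dec (j ≡ u) → at M i j ≡ at N i j
      go i j (no p) (no q) _ _ = ≡-trans (≡-sym (blank-out (_≟ v) M p q))
        (≡-trans (cong (λ X → at X i j) (Product.,-injectiveˡ eq)) (blank-out (_≟ v) N p q))
      go i j _ _ (no p) (no q) = ≡-trans (≡-sym (blank-out (_≟ u) M p q))
        (≡-trans (cong (λ X → at X i j) (Product.,-injectiveʳ eq)) (blank-out (_≟ u) N p q))
      go i j (yes refl) _ _ (yes refl) = ≡-trans (uncoloured V v u v≁u) (≡-sym (uncoloured W v u v≁u))
        where v≁u = ≡-trans (Graph.sym G v u) u≁v
      go i j _ (yes refl) (yes refl) _ = ≡-trans (uncoloured V u v u≁v) (≡-sym (uncoloured W u v u≁v))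
      go i j (yes refl) _ (yes p) (no _) = contradiction (≡-sym p) u≢v
      go i j (no _) (yes refl) (no _) (yes q) = contradiction (≡-sym q) u≢v
  cloned-u : length (matched Ms Ms) ≤ count r (pull G (v ↦ u))
  cloned-u = Clone.clone-count G u≢v u≁v (matched Ms Ms) (matched-unique (colourings-unique r _) (colourings-unique r _))
    λ {M} {N} p∈ → let (M∈ , N∈) , eq = ∈-matched⁻ {Ms} {Ms} p∈ in ∈-colourings⁻ M∈ , ∈-colourings⁻ N∈ ,
      λ i j (p , p′) (q , q′) → agree M N eq i j [ p , p′ ]′ [ q , q′ ]′
  cloned-v : length (matched Ns Ns) ≤ count r (pull G (u ↦ v))
  cloned-v = Clone.clone-count G (u≢v ∘ ≡-sym) (≡-trans (Graph.sym G v u) u≁v) (matched Ns Ns)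
    (matched-unique (colourings-unique r _) (colourings-unique r _))
    λ {M} {N} p∈ → let (M∈ , N∈) , eq = ∈-matched⁻ {Ns} {Ns} p∈ in ∈-colourings⁻ M∈ , ∈-colourings⁻ N∈ ,
      λ i j (p , p′) (q , q′) → agree M N eq i j [ p′ , p ]′ [ q′ , q ]′

-- From maximal graphs to complete multipartite graphs

module Zykov (r : ℕ) {n : ℕ} (a b c : Fin n) where

  Maximal : Graph n → Set
  Maximal G = ∀ (H : Graph n) → count r H ≤ count r G

  Twin : Graph n → Fin n → Fin n → Set
  Twin G u w = ∀ z → adj G u z ≡ adj G w z

  twin? : ∀ G u w → Dec (Twin G u w)
  twin? G u w = Fin.all? λ z → adj G u z Bool.≟ adj G w z

  Clean : Graph n → Fin n → Set
  Clean G w = ∀ u → adj G u w ≡ false → Twin G u w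

  Settled : Graph n → Fin n → Fin n → Set
  Settled G w u = adj G u w ≡ true ⊎ Twin G u w

  -- The vertices that are never overwritten while w is being cleaned: only non-neighbours of w that
  -- are not its twins are, and a clean vertex is already a twin of its non-neighbours.
  Safe : Graph n → Fin n → Fin n → Set
  Safe G w x = x ≡ w ⊎ adj G x w ≡ true ⊎ Clean G x

  record Extremal (G : Graph n) : Set where
    field
      maximal : Maximal G
      ab : adj G a b ≡ true
      ac : adj G a c ≡ true
      bc : adj G b c ≡ true
  open Extremal

  AllSafe : Graph n → Fin n → Set
  AllSafe G w = Safe G w a × Safe G w b × Safe G w c

  -- The counts of the two clones average at least the maximum and neither exceeds it, so each
  -- attains it.
  maximal-clone : ∀ {G u w} → Maximal G → u ≢ w → adj G u w ≡ false → Maximal (pull G (u ↦ w))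
  maximal-clone {G} {u} {w} max u≢w u≁w H = ℕ.≤-trans (max H) (ℕ.+-cancelˡ-≤ (count r G) _ _ (begin
    count r G + count r G                                ≡⟨ cong (count r G +_) (ℕ.+-identityʳ _) ⟨
    2 * count r G                                        ≤⟨ symmetrization G u≢w u≁w ⟩
    count r (pull G (w ↦ u)) + count r (pull G (u ↦ w))  ≤⟨ ℕ.+-monoˡ-≤ (count r (pull G (u ↦ w))) (max (pull G (w ↦ u))) ⟩
    count r G + count r (pull G (u ↦ w))                 ∎))
    where open ℕ.≤-Reasoning

  -- A clean vertex is never replaced, because its non-neighbours are its twins already.
  module Replace (G : Graph n) {u w : Fin n} (u≁w : adj G u w ≡ false) (¬twin : ¬ Twin G u w) where

    G′ : Graph n
    G′ = pull G (u ↦ w)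

    u≢w : u ≢ w
    u≢w refl = ¬twin λ _ → refl

    fixed : ∀ {x} → x ≢ u → (u ↦ w) x ≡ x
    fixed = ↦-miss

    same-adj : ∀ {x y} → x ≢ u → y ≢ u → adj G′ x y ≡ adj G x y
    same-adj x≢u y≢u = cong₂ (adj G) (fixed x≢u) (fixed y≢u)

    clean-kept : ∀ {x} → Clean G x → x ≢ u
    clean-kept clean refl = ¬twin λ z → ≡-sym (clean w (≡-trans (Graph.sym G w u) u≁w) z)

    clean-mono : ∀ x → Clean G x → Clean G′ x
    clean-mono x clean y eq z = ≡-trans
      (clean _ (≡-trans (cong (adj G ((u ↦ w) y)) (≡-sym (fixed (clean-kept clean)))) eq) ((u ↦ w) z))
      (cong (λ x → adj G x ((u ↦ w) z)) (≡-sym (fixed (clean-kept clean))))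

    safe-kept : ∀ {x} → Safe G w x → x ≢ u
    safe-kept (inj₁ refl)          = u≢w ∘ ≡-sym
    safe-kept (inj₂ (inj₁ eq))     = λ { refl → case ≡-trans (≡-sym eq) u≁w of λ () }
    safe-kept (inj₂ (inj₂ clean))  = clean-kept clean

    safe-mono : ∀ {x} → Safe G w x → Safe G′ w x
    safe-mono (inj₁ eq)             = inj₁ eq
    safe-mono s@(inj₂ (inj₁ eq))    = inj₂ (inj₁ (≡-trans (same-adj (safe-kept s) (u≢w ∘ ≡-sym)) eq))
    safe-mono (inj₂ (inj₂ clean))   = inj₂ (inj₂ (clean-mono _ clean))

    settled-mono : ∀ x → Settled G w x → Settled G′ w x
    settled-mono x (inj₁ eq) = inj₁ (≡-trans (same-adj (λ { refl → case ≡-trans (≡-sym eq) u≁w of λ () }) (u≢w ∘ ≡-sym)) eq)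
    settled-mono x (inj₂ twin) = inj₂ λ z → ≡-trans (cong (λ y → adj G y ((u ↦ w) z)) (fixed λ { refl → ¬twin twin }))
      (≡-trans (twin ((u ↦ w) z)) (cong (λ y → adj G y ((u ↦ w) z)) (≡-sym (fixed (u≢w ∘ ≡-sym)))))

    now-twin : Twin G′ u w
    now-twin z = cong (λ y → adj G y ((u ↦ w) z)) (≡-trans (↦-hit u w) (≡-sym (fixed (u≢w ∘ ≡-sym))))

    extremal : AllSafe G w → Extremal G → Extremal G′
    extremal (sa , sb , sc) ext = record
      { maximal = maximal-clone {G} (maximal ext) u≢w u≁w
      ; ab = ≡-trans (same-adj (safe-kept sa) (safe-kept sb)) (ab ext)
      ; ac = ≡-trans (same-adj (safe-kept sa) (safe-kept sc)) (ac ext)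
      ; bc = ≡-trans (same-adj (safe-kept sb) (safe-kept sc)) (bc ext)
      }

  -- One pass is enough, because turning u into a copy of w leaves settled vertices settled and
  -- clean vertices clean.
  settle : ∀ w us G → Extremal G → AllSafe G w → ∃ λ G′ → Extremal G′ × (∀ x → Clean G x → Clean G′ x) ×
    (∀ x → Settled G w x → Settled G′ w x) × (∀ {u} → u ∈ us → Settled G′ w u)
  settle w [] G ext safe = G , ext , (λ _ c → c) , (λ _ s → s) , λ ()
  settle w (u ∷ us) G ext safe@(sa , sb , sc) with adj G u w in eq | twin? G u w
  ... | true  | _ with G′ , ext′ , clean , settled , all ← settle w us G ext safe =
    G′ , ext′ , clean , settled , λ { (here refl) → settled u (inj₁ eq) ; (there u∈) → all u∈ }
  ... | false | yes twin with G′ , ext′ , clean , settled , all ← settle w us G ext safe =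
    G′ , ext′ , clean , settled , λ { (here refl) → settled u (inj₂ twin) ; (there u∈) → all u∈ }
  ... | false | no ¬twin
    with G″ , ext″ , clean , settled , all ← settle w us (Replace.G′ G eq ¬twin) (Replace.extremal G eq ¬twin safe ext)
      (Replace.safe-mono G eq ¬twin sa , Replace.safe-mono G eq ¬twin sb , Replace.safe-mono G eq ¬twin sc) =
    G″ , ext″ , (λ x → clean x ∘ Replace.clean-mono G eq ¬twin x) , (λ x → settled x ∘ Replace.settled-mono G eq ¬twin x) ,
    λ { (here refl) → settled u (inj₂ (Replace.now-twin G eq ¬twin)) ; (there u∈) → all u∈ }

  clean-vertex : ∀ w G → Extremal G → AllSafe G w → ∃ λ G′ → Extremal G′ × (∀ x → Clean G x → Clean G′ x) × Clean G′ w
  clean-vertex w G ext safe with G′ , ext′ , mono , _ , all ← settle w (allFin n) G ext safe =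
    G′ , ext′ , mono , λ u eq → case all (∈-allFin u) of λ
      { (inj₁ eq′) → case ≡-trans (≡-sym eq) eq′ of λ () ; (inj₂ twin) → twin }

  clean-list : ∀ ws G → Extremal G → Clean G a → Clean G b → Clean G c →
    ∃ λ G′ → Extremal G′ × (∀ x → Clean G x → Clean G′ x) × (∀ {w} → w ∈ ws → Clean G′ w)
  clean-list [] G ext _ _ _ = G , ext , (λ _ c → c) , λ ()
  clean-list (w ∷ ws) G ext ca cb cc
    with G₁ , ext₁ , mono₁ , cw ← clean-vertex w G ext (inj₂ (inj₂ ca) , inj₂ (inj₂ cb) , inj₂ (inj₂ cc))
    with G₂ , ext₂ , mono₂ , all ← clean-list ws G₁ ext₁ (mono₁ a ca) (mono₁ b cb) (mono₁ c cc) =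
    G₂ , ext₂ , (λ x → mono₂ x ∘ mono₁ x) , λ { (here refl) → mono₂ _ cw ; (there w∈) → all w∈ }

  adj-flip : ∀ (G : Graph n) {x y} → adj G x y ≡ true → adj G y x ≡ true
  adj-flip G {x} {y} eq = ≡-trans (Graph.sym G y x) eq

  -- The order protects the triangle. While one of a, b, c is cleaned, the other two are its
  -- neighbours and are not overwritten; afterwards all three are clean and stay so. Without the
  -- triangle the process could end in a bipartite graph.
  clean-all : ∀ G → Extremal G → ∃ λ G′ → Extremal G′ × (∀ w → Clean G′ w)
  clean-all G ext
    with G₁ , ext₁ , _ , ca ← clean-vertex a G ext
      (inj₁ refl , inj₂ (inj₁ (adj-flip G (ab ext))) , inj₂ (inj₁ (adj-flip G (ac ext))))
    with G₂ , ext₂ , mono₂ , cb ← clean-vertex b G₁ ext₁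
      (inj₂ (inj₁ (ab ext₁)) , inj₁ refl , inj₂ (inj₁ (adj-flip G₁ (bc ext₁))))
    with G₃ , ext₃ , mono₃ , cc ← clean-vertex c G₂ ext₂
      (inj₂ (inj₁ (ac ext₂)) , inj₂ (inj₁ (bc ext₂)) , inj₁ refl)
    with G₄ , ext₄ , _ , all ← clean-list (allFin n) G₃ ext₃ (mono₃ a (mono₂ a ca)) (mono₃ b cb) cc =
    G₄ , ext₄ , λ w → all (∈-allFin w)

  module Parts (G : Graph n) (clean : ∀ w → Clean G w) where

    strangers : Fin n → List (Fin n)
    strangers u = filter (λ z → adj G u z Bool.≟ false) (allFin n)

    -- In a clean graph non-adjacency is an equivalence relation, and a class is named by its first
    -- vertex. The list contains u, so the default is not reached.
    part : Fin n → Fin n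
    part u = headOr u (strangers u)

    self : ∀ u → u ∈ strangers u
    self u = ∈-filter⁺ (λ z → adj G u z Bool.≟ false) (∈-allFin u) (irrefl G u)

    part-stranger : ∀ u → adj G u (part u) ≡ false
    part-stranger u = proj₂ (∈-filter⁻ (λ z → adj G u z Bool.≟ false) {xs = allFin n} (headOr-∈ (self u)))

    stranger⇒same : ∀ {u v} → adj G u v ≡ false → part u ≡ part v
    stranger⇒same {u} {v} eq = headOr-irrelevant
      (List.filter-≐ (λ z → adj G u z Bool.≟ false) (λ z → adj G v z Bool.≟ false)
        ((λ {z} e → ≡-trans (≡-sym (clean v u eq z)) e) , (λ {z} e → ≡-trans (clean v u eq z) e)) (allFin n))
      (self u)

    adj⇒apart : ∀ {u v} → adj G u v ≡ true → part u ≢ part v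
    adj⇒apart {u} {v} eq same = case ≡-trans (≡-sym eq) (≡-trans (clean (part u) u (part-stranger u) v)
      (≡-trans (cong (λ z → adj G z v) same) (≡-trans (Graph.sym G (part v) v) (part-stranger v)))) of λ ()

    apart⇒adj : ∀ {u v} → part u ≢ part v → adj G u v ≡ true
    apart⇒adj {u} {v} apart with adj G u v in eq
    ... | true  = refl
    ... | false = contradiction (stranger⇒same eq) apart

  extremal-bound : ∀ {d} → 1 < r → Gains r d → ∀ G → Extremal G → let e = 2 * (2 * suc d) in
    count r G ^ e ≤ (((n + n) ^ r) ^ n) ^ e * r ^ (d * (n * n) + 12 * suc d * n)
  extremal-bound {d} 1<r gains G ext with G′ , ext′ , clean ← clean-all G ext = ℕ.≤-trans
    (ℕ.^-monoˡ-≤ (2 * (2 * suc d)) {count r G} {count r G′} (maximal ext′ G))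
    (Multipartite.count-bound G′ part adj⇒apart apart⇒adj 1<r gains
      (adj⇒apart (ab ext′)) (adj⇒apart (ac ext′)) (adj⇒apart (bc ext′)))
    where
    open Parts G′ clean

-- Large n

-- With q = n / K the left side is at most Q (q + 1) ^ B. As K = B + 1, there is one spare factor q
-- + 1, which exceeds the constant Q, and (q + 1) ^ K ≤ 2 ^ (q K).
exponential : ∀ A B → ∃ λ n₀ → ∀ n → n₀ ≤ n → (n + n) ^ B * A < 2 ^ n
exponential A B = K * Q , λ n n₀≤n → let q = n / K in begin-strict
  (n + n) ^ B * A                        ≤⟨ ℕ.*-monoˡ-≤ A (ℕ.^-monoˡ-≤ B (ℕ.+-mono-≤ (upper n) (upper n))) ⟩
  (suc q * K + suc q * K) ^ B * A        ≡⟨ cong (λ x → x ^ B * A) (regroup (suc q) K) ⟩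
  (suc q * (K + K)) ^ B * A              ≡⟨ cong (_* A) (^-distribʳ-* B (suc q) (K + K)) ⟩
  suc q ^ B * (K + K) ^ B * A            ≡⟨ ℕ.*-assoc (suc q ^ B) _ A ⟩
  suc q ^ B * Q                          ≡⟨ ℕ.*-comm (suc q ^ B) Q ⟩
  Q * suc q ^ B                          <⟨ ℕ.*-monoˡ-< (suc q ^ B) {{ℕ.m^n≢0 (suc q) B}} (s≤s (large n n₀≤n)) ⟩
  suc q ^ K                              ≤⟨ ℕ.^-monoˡ-≤ K (suc≤2^ q) ⟩
  (2 ^ q) ^ K                            ≡⟨ ℕ.^-*-assoc 2 q K ⟩
  2 ^ (q * K)                            ≤⟨ ℕ.^-monoʳ-≤ 2 (m/n*n≤m n K) ⟩
  2 ^ n                                  ∎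
  where
  open ℕ.≤-Reasoning
  K Q : ℕ
  K = suc B
  Q = (K + K) ^ B * A
  regroup : ∀ x y → x * y + x * y ≡ x * (y + y)
  regroup = solve-∀
  upper : ∀ n → n ≤ suc (n / K) * K
  upper n = ℕ.≤-trans (ℕ.≤-reflexive (m≡m%n+[m/n]*n n K)) (ℕ.+-monoˡ-≤ _ (ℕ.<⇒≤ (m%n<n n K)))
  large : ∀ n → K * Q ≤ n → Q ≤ n / K
  large n h = subst (_≤ n / K) (≡-trans (cong (_/ K) (ℕ.*-comm K Q)) (m*n/n≡m Q K)) (/-monoˡ-≤ K h)
  suc≤2^ : ∀ q → suc q ≤ 2 ^ q
  suc≤2^ zero    = ℕ.≤-refl
  suc≤2^ (suc q) = ℕ.≤-trans (s≤s (suc≤2^ q)) (subst (_≤ 2 ^ q + (2 ^ q + 0)) (ℕ.+-comm (2 ^ q) 1)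
    (ℕ.+-monoʳ-≤ (2 ^ q) (ℕ.≤-trans (1≤^ q (s≤s z≤n)) (ℕ.m≤m+n (2 ^ q) 0))))

root-cancel : ∀ {x y} k → x ^ suc k ≤ y ^ suc k → x ≤ y
root-cancel {x} {y} k h with x ≤? y
... | yes x≤y = x≤y
... | no  x≰y = contradiction h (ℕ.<⇒≱ (ℕ.^-monoˡ-< (suc k) (ℕ.≰⇒> x≰y)))

4exK3 : ∀ n → n * n ≤ 3 + exK3 n * 4
4exK3 n = ℕ.≤-trans (ℕ.≤-reflexive (m≡m%n+[m/n]*n (n * n) 4)) (ℕ.+-monoˡ-≤ _ (ℕ.≤-pred (m%n<n (n * n) 4)))

-- The left exponent is at least D N² - 3 D, the right one has only d N² with d = D - 1. After
-- cancelling r ^ (d N²) and taking N-th roots, r ^ N would be at most a fixed power of 2 N times r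
-- ^ (15 D). Here 15 D is 12 D from the linear term plus 3 D from rounding N² / 4.
below-threshold : ∀ {r} d → 2 ≤ r → ∃ λ n₀ → ∀ n → n₀ ≤ n → let e = 2 * (2 * suc d) in
  ¬ ((r ^ exK3 n) ^ e ≤ (((n + n) ^ r) ^ n) ^ e * r ^ (d * (n * n) + 12 * suc d * n))
below-threshold {r} d 2≤r with n₁ , exp ← exponential (r ^ (15 * suc d)) (r * (2 * (2 * suc d))) =
  suc n₁ , λ { (suc k) (s≤s n₁≤k) h → ℕ.<⇒≱ (ℕ.<-≤-trans (exp (suc k) (ℕ.m≤n⇒m≤1+n n₁≤k)) (ℕ.^-monoˡ-≤ (suc k) 2≤r)) (bound k h) }
  where
  open ℕ.≤-Reasoning
  D e : ℕ
  D = suc d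
  e = 2 * (2 * suc d)
  instance
    r≢0 : NonZero r
    r≢0 = >-nonZero (ℕ.<-trans (s≤s z≤n) 2≤r)
  bound : ∀ k → let N = suc k in (r ^ exK3 N) ^ e ≤ (((N + N) ^ r) ^ N) ^ e * r ^ (d * (N * N) + 12 * D * N) →
    r ^ N ≤ (N + N) ^ (r * e) * r ^ (15 * D)
  bound k h = root-cancel k (ℕ.*-cancelʳ-≤ _ _ (r ^ (d * (N * N))) {{ℕ.m^n≢0 r (d * (N * N))}} (begin
    (r ^ N) ^ N * r ^ (d * (N * N))                            ≡⟨ cong (_* r ^ (d * (N * N))) (ℕ.^-*-assoc r N N) ⟩
    r ^ (N * N) * r ^ (d * (N * N))                            ≡⟨ ℕ.^-distribˡ-+-* r (N * N) _ ⟨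
    r ^ (D * (N * N))                                          ≤⟨ ℕ.^-monoʳ-≤ r (ℕ.*-monoʳ-≤ D (4exK3 N)) ⟩
    r ^ (D * (3 + exK3 N * 4))                                 ≡⟨ cong (r ^_) (split d (exK3 N)) ⟩
    r ^ (exK3 N * e + 3 * D)                                   ≡⟨ ℕ.^-distribˡ-+-* r (exK3 N * e) _ ⟩
    r ^ (exK3 N * e) * r ^ (3 * D)                             ≡⟨ cong (_* r ^ (3 * D)) (ℕ.^-*-assoc r (exK3 N) e) ⟨
    (r ^ exK3 N) ^ e * r ^ (3 * D)                             ≤⟨ ℕ.*-monoˡ-≤ (r ^ (3 * D)) h ⟩
    X * r ^ (d * (N * N) + 12 * D * N) * r ^ (3 * D)           ≡⟨ ℕ.*-assoc X _ _ ⟩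
    X * (r ^ (d * (N * N) + 12 * D * N) * r ^ (3 * D))         ≡⟨ cong (X *_) (ℕ.^-distribˡ-+-* r (d * (N * N) + 12 * D * N) _) ⟨
    X * r ^ (d * (N * N) + 12 * D * N + 3 * D)                 ≤⟨ ℕ.*-monoʳ-≤ X (ℕ.^-monoʳ-≤ r exponents) ⟩
    X * r ^ (15 * D * N + d * (N * N))                         ≡⟨ cong (X *_) (ℕ.^-distribˡ-+-* r (15 * D * N) _) ⟩
    X * (r ^ (15 * D * N) * r ^ (d * (N * N)))                 ≡⟨ ℕ.*-assoc X _ _ ⟨
    X * r ^ (15 * D * N) * r ^ (d * (N * N))                   ≡⟨ cong (_* r ^ (d * (N * N))) (cong₂ _*_ X≡ (≡-sym (ℕ.^-*-assoc r (15 * D) N))) ⟩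
    ((N + N) ^ (r * e)) ^ N * (r ^ (15 * D)) ^ N * r ^ (d * (N * N))
      ≡⟨ cong (_* r ^ (d * (N * N))) (^-distribʳ-* N ((N + N) ^ (r * e)) (r ^ (15 * D))) ⟨
    ((N + N) ^ (r * e) * r ^ (15 * D)) ^ N * r ^ (d * (N * N)) ∎))
    where
    N X : ℕ
    N = suc k
    X = (((N + N) ^ r) ^ N) ^ e
    X≡ : X ≡ ((N + N) ^ (r * e)) ^ N
    X≡ = ≡-trans (^-swap ((N + N) ^ r) N e) (cong (_^ N) (ℕ.^-*-assoc (N + N) r e))
    split : ∀ d x → suc d * (3 + x * 4) ≡ x * (2 * (2 * suc d)) + 3 * suc d
    split = solve-∀
    regroup : ∀ d n x → x + 12 * suc d * n + 3 * suc d * n ≡ 15 * suc d * n + x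
    regroup = solve-∀
    exponents : d * (N * N) + 12 * D * N + 3 * D ≤ 15 * D * N + d * (N * N)
    exponents = ℕ.≤-trans (ℕ.+-monoʳ-≤ (d * (N * N) + 12 * D * N) (ℕ.m≤m*n (3 * D) N)) (ℕ.≤-reflexive (regroup d N (d * (N * N))))

-- Colourings as vectors indexed by the edges

TriangleFree : Graph n → Set
TriangleFree G = ∀ {a b c} → adj G a b ≡ true → adj G a c ≡ true → adj G b c ≡ true → ⊥

T⇒≡ : ∀ {x} → T x → x ≡ true
T⇒≡ = Bool.T-≡ .Equivalence.to

≡⇒T : ∀ {x} → x ≡ true → T x
≡⇒T = Bool.T-≡ .Equivalence.from

∈-pairs : ∀ (i j : Fin n) → (i , j) ∈ pairs n
∈-pairs {n} i j = ∈-concatMap⁺ (λ i → map (i ,_) (allFin n)) (Any.map (λ { refl → ∈-map⁺ (i ,_) (∈-allFin j) }) (∈-allFin i))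

pairs-unique : ∀ n → Unique (pairs n)
pairs-unique n = concatMap-unique (λ i → map (i ,_) (allFin n)) (λ i → Unique.map⁺ Product.,-injectiveʳ (Unique.allFin⁺ n))
  (AllPairs.map (λ {i} {j} i≢j _ p q → let _ , _ , e = ∈-map⁻ (i ,_) p ; _ , _ , e′ = ∈-map⁻ (j ,_) q in
    i≢j (Product.,-injectiveˡ (≡-trans (≡-sym e) e′))) (Unique.allFin⁺ n))

∈-edges⁺ : (G : Graph n) {i j : Fin n} → toℕ i < toℕ j → adj G i j ≡ true → (i , j) ∈ edges G
∈-edges⁺ G {i} {j} i<j eq = ∈-filter⁺ _ (∈-pairs i j) (Bool.T-∧ .Equivalence.from (ℕ.<⇒<ᵇ i<j , ≡⇒T eq))

∈-edges⁻ : (G : Graph n) {i j : Fin n} → (i , j) ∈ edges G → toℕ i < toℕ j × adj G i j ≡ true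
∈-edges⁻ {n} G {i} {j} e∈ =
  let lt , ad = Bool.T-∧ {toℕ i <ᵇ toℕ j} .Equivalence.to (proj₂ (∈-filter⁻ _ {xs = pairs n} e∈))
  in ℕ.<ᵇ⇒< (toℕ i) (toℕ j) lt , T⇒≡ ad

edges-unique : (G : Graph n) → Unique (edges G)
edges-unique {n} G = Unique.filter⁺ _ (pairs-unique n)

∈-triangles⁺ : (G : Graph n) {i j k : Fin n} → toℕ i < toℕ j → toℕ j < toℕ k →
  adj G i j ≡ true → adj G j k ≡ true → adj G i k ≡ true → (i , j , k) ∈ triangles G
∈-triangles⁺ {n} G {i} {j} {k} i<j j<k ij jk ik = ∈-filter⁺ _
  (∈-concatMap⁺ _ (Any.map (λ { refl → ∈-concatMap⁺ _ (Any.map (λ { refl → ∈-map⁺ _ (∈-allFin k) }) (∈-allFin j)) }) (∈-allFin i)))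
  (T-∧ (ℕ.<⇒<ᵇ i<j) (T-∧ (ℕ.<⇒<ᵇ j<k) (T-∧ (≡⇒T ij) (T-∧ (≡⇒T jk) (≡⇒T ik)))))
  where
  T-∧ : ∀ {x y} → T x → T y → T (x ∧ y)
  T-∧ p q = Bool.T-∧ .Equivalence.from (p , q)

∈-triangles⁻ : (G : Graph n) {i j k : Fin n} → (i , j , k) ∈ triangles G →
  adj G i j ≡ true × adj G j k ≡ true × adj G i k ≡ true
∈-triangles⁻ G {i} {j} {k} t∈ =
  let _ , p₁ = T-∧ {toℕ i <ᵇ toℕ j} (proj₂ (∈-filter⁻ _ {xs = triples} t∈))
      _ , p₂ = T-∧ {toℕ j <ᵇ toℕ k} p₁
      ij , p₃ = T-∧ {adj G i j} p₂
      jk , ik = T-∧ {adj G j k} p₃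
  in T⇒≡ ij , T⇒≡ jk , T⇒≡ ik
  where
  triples = concatMap (λ i → concatMap (λ j → map (λ k → i , j , k) (allFin _)) (allFin _)) (allFin _)
  T-∧ : ∀ {x y} → T (x ∧ y) → T x × T y
  T-∧ = Bool.T-∧ .Equivalence.to

allVecs-unique : ∀ r m → Unique (allVecs r m)
allVecs-unique r zero    = [] ∷ []
allVecs-unique r (suc m) = concatMap-unique (λ c → map (c ∷_) (allVecs r m))
  (λ c → Unique.map⁺ Vec.∷-injectiveʳ (allVecs-unique r m))
  (AllPairs.map (λ {c} {d} c≢d _ p q → let _ , _ , e = ∈-map⁻ (c ∷_) p ; _ , _ , e′ = ∈-map⁻ (d ∷_) q in
    c≢d (Vec.∷-injectiveˡ (≡-trans (≡-sym e) e′))) (Unique.allFin⁺ r))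

length-allVecs : ∀ r m → length (allVecs r m) ≡ r ^ m
length-allVecs r zero    = refl
length-allVecs r (suc m) = ≡-trans (go (allFin r)) (cong (_* r ^ m) (List.length-tabulate {n = r} id))
  where
  go : ∀ cs → length (concatMap (λ c → map (c ∷_) (allVecs r m)) cs) ≡ length cs * r ^ m
  go []       = refl
  go (c ∷ cs) = ≡-trans (List.length-++ (map (c ∷_) (allVecs r m)))
    (cong₂ _+_ (≡-trans (List.length-map (c ∷_) (allVecs r m)) (length-allVecs r m)) (go cs))

allB-true : (p : A → Bool) (xs : List A) → (∀ {x} → x ∈ xs → p x ≡ true) → allB p xs ≡ true
allB-true p []       _ = refl
allB-true p (x ∷ xs) h rewrite h (here refl) = allB-true p xs (h ∘ there)

allB-∈ : (p : A → Bool) (xs : List A) → allB p xs ≡ true → ∀ {x} → x ∈ xs → p x ≡ true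
allB-∈ p (x ∷ xs) eq x∈ with p x in px
allB-∈ p (x ∷ xs) eq (here refl) | true = px
allB-∈ p (x ∷ xs) eq (there x∈)  | true = allB-∈ p xs eq x∈

cK32-triangleFree : (G : Graph n) → TriangleFree G → cK32 r G ≡ r ^ length (edges G)
cK32-triangleFree {r = r} G free = ≡-trans
  (cong length (List.filter-all (λ col → T? (K32free G col))
    (All.universal (λ col → ≡⇒T (allB-true _ (triangles G) λ t∈ →
      let ij , jk , ik = ∈-triangles⁻ G t∈ in ⊥-elim (free ij ik jk))) (allVecs r (length (edges G))))))
  (length-allVecs r (length (edges G)))

lookupCol-∉ : ∀ es (cs : List (Fin r)) {i j : Fin n} → (i , j) ∉ es → lookupCol (zip es cs) i j ≡ nothing
lookupCol-∉ [] _ _ = refl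
lookupCol-∉ (_ ∷ _) [] _ = refl
lookupCol-∉ ((a , b) ∷ es) (c ∷ cs) {i} {j} ∉es with a ≟ i | b ≟ j
... | yes refl | yes refl = contradiction (here refl) ∉es
... | yes _    | no _     = lookupCol-∉ es cs (∉es ∘ there)
... | no _     | _        = lookupCol-∉ es cs (∉es ∘ there)

lookupCol-∈ : ∀ (es : List (Fin n × Fin n)) (cs : Vec (Fin r) (length es)) {i j} → (i , j) ∈ es →
  lookupCol (zip es (Vec.toList cs)) i j ≢ nothing
lookupCol-∈ ((a , b) ∷ es) (c ∷ cs) {i} {j} ∈es eq with a ≟ i | b ≟ j
lookupCol-∈ ((a , b) ∷ es) (c ∷ cs) ∈es         () | yes _ | yes _
lookupCol-∈ ((a , b) ∷ es) (c ∷ cs) (here refl) eq | yes _ | no b≢b = b≢b refl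
lookupCol-∈ ((a , b) ∷ es) (c ∷ cs) (there ∈es) eq | yes _ | no _   = lookupCol-∈ es cs ∈es eq
lookupCol-∈ ((a , b) ∷ es) (c ∷ cs) (here refl) eq | no a≢a | _     = a≢a refl
lookupCol-∈ ((a , b) ∷ es) (c ∷ cs) (there ∈es) eq | no _   | _     = lookupCol-∈ es cs ∈es eq

lookupCol-here : ∀ {a b : Fin n} {c : Fin r} rest → lookupCol (((a , b) , c) ∷ rest) a b ≡ just c
lookupCol-here {a = a} {b} _ with a ≟ a | b ≟ b
... | yes _ | yes _ = refl
... | yes _ | no ne = contradiction refl ne
... | no ne | _     = contradiction refl ne

lookupCol-there : ∀ {a b i j : Fin n} {c : Fin r} rest → (a , b) ≢ (i , j) → lookupCol (((a , b) , c) ∷ rest) i j ≡ lookupCol rest i j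
lookupCol-there {a = a} {b} {i} {j} _ ne with a ≟ i | b ≟ j
... | yes refl | yes refl = contradiction refl ne
... | yes _    | no _     = refl
... | no _     | _        = refl

lookupCol-ext : ∀ {es : List (Fin n × Fin n)} → Unique es → (cs ds : Vec (Fin r) (length es)) →
  (∀ {i j} → (i , j) ∈ es → lookupCol (zip es (Vec.toList cs)) i j ≡ lookupCol (zip es (Vec.toList ds)) i j) → cs ≡ ds
lookupCol-ext [] [] [] _ = refl
lookupCol-ext {es = (a , b) ∷ es} (e∉ ∷ uniq) (c ∷ cs) (d ∷ ds) h = cong₂ _∷_
  (Maybe.just-injective (≡-trans (≡-sym (lookupCol-here {a = a} {b} cs′)) (≡-trans (h (here refl)) (lookupCol-here {a = a} {b} ds′))))
  (lookupCol-ext uniq cs ds λ e∈ → ≡-trans (≡-sym (lookupCol-there {c = c} cs′ (All.lookup e∉ e∈)))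
    (≡-trans (h (there e∈)) (lookupCol-there {c = d} ds′ (All.lookup e∉ e∈))))
  where
  cs′ ds′ : List ((Fin _ × Fin _) × Fin _)
  cs′ = zip es (Vec.toList cs)
  ds′ = zip es (Vec.toList ds)

-- Any single equality entails the others. With p, q, s the colours of i j, j k, i k, each
-- implication serves a different vertex as the middle one in `closed`.
NotTwo : A → A → A → Set _
NotTwo p q s = (p ≡ q → p ≡ s) × (p ≡ s → p ≡ q) × (q ≡ s → p ≡ q)

exactlyTwo-false : (p q s : Maybe (Fin r)) → exactlyTwo p q s ≡ false → NotTwo p q s
exactlyTwo-false p q s eq with Maybe.≡-dec _≟_ p q | Maybe.≡-dec _≟_ p s | Maybe.≡-dec _≟_ q s
... | yes pq | yes ps | yes qs = (λ _ → ps) , (λ _ → pq) , (λ _ → pq)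
... | no ¬pq | no ¬ps | no ¬qs = (λ e → contradiction e ¬pq) , (λ e → contradiction e ¬ps) , (λ e → contradiction e ¬qs)
exactlyTwo-false p q s () | yes _ | yes _ | no _
exactlyTwo-false p q s () | yes _ | no _  | _
exactlyTwo-false p q s () | no _  | yes _ | _
exactlyTwo-false p q s () | no _  | no _  | yes _

module FromVector {n r : ℕ} (G : Graph n) (col : Colouring r G) where

  value : Fin n → Fin n → Maybe (Fin r)
  value = lookupCol (zip (edges G) (Vec.toList col))

  toMatrix : Matrix r n
  toMatrix = matrix λ i j → if toℕ i <ᵇ toℕ j then value i j else value j i

  upper : ∀ {i j} → toℕ i < toℕ j → at toMatrix i j ≡ value i j
  upper {i} {j} i<j = ≡-trans (at-matrix _ i j) (cong (λ b → if b then value i j else value j i) (T⇒≡ (ℕ.<⇒<ᵇ i<j)))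

  lower : ∀ {i j} → toℕ j < toℕ i → at toMatrix i j ≡ value j i
  lower {i} {j} j<i = ≡-trans (at-matrix _ i j) (cong (λ b → if b then value i j else value j i)
    (Bool.¬-not λ eq → ℕ.<-asym j<i (ℕ.<ᵇ⇒< (toℕ i) (toℕ j) (≡⇒T eq))))

  blank-diagonal : ∀ i → at toMatrix i i ≡ nothing
  blank-diagonal i = ≡-trans (at-matrix _ i i) (≡-trans (both (toℕ i <ᵇ toℕ i))
    (lookupCol-∉ (edges G) (Vec.toList col) λ e∈ → ℕ.<-irrefl refl (proj₁ (∈-edges⁻ G e∈))))
    where
    both : ∀ b → (if b then value i i else value i i) ≡ value i i
    both true  = refl
    both false = refl

  symm : ∀ i j → at toMatrix i j ≡ at toMatrix j i
  symm i j with ℕ.<-cmp (toℕ i) (toℕ j)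
  ... | tri< i<j _ _ = ≡-trans (upper i<j) (≡-sym (lower i<j))
  ... | tri> _ _ j<i = ≡-trans (lower j<i) (≡-sym (upper j<i))
  ... | tri≈ _ eq _ with refl ← Fin.toℕ-injective eq = refl

  value-nothing : ∀ {i j} → adj G i j ≡ false → value i j ≡ nothing
  value-nothing eq = lookupCol-∉ (edges G) (Vec.toList col)
    λ e∈ → case ≡-trans (≡-sym eq) (proj₂ (∈-edges⁻ G e∈)) of λ ()

  uncol : ∀ i j → adj G i j ≡ false → at toMatrix i j ≡ nothing
  uncol i j eq with ℕ.<-cmp (toℕ i) (toℕ j)
  ... | tri< i<j _ _ = ≡-trans (upper i<j) (value-nothing eq)
  ... | tri> _ _ j<i = ≡-trans (lower j<i) (value-nothing (≡-trans (Graph.sym G j i) eq))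
  ... | tri≈ _ e _ with refl ← Fin.toℕ-injective e = blank-diagonal i

  col′ : ∀ i j → adj G i j ≡ true → at toMatrix i j ≢ nothing
  col′ i j eq eq′ with ℕ.<-cmp (toℕ i) (toℕ j)
  ... | tri< i<j _ _ = lookupCol-∈ (edges G) col (∈-edges⁺ G i<j eq) (≡-trans (≡-sym (upper i<j)) eq′)
  ... | tri> _ _ j<i = lookupCol-∈ (edges G) col (∈-edges⁺ G j<i (≡-trans (Graph.sym G j i) eq)) (≡-trans (≡-sym (lower j<i)) eq′)
  ... | tri≈ _ e _ with refl ← Fin.toℕ-injective e = case ≡-trans (≡-sym eq) (irrefl G i) of λ ()

  module _ (free : T (K32free G col)) where

    sorted : ∀ {i j k} → toℕ i < toℕ j → toℕ j < toℕ k → adj G i j ≡ true → adj G j k ≡ true → adj G i k ≡ true →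
      NotTwo (at toMatrix i j) (at toMatrix j k) (at toMatrix i k)
    sorted {i} {j} {k} i<j j<k ij jk ik = subst₂ (λ p q → NotTwo p q (at toMatrix i k)) (≡-sym (upper i<j)) (≡-sym (upper j<k))
      (subst (NotTwo (value i j) (value j k)) (≡-sym (upper (ℕ.<-trans i<j j<k)))
        (exactlyTwo-false (value i j) (value j k) (value i k)
          (≡-trans (≡-sym (Bool.not-involutive _)) (cong not
            (allB-∈ _ (triangles G) (T⇒≡ free) (∈-triangles⁺ G i<j j<k ij jk ik))))))

    -- `triangles` lists increasing triples only, so each of the six orders of i, j, k is reduced to
    -- `sorted` by symmetry. Ties are excluded because adjacent vertices are distinct.
    closed′ : ∀ i j k c → at toMatrix i j ≡ just c → at toMatrix j k ≡ just c → adj G i k ≡ true → at toMatrix i k ≡ just c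
    closed′ i j k c ij jk ik = go (ℕ.<-cmp (toℕ i) (toℕ j)) (ℕ.<-cmp (toℕ j) (toℕ k)) (ℕ.<-cmp (toℕ i) (toℕ k))
      where
      adjacent : ∀ {i j} → at toMatrix i j ≡ just c → adj G i j ≡ true
      adjacent {i} {j} eq with adj G i j in e
      ... | true  = refl
      ... | false = case ≡-trans (≡-sym eq) (uncol i j e) of λ ()
      flip : ∀ {i j} → adj G i j ≡ true → adj G j i ≡ true
      flip {i} {j} = ≡-trans (Graph.sym G j i)
      turn : ∀ {i j} → at toMatrix i j ≡ just c → at toMatrix j i ≡ just c
      turn {i} {j} = ≡-trans (symm j i)
      aij : adj G i j ≡ true
      aij = adjacent ij
      ajk : adj G j k ≡ true
      ajk = adjacent jk
      equal : ∀ {x y : Fin n} → x ≡ y → adj G x y ≡ true → ⊥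
      equal {x} refl e = case ≡-trans (≡-sym e) (irrefl G x) of λ ()
      go : Tri (toℕ i < toℕ j) (toℕ i ≡ toℕ j) (toℕ j < toℕ i) → Tri (toℕ j < toℕ k) (toℕ j ≡ toℕ k) (toℕ k < toℕ j) →
        Tri (toℕ i < toℕ k) (toℕ i ≡ toℕ k) (toℕ k < toℕ i) → at toMatrix i k ≡ just c
      go (tri≈ _ e _) _ _ = ⊥-elim (equal (Fin.toℕ-injective e) aij)
      go _ (tri≈ _ e _) _ = ⊥-elim (equal (Fin.toℕ-injective e) ajk)
      go _ _ (tri≈ _ e _) = ⊥-elim (equal (Fin.toℕ-injective e) ik)
      go (tri< i<j _ _) (tri< j<k _ _) _ =
        ≡-trans (≡-sym (proj₁ (sorted i<j j<k aij ajk ik) (≡-trans ij (≡-sym jk)))) ij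
      go (tri> _ _ j<i) (tri> _ _ k<j) _ =
        turn (≡-trans (≡-sym (proj₁ (sorted k<j j<i (flip ajk) (flip aij) (flip ik)) (≡-trans (turn jk) (≡-sym (turn ij))))) (turn jk))
      go (tri< _ _ _) (tri> _ _ k<j) (tri< i<k _ _) =
        ≡-trans (proj₂ (proj₂ (sorted i<k k<j ik (flip ajk) aij)) (≡-trans (turn jk) (≡-sym ij))) (turn jk)
      go (tri< i<j _ _) (tri> _ _ k<j) (tri> _ _ k<i) =
        turn (≡-trans (proj₂ (proj₂ (sorted k<i i<j (flip ik) aij (flip ajk))) (≡-trans ij (≡-sym (turn jk)))) ij)
      go (tri> _ _ j<i) (tri< j<k _ _) (tri< i<k _ _) =
        ≡-trans (≡-sym (proj₁ (proj₂ (sorted j<i i<k (flip aij) ik ajk)) (≡-trans (turn ij) (≡-sym jk)))) (turn ij)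
      go (tri> _ _ j<i) (tri< j<k _ _) (tri> _ _ k<i) =
        turn (≡-trans (≡-sym (proj₁ (proj₂ (sorted j<k k<i ajk (flip ik) (flip aij))) (≡-trans jk (≡-sym (turn ij))))) jk)

    toMatrix-valid : Valid G toMatrix
    toMatrix-valid = valid symm uncol col′ closed′

-- The passage from vectors to matrices loses nothing: the edge list has no repetitions, so every
-- entry of a vector can be read off at its edge.
cK32≤count : ∀ r (G : Graph n) → cK32 r G ≤ count r G
cK32≤count r G = injection⇒length≤ (FromVector.toMatrix G)
  (Unique.filter⁺ (λ col → T? (K32free G col)) (allVecs-unique r (length (edges G))))
  (λ {col} {col′} _ _ eq → lookupCol-ext (edges-unique G) col col′ λ e∈ → let i<j = proj₁ (∈-edges⁻ G e∈) in
    ≡-trans (≡-sym (FromVector.upper G col i<j)) (≡-trans (cong (λ M → at M _ _) eq) (FromVector.upper G col′ i<j)))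
  (λ {col} col∈ → ∈-colourings⁺ (FromVector.toMatrix-valid G col
    (proj₂ (∈-filter⁻ (λ col → T? (K32free G col)) {xs = allVecs r (length (edges G))} col∈))))

-- A valid matrix is determined by its entries on the edges. Together with Mantel's bound this
-- limits the triangle-free competitors in `triangle-count`.
count≤ : ∀ r (G : Graph n) → count r G ≤ r ^ length (edges G)
count≤ {n} r G = ℕ.≤-trans (injection⇒length≤ restrict (colourings-unique r G) inj into) (ℕ.≤-reflexive size)
  where
  es : List (Fin n × Fin n)
  es = edges G
  choices : List (Vec (Maybe (Fin r)) (length es))
  choices = vecsOf λ _ → map just (allFin r)
  entry : Matrix r n → Fin n × Fin n → Maybe (Fin r)
  entry M (i , j) = at M i j
  restrict : Matrix r n → Vec (Maybe (Fin r)) (length es)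
  restrict M = Vec.tabulate λ k → entry M (Data.List.lookup es k)
  size : length choices ≡ r ^ length es
  size = ≡-trans (length-vecsOf {n = length es} _) (≡-trans (product-replicate _ (allFin (length es)))
    (cong₂ _^_ (≡-trans (List.length-map just (allFin r)) (List.length-tabulate {n = r} id)) (List.length-tabulate {n = length es} id)))
  into : ∀ {M} → M ∈ colourings r G → restrict M ∈ choices
  into {M} M∈ = ∈-vecsOf⁺ _ (restrict M) λ k → subst (_∈ map just (allFin r)) (≡-sym (Vec.lookup∘tabulate _ k))
    (coloured-entry (∈-lookup {xs = es} k))
    where
    coloured-entry : ∀ {e} → e ∈ es → entry M e ∈ map just (allFin r)
    coloured-entry e∈ with c , eq ← adj⇒coloured (∈-colourings⁻ {G = G} M∈) (proj₂ (∈-edges⁻ G e∈)) =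
      subst (_∈ map just (allFin r)) (≡-sym eq) (∈-map⁺ just (∈-allFin c))
  inj : InjectiveOn restrict (colourings r G)
  inj {M} {N} M∈ N∈ eq = upper-ext V W λ {u} {v} u<v → go u v u<v (adj G u v) refl
    where
    V : Valid G M
    V = ∈-colourings⁻ M∈
    W : Valid G N
    W = ∈-colourings⁻ N∈
    same : ∀ k → entry M (Data.List.lookup es k) ≡ entry N (Data.List.lookup es k)
    same k = ≡-trans (≡-sym (Vec.lookup∘tabulate _ k)) (≡-trans (cong (λ v → lookup v k) eq) (Vec.lookup∘tabulate _ k))
    go : ∀ u v → toℕ u < toℕ v → ∀ b → adj G u v ≡ b → at M u v ≡ at N u v
    go u v _   false eq = ≡-trans (uncoloured V u v eq) (≡-sym (uncoloured W u v eq))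
    go u v u<v true  eq = subst (λ e → entry M e ≡ entry N e) (≡-sym (Any.lookup-index e∈)) (same (Any.index e∈))
      where
      e∈ : (u , v) ∈ es
      e∈ = ∈-edges⁺ G u<v eq

-- Mantel's theorem with uniqueness

quotient : ∀ {q m} k .{{_ : NonZero k}} → q * k ≤ m → m < suc q * k → m / k ≡ q
quotient {q} {m} k lower upper = ℕ.≤-antisym (ℕ.≤-pred (m<n*o⇒m/o<n {m} {suc q} {k} upper))
  (subst (_≤ m / k) (m*n/n≡m q k) (/-monoˡ-≤ k lower))

product≤exK3 : ∀ {a b n} → a + b ≡ n → a * b ≤ exK3 n
product≤exK3 {a} {b} refl = subst (_≤ (a + b) * (a + b) / 4) (m*n/n≡m (a * b) 4) (/-monoˡ-≤ 4 (amgm a b))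
  where
  square : ∀ a z → a * (a + z) * 4 + z * z ≡ (a + (a + z)) * (a + (a + z))
  square = solve-∀
  amgm : ∀ a b → a * b * 4 ≤ (a + b) * (a + b)
  amgm a b with ℕ.≤-total a b
  ... | inj₁ a≤b with z , refl ← ℕ.m≤n⇒∃[o]m+o≡n a≤b = ℕ.≤-trans (ℕ.m≤m+n _ (z * z)) (ℕ.≤-reflexive (square a z))
  ... | inj₂ b≤a with z , refl ← ℕ.m≤n⇒∃[o]m+o≡n b≤a = ℕ.≤-trans (ℕ.m≤m+n _ (z * z))
    (ℕ.≤-reflexive (≡-trans (cong (λ x → x * 4 + z * z) (ℕ.*-comm (b + z) b))
      (≡-trans (square b z) (cong (λ x → x * x) (ℕ.+-comm b (b + z))))))

half-split : ∀ n → n / 2 + (n ∸ n / 2) ≡ n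
half-split n = ℕ.m+[n∸m]≡n (ℕ.≤-trans (ℕ.m≤m*n (n / 2) 2) (m/n*n≤m n 2))

balanced : ∀ {a b n} → a + b ≡ n → exK3 n ≤ a * b → a ≤ b → n / 2 ≡ a
balanced {a} {b} refl ex≤ a≤b with z , refl ← ℕ.m≤n⇒∃[o]m+o≡n a≤b = go z ex≤
  where
  go : ∀ z → exK3 (a + (a + z)) ≤ a * (a + z) → (a + (a + z)) / 2 ≡ a
  go 0 _ = quotient 2 (ℕ.≤-reflexive (even a)) (ℕ.≤-trans (s≤s (ℕ.≤-reflexive (≡-sym (even a)))) (ℕ.n≤1+n _))
    where
    even : ∀ a → a * 2 ≡ a + (a + 0)
    even = solve-∀
  go 1 _ = quotient 2 (ℕ.≤-trans (ℕ.n≤1+n _) (ℕ.≤-reflexive (odd a))) (s≤s (ℕ.≤-reflexive (≡-sym (odd a))))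
    where
    odd : ∀ a → 1 + a * 2 ≡ a + (a + 1)
    odd = solve-∀
  -- If the parts differ by y + 2, then 4 (a b + 1) + y (y + 4) = n², so a b + 1 still fits under n²
  -- / 4.
  go (suc (suc y)) h = contradiction h (ℕ.<⇒≱ (subst (_≤ exK3 (a + (a + suc (suc y)))) (m*n/n≡m (suc (a * (a + suc (suc y)))) 4)
    (/-monoˡ-≤ 4 (ℕ.≤-trans (ℕ.m≤m+n _ (y * (4 + y))) (ℕ.≤-reflexive (square a y))))))
    where
    square : ∀ a y → suc (a * (a + suc (suc y))) * 4 + y * (4 + y) ≡
      (a + (a + suc (suc y))) * (a + (a + suc (suc y)))
    square = solve-∀

exK3≤halves : ∀ n → exK3 n ≤ n / 2 * (n ∸ n / 2)
exK3≤halves n = ℕ.≤-pred (m<n*o⇒m/o<n {n * n} {suc (h * (n ∸ h))} {4} (go (n % 2) (m%n<n n 2) (m≡m%n+[m/n]*n n 2)))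
  where
  h : ℕ
  h = n / 2
  even : ∀ h → suc ((h + (h + 0)) * (h + (h + 0))) + 3 ≡ suc (h * (h + 0)) * 4
  even = solve-∀
  odd : ∀ h → suc ((h + (h + 1)) * (h + (h + 1))) + 2 ≡ suc (h * (h + 1)) * 4
  odd = solve-∀
  rest : ∀ t → n ≡ t + h * 2 → n ∸ h ≡ h + t
  rest t eq = ≡-trans (cong (_∸ h) (≡-trans eq (regroup t h))) (ℕ.m+n∸m≡n h (h + t))
    where
    regroup : ∀ t h → t + h * 2 ≡ h + (h + t)
    regroup = solve-∀
  go : ∀ t → t < 2 → n ≡ t + h * 2 → n * n < suc (h * (n ∸ h)) * 4
  go t t<2 eq = subst₂ (λ x y → x * x < suc (h * y) * 4) (≡-trans (cong (h +_) (≡-sym (rest t eq))) (half-split n)) (≡-sym (rest t eq)) (small t t<2)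
    where
    small : ∀ t → t < 2 → (h + (h + t)) * (h + (h + t)) < suc (h * (h + t)) * 4
    small 0 _ = ℕ.≤-trans (ℕ.m≤m+n _ 3) (ℕ.≤-reflexive (even h))
    small 1 _ = ℕ.≤-trans (ℕ.m≤m+n _ 2) (ℕ.≤-reflexive (odd h))
    small (suc (suc _)) (s≤s (s≤s ()))

-- Matching Boolean functions by a permutation

bit : Bool → ℕ
bit true  = 1
bit false = 0

trues : (Fin n → Bool) → ℕ
trues {n = zero}  f = 0
trues {n = suc n} f = bit (f zero) + trues (f ∘ suc)

trues-filter : {A : Set} (f : A → Bool) (h : Fin n → A) → length (filter (λ x → f x Bool.≟ true) (tabulate h)) ≡ trues (f ∘ h)
trues-filter {n = zero}  f h = refl
trues-filter {n = suc n} f h with f (h zero)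
... | true  = cong suc (trues-filter f (h ∘ suc))
... | false = trues-filter f (h ∘ suc)

trues-punchIn : (g : Fin (suc n) → Bool) (j : Fin (suc n)) → trues g ≡ bit (g j) + trues (g ∘ punchIn j)
trues-punchIn g zero = refl
trues-punchIn {n = suc n} g (suc j) = ≡-trans (cong (bit (g zero) +_) (trues-punchIn (g ∘ suc) j))
  (rearrange (bit (g zero)) (bit (g (suc j))) _)
  where
  rearrange : ∀ x y z → x + (y + z) ≡ y + (x + z)
  rearrange = solve-∀

trues-const : ∀ {f : Fin n → Bool} b → (∀ i → f i ≡ b) → trues f ≡ n * bit b
trues-const {n = zero}  b _ = refl
trues-const {n = suc n} b h = cong₂ _+_ (cong bit (h zero)) (trues-const b (h ∘ suc))

trues≤ : (f : Fin n → Bool) → trues f ≤ n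
trues≤ {n = zero}  f = z≤n
trues≤ {n = suc n} f = ℕ.+-mono-≤ (bit≤1 (f zero)) (trues≤ (f ∘ suc))
  where
  bit≤1 : ∀ b → bit b ≤ 1
  bit≤1 true  = ℕ.≤-refl
  bit≤1 false = z≤n

trues-not : (f : Fin n → Bool) → trues f + trues (not ∘ f) ≡ n
trues-not {n = zero}  f = refl
trues-not {n = suc n} f with f zero
... | true  = cong suc (trues-not (f ∘ suc))
... | false = ≡-trans (ℕ.+-suc _ _) (cong suc (trues-not (f ∘ suc)))

trues-initial : ∀ n {k} → k ≤ n → trues {n} (λ i → toℕ i <ᵇ k) ≡ k
trues-initial n       {zero}  _         = ≡-trans (trues-const {n} {λ i → toℕ i <ᵇ 0} false λ _ → refl) (ℕ.*-zeroʳ n)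
trues-initial (suc n) {suc k} (s≤s k≤n) = cong suc (trues-initial n k≤n)

matching-value : (f g : Fin (suc n) → Bool) → trues f ≡ trues g → ∃ λ j → g j ≡ f zero
matching-value {n} f g eq with Fin.any? (λ j → g j Bool.≟ f zero)
... | yes found = found
... | no none = ⊥-elim (impossible (f zero) refl (trues-const (not (f zero)) λ j → Bool.¬-not (λ e → none (j , e))))
  where
  impossible : ∀ b → f zero ≡ b → trues g ≡ suc n * bit (not b) → ⊥
  impossible true  fz h = case ≡-trans (≡-sym (cong (λ b → bit b + trues (f ∘ suc)) fz)) (≡-trans eq (≡-trans h (ℕ.*-zeroʳ (suc n)))) of λ ()
  impossible false fz h = ℕ.<-irrefl refl (ℕ.≤-trans
    (ℕ.≤-reflexive (≡-trans (≡-sym (ℕ.*-identityʳ (suc n))) (≡-trans (≡-sym h) (≡-trans (≡-sym eq) (cong (λ b → bit b + trues (f ∘ suc)) fz)))))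
    (trues≤ (f ∘ suc)))

-- The element 0 is sent to some j with the same value; with both removed, the counts still agree.
-- This converts equal part sizes into an isomorphism of bipartite graphs.
match : (f g : Fin n → Bool) → trues f ≡ trues g → ∃ λ (π : Permutation′ n) → ∀ i → f i ≡ g (π ⟨$⟩ʳ i)
match {n = zero}  f g _  = Perm.id , λ ()
match {n = suc n} f g eq with j , gj ← matching-value f g eq
  with π , h ← match (f ∘ suc) (g ∘ punchIn j) (ℕ.+-cancelˡ-≡ (bit (f zero)) _ _
    (≡-trans eq (≡-trans (trues-punchIn g j) (cong (λ b → bit b + trues (g ∘ punchIn j)) gj)))) =
  Perm.insert zero j π , λ
    { zero → ≡-sym gj
    ; (suc i) → ≡-trans (h i) (cong g (≡-sym (Perm.insert-punchIn zero j π i))) }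

-- Edge counting around a vertex of maximum degree

module Mantel {m : ℕ} (G : Graph (suc m)) (free : TriangleFree G) where

  private
    N : ℕ
    N = suc m

  nbrs others : Fin N → List (Fin N)
  nbrs   x = filter (λ y → adj G x y Bool.≟ true) (allFin N)
  others x = filter (¬? ∘ λ y → adj G x y Bool.≟ true) (allFin N)

  ∈-nbrs : ∀ {x y} → adj G x y ≡ true → y ∈ nbrs x
  ∈-nbrs {x} {y} = ∈-filter⁺ (λ y → adj G x y Bool.≟ true) (∈-allFin y)

  ∈-others : ∀ {x y} → adj G x y ≢ true → y ∈ others x
  ∈-others {x} {y} = ∈-filter⁺ (¬? ∘ λ y → adj G x y Bool.≟ true) (∈-allFin y)

  hub : ∃ λ v → ∀ x → length (nbrs x) ≤ length (nbrs v)
  hub with v , max ← largest-fibre nbrs zero (tabulate suc) = v , λ x → max (∈-allFin x)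

  v : Fin N
  v = proj₁ hub

  a b : ℕ
  a = length (nbrs v)
  b = length (others v)

  a+b : a + b ≡ N
  a+b = ≡-trans (length-filter-split (λ y → adj G v y Bool.≟ true) (allFin N)) (List.length-tabulate {n = N} id)

  flip : ∀ {x y} → adj G x y ≡ true → adj G y x ≡ true
  flip {x} {y} eq = ≡-trans (Graph.sym G y x) eq

  -- No edge joins two neighbours of the hub, so every edge is charged to an endpoint that is not one.
  orient : Fin N × Fin N → Fin N × Fin N
  orient (i , j) = if adj G v i then (j , i) else (i , j)

  orient-cases : ∀ {i j} → (i , j) ∈ edges G →
    (adj G v i ≡ true × adj G v j ≢ true × orient (i , j) ≡ (j , i)) ⊎ (adj G v i ≢ true × orient (i , j) ≡ (i , j))
  orient-cases {i} {j} e∈ with adj G v i in eq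
  ... | true  = inj₁ (refl , (λ eq′ → free eq eq′ (proj₂ (∈-edges⁻ G e∈))) , refl)
  ... | false = inj₂ ((λ ()) , refl)

  orient-injective : InjectiveOn orient (edges G)
  orient-injective {i , j} {k , l} p q eq with orient-cases p | orient-cases q
  ... | inj₁ (_ , _ , e) | inj₁ (_ , _ , e′) with refl ← ≡-trans (≡-sym e) (≡-trans eq e′) = refl
  ... | inj₂ (_ , e)     | inj₂ (_ , e′)     = ≡-trans (≡-sym e) (≡-trans eq e′)
  ... | inj₁ (_ , _ , e) | inj₂ (_ , e′) with refl ← ≡-trans (≡-sym e) (≡-trans eq e′) =
    contradiction (proj₁ (∈-edges⁻ G p)) (ℕ.<-asym (proj₁ (∈-edges⁻ G q)))
  ... | inj₂ (_ , e) | inj₁ (_ , _ , e′) with refl ← ≡-trans (≡-sym e) (≡-trans eq e′) =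
    contradiction (proj₁ (∈-edges⁻ G p)) (ℕ.<-asym (proj₁ (∈-edges⁻ G q)))

  arcs : List (Fin N × Fin N)
  arcs = concatMap (λ x → map (x ,_) (nbrs x)) (others v)

  ∈-arcs : ∀ {x y} → adj G v x ≢ true → adj G x y ≡ true → (x , y) ∈ arcs
  ∈-arcs {x} {y} vx xy = ∈-concatMap⁺ (λ x → map (x ,_) (nbrs x))
    (Any.map (λ { refl → ∈-map⁺ (x ,_) (∈-nbrs xy) }) (∈-others vx))

  length-arcs : length arcs ≤ b * a
  length-arcs = length-concatMap-≤ (λ x → map (x ,_) (nbrs x)) (others v) λ {x} _ →
    ℕ.≤-trans (ℕ.≤-reflexive (List.length-map (x ,_) (nbrs x))) (proj₂ hub x)

  orient-∈ : ∀ {e} → e ∈ edges G → orient e ∈ arcs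
  orient-∈ {i , j} e∈ with orient-cases e∈
  ... | inj₁ (_ , vj , e) = subst (_∈ arcs) (≡-sym e) (∈-arcs vj (flip (proj₂ (∈-edges⁻ G e∈))))
  ... | inj₂ (vi , e)     = subst (_∈ arcs) (≡-sym e) (∈-arcs vi (proj₂ (∈-edges⁻ G e∈)))

  b*a≤exK3 : b * a ≤ exK3 N
  b*a≤exK3 = product≤exK3 {b} {a} (≡-trans (ℕ.+-comm b a) a+b)

  mantel : length (edges G) ≤ exK3 N
  mantel = ℕ.≤-trans (injection⇒length≤ orient (edges-unique G) orient-injective orient-∈) (ℕ.≤-trans length-arcs b*a≤exK3)

  module Equality (full : length (edges G) ≡ exK3 N) where

    -- An edge with both ends in `others v` occurs in `arcs` in both directions but is charged only
    -- once. The reversed arc is missed, which makes the count strict.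
    no-outer-edge : ∀ {x y} → toℕ x < toℕ y → adj G v x ≢ true → adj G v y ≢ true → adj G x y ≢ true
    no-outer-edge {x} {y} x<y vx vy xy = ℕ.<-irrefl full (ℕ.<-≤-trans
      (injection⇒length< orient (edges-unique G) orient-injective orient-∈ (∈-arcs vy (flip xy)) avoid)
      (ℕ.≤-trans length-arcs b*a≤exK3))
      where
      avoid : ∀ {e} → e ∈ edges G → orient e ≢ (y , x)
      avoid {i , j} e∈ eq with orient-cases e∈
      ... | inj₁ (vi , _ , e) with refl ← ≡-trans (≡-sym e) eq = vx vi
      ... | inj₂ (_ , e) with refl ← ≡-trans (≡-sym e) eq = ℕ.<-asym x<y (proj₁ (∈-edges⁻ G e∈))

    independent : ∀ {x y} → adj G v x ≢ true → adj G v y ≢ true → adj G x y ≢ true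
    independent {x} {y} vx vy xy with ℕ.<-cmp (toℕ x) (toℕ y)
    ... | tri< x<y _ _ = no-outer-edge x<y vx vy xy
    ... | tri> _ _ y<x = no-outer-edge y<x vy vx (flip xy)
    ... | tri≈ _ e _ with refl ← Fin.toℕ-injective e = case ≡-trans (≡-sym xy) (irrefl G x) of λ ()

    -- As `others v` is independent, orientation embeds the edges into the product of `others v` and
    -- `nbrs v`. A missing pair would leave fewer than b a edges, whereas the number of edges is at
    -- least b a.
    complete : ∀ {x y} → adj G v x ≢ true → adj G v y ≡ true → adj G x y ≡ true
    complete {x} {y} vx vy with adj G x y in xy
    ... | true  = refl
    ... | false = contradiction (injection⇒length< orient (edges-unique G) orient-injective into
      (∈-cartesianProduct⁺ (∈-others vx) (∈-nbrs vy)) avoid)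
      (ℕ.≤⇒≯ (ℕ.≤-trans (ℕ.≤-reflexive (length-cartesianProductWith _,_ (others v) (nbrs v)))
        (ℕ.≤-trans b*a≤exK3 (ℕ.≤-reflexive (≡-sym full)))))
      where
      into : ∀ {e} → e ∈ edges G → orient e ∈ cartesianProduct (others v) (nbrs v)
      into {i , j} e∈ with orient-cases e∈
      ... | inj₁ (vi , vj , e) = subst (_∈ _) (≡-sym e) (∈-cartesianProduct⁺ (∈-others vj) (∈-nbrs vi))
      ... | inj₂ (vi , e) with adj G v j in vj
      ...   | true  = subst (_∈ _) (≡-sym e) (∈-cartesianProduct⁺ (∈-others vi) (∈-nbrs vj))
      ...   | false = contradiction (proj₂ (∈-edges⁻ G e∈)) (independent vi λ eq → case ≡-trans (≡-sym eq) vj of λ ())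
      avoid : ∀ {e} → e ∈ edges G → orient e ≢ (x , y)
      avoid {i , j} e∈ eq with orient-cases e∈
      ... | inj₁ (_ , _ , e) with refl ← ≡-trans (≡-sym e) eq = case ≡-trans (≡-sym xy) (flip (proj₂ (∈-edges⁻ G e∈))) of λ ()
      ... | inj₂ (_ , e) with refl ← ≡-trans (≡-sym e) eq = case ≡-trans (≡-sym xy) (proj₂ (∈-edges⁻ G e∈)) of λ ()

    bipartite : ∀ x y → adj G x y ≡ adj G v x xor adj G v y
    bipartite x y with adj G v x in vx | adj G v y in vy
    ... | true  | true  = Bool.¬-not (free vx vy)
    ... | true  | false = flip (complete (λ e → case ≡-trans (≡-sym e) vy of λ ()) vx)
    ... | false | true  = complete (λ e → case ≡-trans (≡-sym e) vx of λ ()) vy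
    ... | false | false = Bool.¬-not (independent (λ e → case ≡-trans (≡-sym e) vx of λ ()) (λ e → case ≡-trans (≡-sym e) vy of λ ()))

    inA : Fin N → Bool
    inA i = toℕ i <ᵇ (N / 2)

    trues-inA : trues inA ≡ N / 2
    trues-inA = trues-initial N (ℕ.≤-trans (ℕ.m≤m*n (N / 2) 2) (m/n*n≤m N 2))

    trues-nbrs : trues (adj G v) ≡ a
    trues-nbrs = ≡-sym (trues-filter (adj G v) id)

    exK3≤ : exK3 N ≤ b * a
    exK3≤ = ℕ.≤-trans (ℕ.≤-reflexive (≡-sym full))
      (ℕ.≤-trans (injection⇒length≤ orient (edges-unique G) orient-injective orient-∈) length-arcs)

    nbrs-half : a ≤ b → trues (adj G v) ≡ trues inA
    nbrs-half a≤b = begin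
      trues (adj G v)  ≡⟨ trues-nbrs ⟩
      a                ≡⟨ balanced {a} {b} {N} a+b (ℕ.≤-trans exK3≤ (ℕ.≤-reflexive (ℕ.*-comm b a))) a≤b ⟨
      N / 2            ≡⟨ trues-inA ⟨
      trues inA        ∎
      where open ≡-Reasoning

    others-half : b ≤ a → trues (not ∘ adj G v) ≡ trues inA
    others-half b≤a = begin
      trues (not ∘ adj G v)  ≡⟨ ℕ.+-cancelˡ-≡ a (trues (not ∘ adj G v)) b sizes ⟩
      b                      ≡⟨ balanced {b} {a} {N} (≡-trans (ℕ.+-comm b a) a+b) exK3≤ b≤a ⟨
      N / 2                  ≡⟨ trues-inA ⟨
      trues inA              ∎
      where
      open ≡-Reasoning
      sizes : a + trues (not ∘ adj G v) ≡ a + b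
      sizes = ≡-trans (cong (_+ trues (not ∘ adj G v)) (≡-sym trues-nbrs)) (≡-trans (trues-not (adj G v)) (≡-sym a+b))

    iso-from : (f : Fin N → Bool) → (∀ x y → adj G x y ≡ f x xor f y) → trues f ≡ trues inA → G ≅ T2 N
    iso-from f split eq = proj₁ π , λ i j → ≡-trans (split i j) (cong₂ _xor_ (proj₂ π i) (proj₂ π j))
      where
      π : ∃ λ (π : Permutation′ N) → ∀ i → f i ≡ inA (π ⟨$⟩ʳ i)
      π = match f inA eq

    -- `T2` marks a part of size ⌊N / 2⌋, so the smaller of the two sides must be the marked one.
    -- Complementing both arguments leaves xor unchanged.
    iso : G ≅ T2 N
    iso = [ (λ a≤b → iso-from (adj G v) bipartite (nbrs-half a≤b))
          , (λ b≤a → iso-from (not ∘ adj G v) (λ x y → ≡-trans (bipartite x y) (not-xor (adj G v x) (adj G v y))) (others-half b≤a))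
          ]′ (ℕ.≤-total a b)
      where
      not-xor : ∀ x y → x xor y ≡ not x xor not y
      not-xor true  true  = refl
      not-xor true  false = refl
      not-xor false true  = refl
      not-xor false false = refl

-- Triangles and edges of the Turán graph

module Turán {n : ℕ} (G : Graph n) (G≅ : G ≅ T2 n) where

  π : Permutation′ n
  π = proj₁ G≅

  inA : Fin n → Bool
  inA i = toℕ i <ᵇ (n / 2)

  adj≡ : ∀ i j → adj G i j ≡ inA (π ⟨$⟩ʳ i) xor inA (π ⟨$⟩ʳ j)
  adj≡ = proj₂ G≅

  triangleFree : TriangleFree G
  triangleFree {i} {j} {k} ij ik jk = xor-odd (inA (π ⟨$⟩ʳ i)) (inA (π ⟨$⟩ʳ j)) (inA (π ⟨$⟩ʳ k))
    (≡-trans (≡-sym (adj≡ i j)) ij) (≡-trans (≡-sym (adj≡ i k)) ik) (≡-trans (≡-sym (adj≡ j k)) jk)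
    where
    xor-odd : ∀ x y z → x xor y ≡ true → x xor z ≡ true → y xor z ≡ true → ⊥
    xor-odd true  true  _     () _ _
    xor-odd true  false true  _ () _
    xor-odd true  false false _ _ ()
    xor-odd false true  true  _ _ ()
    xor-odd false true  false _ () _
    xor-odd false false _     () _ _

  As Bs : List (Fin n)
  As = filter (λ i → inA i Bool.≟ true) (allFin n)
  Bs = filter (¬? ∘ λ i → inA i Bool.≟ true) (allFin n)

  place : Fin n × Fin n → Fin n × Fin n
  place (p , q) = let i = π ⟨$⟩ˡ p ; j = π ⟨$⟩ˡ q in if toℕ i <ᵇ toℕ j then (i , j) else (j , i)

  ∈-product : ∀ {p q} → (p , q) ∈ cartesianProduct As Bs → inA p ≡ true × inA q ≡ false
  ∈-product pq∈ with p∈ , q∈ ← ∈-cartesianProduct⁻ As Bs pq∈ =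
    proj₂ (∈-filter⁻ (λ i → inA i Bool.≟ true) {xs = allFin n} p∈) ,
    Bool.¬-not (proj₂ (∈-filter⁻ (¬? ∘ λ i → inA i Bool.≟ true) {xs = allFin n} q∈))

  ˡ-injective : ∀ {p q} → π ⟨$⟩ˡ p ≡ π ⟨$⟩ˡ q → p ≡ q
  ˡ-injective {p} {q} eq = ≡-trans (≡-sym (Perm.inverseʳ π)) (≡-trans (cong (π ⟨$⟩ʳ_) eq) (Perm.inverseʳ π))

  place-cases : ∀ p q → (toℕ (π ⟨$⟩ˡ p) < toℕ (π ⟨$⟩ˡ q) × place (p , q) ≡ (π ⟨$⟩ˡ p , π ⟨$⟩ˡ q)) ⊎
    (¬ toℕ (π ⟨$⟩ˡ p) < toℕ (π ⟨$⟩ˡ q) × place (p , q) ≡ (π ⟨$⟩ˡ q , π ⟨$⟩ˡ p))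
  place-cases p q with toℕ (π ⟨$⟩ˡ p) <ᵇ toℕ (π ⟨$⟩ˡ q) in eq
  ... | true  = inj₁ (ℕ.<ᵇ⇒< _ _ (≡⇒T eq) , refl)
  ... | false = inj₂ ((λ lt → case ≡-trans (≡-sym (T⇒≡ (ℕ.<⇒<ᵇ lt))) eq of λ ()) , refl)

  adjacent : ∀ {p q} → inA p ≡ true → inA q ≡ false → adj G (π ⟨$⟩ˡ p) (π ⟨$⟩ˡ q) ≡ true
  adjacent {p} {q} pA qB = ≡-trans (adj≡ _ _) (cong₂ _xor_ (≡-trans (cong inA (Perm.inverseʳ π)) pA) (≡-trans (cong inA (Perm.inverseʳ π)) qB))

  exK3≤edges : exK3 n ≤ length (edges G)
  exK3≤edges = begin
    exK3 n                           ≤⟨ exK3≤halves n ⟩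
    n / 2 * (n ∸ n / 2)              ≡⟨ cong₂ _*_ |As| |Bs| ⟨
    length As * length Bs            ≡⟨ length-cartesianProductWith _,_ As Bs ⟨
    length (cartesianProduct As Bs)  ≤⟨ injection⇒length≤ place
                                          (Unique.cartesianProduct⁺ (Unique.filter⁺ _ (Unique.allFin⁺ n)) (Unique.filter⁺ _ (Unique.allFin⁺ n))) inj into ⟩
    length (edges G)                 ∎
    where
    open ℕ.≤-Reasoning
    |As| : length As ≡ n / 2
    |As| = ≡-trans (trues-filter inA id) (trues-initial n (ℕ.≤-trans (ℕ.m≤m*n (n / 2) 2) (m/n*n≤m n 2)))
    |Bs| : length Bs ≡ n ∸ n / 2
    |Bs| = ℕ.+-cancelˡ-≡ (n / 2) _ _ (≡-trans (cong (_+ length Bs) (≡-sym |As|))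
      (≡-trans (length-filter-split (λ i → inA i Bool.≟ true) (allFin n)) (≡-trans (List.length-tabulate {n = n} id) (≡-sym (half-split n)))))
    into : ∀ {e} → e ∈ cartesianProduct As Bs → place e ∈ edges G
    into {p , q} e∈ with pA , qB ← ∈-product e∈ with place-cases p q
    ... | inj₁ (lt , eq) = subst (_∈ edges G) (≡-sym eq) (∈-edges⁺ G lt (adjacent pA qB))
    ... | inj₂ (ge , eq) = subst (_∈ edges G) (≡-sym eq) (∈-edges⁺ G
      (ℕ.≤∧≢⇒< (ℕ.≮⇒≥ ge) λ e → case ≡-trans (≡-sym pA) (≡-trans (cong inA (≡-sym (ˡ-injective (Fin.toℕ-injective e)))) qB) of λ ())
      (≡-trans (Graph.sym G _ _) (adjacent pA qB)))
    inj : InjectiveOn place (cartesianProduct As Bs)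
    inj {p , q} {p′ , q′} e∈ e∈′ eq with pA , qB ← ∈-product e∈ | pA′ , qB′ ← ∈-product e∈′ with place-cases p q | place-cases p′ q′
    ... | inj₁ (_ , e) | inj₁ (_ , e′) with ≡-trans (≡-sym e) (≡-trans eq e′)
    ...   | f = cong₂ _,_ (ˡ-injective (Product.,-injectiveˡ f)) (ˡ-injective (Product.,-injectiveʳ f))
    inj {p , q} {p′ , q′} e∈ e∈′ eq | inj₂ (_ , e) | inj₂ (_ , e′) with ≡-trans (≡-sym e) (≡-trans eq e′)
    ...   | f = cong₂ _,_ (ˡ-injective (Product.,-injectiveʳ f)) (ˡ-injective (Product.,-injectiveˡ f))
    inj {p , q} {p′ , q′} e∈ e∈′ eq | inj₁ (_ , e) | inj₂ (_ , e′) =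
      case ≡-trans (≡-sym pA) (≡-trans (cong inA (ˡ-injective (Product.,-injectiveˡ (≡-trans (≡-sym e) (≡-trans eq e′))))) qB′) of λ ()
    inj {p , q} {p′ , q′} e∈ e∈′ eq | inj₂ (_ , e) | inj₁ (_ , e′) =
      case ≡-trans (≡-sym pA′) (≡-trans (cong inA (≡-sym (ˡ-injective (Product.,-injectiveˡ (≡-trans (≡-sym e) (≡-trans eq e′)))))) qB) of λ ()

-- The extremal theorem

Triangle : Graph n → Set
Triangle G = ∃ λ a → ∃ λ b → ∃ λ c → adj G a b ≡ true × adj G a c ≡ true × adj G b c ≡ true

triangle? : (G : Graph n) → Dec (Triangle G)
triangle? G = Fin.any? λ a → Fin.any? λ b → Fin.any? λ c →
  (adj G a b Bool.≟ true) ×-dec (adj G a c Bool.≟ true) ×-dec (adj G b c Bool.≟ true)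

¬triangle⇒free : (G : Graph n) → ¬ Triangle G → TriangleFree G
¬triangle⇒free G none ab ac bc = none (_ , _ , _ , ab , ac , bc)

triangle-count : ∀ {m r d} → 1 < r → Gains r d →
  (let N = suc m ; e = 2 * (2 * suc d) in
   ¬ ((r ^ exK3 N) ^ e ≤ (((N + N) ^ r) ^ N) ^ e * r ^ (d * (N * N) + 12 * suc d * N))) →
  (G : Graph (suc m)) → Triangle G → count r G < r ^ exK3 (suc m)
triangle-count {m} {r} {d} 1<r gains large G tri = ℕ.≰⇒> λ ex≤ → climb (length (matrices r (suc m)) ∸ count r G) G ℕ.≤-refl tri ex≤
  where
  instance
    r≢0 : NonZero r
    r≢0 = >-nonZero (ℕ.<⇒≤ 1<r)
  count≤total : ∀ (H : Graph (suc m)) → count r H ≤ length (matrices r (suc m))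
  count≤total H = List.length-filter (valid? H) (matrices r (suc m))
  -- A larger count at H again comes from a graph with a triangle, so G may be taken maximal.
  climb : ∀ k (G : Graph (suc m)) → length (matrices r (suc m)) ∸ count r G ≤ k → Triangle G → r ^ exK3 (suc m) ≤ count r G → ⊥
  climb k G gap (a , b , c , ab , ac , bc) ex≤ = large (ℕ.≤-trans (ℕ.^-monoˡ-≤ (2 * (2 * suc d)) ex≤)
    (Zykov.extremal-bound r a b c 1<r gains G record { maximal = maximal k gap ; ab = ab ; ac = ac ; bc = bc }))
    where
    maximal : ∀ k → length (matrices r (suc m)) ∸ count r G ≤ k → ∀ H → count r H ≤ count r G
    maximal k gap H with count r H ≤? count r G
    ... | yes H≤G = H≤G
    ... | no H≰G with triangle? H
    -- A triangle-free H cannot pass the threshold that G is assumed to reach.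
    ...   | no free = ℕ.≤-trans (count≤ r H) (ℕ.≤-trans
              (ℕ.^-monoʳ-≤ r (Mantel.mantel H (¬triangle⇒free H free))) ex≤)
    ...   | yes tri with k | gap
    ...     | zero   | gap = contradiction (ℕ.≤-trans (count≤total H) (ℕ.m∸n≡0⇒m≤n (ℕ.n≤0⇒n≡0 gap))) H≰G
    ...     | suc k′ | gap = ⊥-elim (climb k′ H
              (ℕ.≤-pred (ℕ.<-≤-trans (ℕ.∸-monoʳ-< (ℕ.≰⇒> H≰G) (count≤total H)) gap)) tri (ℕ.≤-trans ex≤ (ℕ.<⇒≤ (ℕ.≰⇒> H≰G))))

theorem1p1 : (r : ℕ) → 2 ≤ r → r ≤ 26 →
    ∃ λ n₀ → ∀ n → n₀ ≤ n → (G : Graph n) →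
    (cK32 r G ≤ r ^ exK3 n) × ((cK32 r G ≡ r ^ exK3 n) ⇔ (G ≅ T2 n))
theorem1p1 r 2≤r r≤26 =
  let d , gain = gains 2≤r r≤26
      n₁ , large = below-threshold d 2≤r
  -- The successor excludes n = 0, as the choice of a maximum-degree vertex requires.
  in suc n₁ , λ { (suc m) (s≤s n₁≤m) G → result m (large (suc m) (ℕ.m≤n⇒m≤1+n n₁≤m)) gain G }
  where
  result : ∀ m {d} → ¬ ((r ^ exK3 (suc m)) ^ (2 * (2 * suc d)) ≤
      (((suc m + suc m) ^ r) ^ suc m) ^ (2 * (2 * suc d)) * r ^ (d * (suc m * suc m) + 12 * suc d * suc m)) → Gains r d → (G : Graph (suc m)) →
    (cK32 r G ≤ r ^ exK3 (suc m)) × ((cK32 r G ≡ r ^ exK3 (suc m)) ⇔ (G ≅ T2 (suc m)))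
  result m {d} large gain G with triangle? G
  ... | yes tri = ℕ.<⇒≤ below , mk⇔ (λ eq → contradiction eq (ℕ.<⇒≢ below))
      (λ G≅ → let _ , _ , _ , ab , ac , bc = tri in ⊥-elim (Turán.triangleFree G G≅ ab ac bc))
    where
    below : cK32 r G < r ^ exK3 (suc m)
    below = ℕ.≤-<-trans (cK32≤count r G) (triangle-count 2≤r gain large G tri)
  ... | no none = ℕ.≤-trans (ℕ.≤-reflexive exact) (ℕ.^-monoʳ-≤ r mantel) , mk⇔
      (λ eq → Equality.iso (ℕ.≤-antisym mantel (ℕ.≮⇒≥ λ lt → ℕ.<⇒≢ (ℕ.^-monoʳ-< r 2≤r lt) (≡-trans (≡-sym exact) eq))))
      (λ G≅ → ≡-trans exact (cong (r ^_) (ℕ.≤-antisym mantel (Turán.exK3≤edges G G≅))))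
    where
    open Mantel G (¬triangle⇒free G none)
    instance
      r≢0 : NonZero r
      r≢0 = >-nonZero (ℕ.<⇒≤ 2≤r)
    exact : cK32 r G ≡ r ^ length (edges G)
    exact = cK32-triangleFree G (¬triangle⇒free G none)
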